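{- Let $n,r\ge 1$ be integers. The set of superspace monomials $\mathcal{A}_{n,r}\subseteq\Omega$ descends to a $\mathbb{C}$-vector space basis of the superspace coinvariant ring $SR_{n,r}=\Omega/SI_{n,r}$ of $\mathbb{Z}_r\wr\mathfrak{S}_n$.
   Context: Write $[n]=\{1,\dots,n\}$ and $\zeta=\exp(2\pi i/r)$. $\mathbb{Z}_r\wr\mathfrak{S}_n$ is the group of $n\times n$ complex monomial matrices (exactly one nonzero entry in each row and column) whose nonzero entries are $r$-th roots of unity. $\Omega=\mathbb{C}[x_1,\dots,x_n]\otimes\wedge\{\theta_1,\dots,\theta_n\}$ is the unital associative $\mathbb{C}$-algebra generated by $x_i,\theta_i$ with relations $x_ix_j=x_jx_i$, $x_i\theta_j=\theta_jx_i$, $\theta_i\theta_j=-\theta_j\theta_i$. The group acts on $\Omega$ by algebra automorphisms: $\mathrm{diag}(\zeta^{c_1},\dots,\zeta^{c_n})$ sends $x_i\mapsto\zeta^{ -c_i}x_i$, $\theta_i\mapsto\zeta^{ -c_i}\theta_i$, and a permutation matrix $w$ sends $x_i\mapsto x_{w(i)}$, $\theta_i\mapsto\theta_{w(i)}$. $SI_{n,r}\subseteq\Omega$ is the two-sided ideal generated by all $(\mathbb{Z}_r\wr\mathfrak{S}_n)$-invariant elements with vanishing constant term, and $SR_{n,r}:=\Omega/SI_{n,r}$. For $J\subseteq[n]$ let $\theta_J:=\prod_{j\in J}\theta_j$ (product in increasing order). The $(J,r)$-staircase $\mathrm{st}(J,r)=(\mathrm{st}(J,r)_1,\dots,\mathrm{st}(J,r)_n)$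 is defined as follows. Write $[n]-J=\{u_1<\cdots<u_k\}$, $u_0:=0$, $u_{k+1}:=n+1$. Set $\mathrm{st}(J,r)_{u_i}:=ir-1$ for $1\le i\le k$; for $j\in J$, set $\mathrm{st}(J,r)_j:=ir-2$, where $1\le i\le k+1$ is the unique index with $u_{i-1}<j<u_i$. $\mathcal{A}_{n,r}(J,r):=\{x_1^{a_1}\cdots x_n^{a_n}: 0\le a_i\le \mathrm{st}(J,r)_i\text{ for all }i\}$ (empty if some $\mathrm{st}(J,r)_i<0$), and $\mathcal{A}_{n,r}:=\bigsqcup_{J\subseteq[n]}\mathcal{A}_{n,r}(J,r)\cdot\theta_J$. "Descends to a basis" means that the images in the quotient form a basis. -}

module Defs where

open import Level using (Level; 0ℓ; _⊔_)
open import Algebra.Bundles using (CommutativeRing; Ring)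
open import Algebra.Module.Bundles using (LeftModule)
import Algebra.Construct.DirectProduct as Product
import Algebra.Properties.AbelianGroup as AbelianGroupProperties
import Algebra.Properties.Ring as RingProperties
import Algebra.Properties.Semiring.Exp as Exp
import Algebra.Solver.Ring.NaturalCoefficients.Default as SemiringSolver
open import Data.Fin.Base using (Fin; toℕ)
open import Data.Fin.Permutation using (Permutation′; _⟨$⟩ʳ_)
open import Data.Fin.Subset using (Subset; Side; inside; outside)
import Data.Integer.Base as ℤ
open import Data.List.Base using (List; []; _∷_)
open import Data.List.Relation.Unary.All using (All)
open import Data.List.Relation.Unary.Unique.Propositional using (Unique)
open import Data.Nat.Base as ℕ using (ℕ; suc; _∸_)
import Data.Nat.Properties as ℕ
open import Data.Product.Base using (_×_; _,_; ∃-syntax; ∃₂)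
open import Data.Rational.Base as ℚ using (ℚ; 0ℚ; 1ℚ; ½; ∣_∣)
import Data.Rational.Properties as ℚ
open import Data.Vec.Base using (Vec; []; _∷_; lookup)
import Data.Vec.Functional as Vector
open import Relation.Binary.Core using (Rel)
open import Relation.Binary.PropositionalEquality as ≡ using (_≡_)
open import Relation.Binary.Structures using (IsEquivalence)
open import Relation.Nullary.Negation using (¬_)
open import Relation.Unary using (Pred)

private
  -- Rearrangements of differences, used for null sequences and for ideals.
  module Differences {c ℓ : Level} (R : Ring c ℓ) where

    open Ring R
    open AbelianGroupProperties +-abelianGroup using (⁻¹-∙-comm; ⁻¹-involutive)
    open RingProperties R using (-‿distribʳ-*)

    diff-neg : ∀ f g → - (f - g) ≈ - f - - g
    diff-neg f g = sym (⁻¹-∙-comm f (- g))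

    diff-swap : ∀ f g → - (f - g) ≈ g - f
    diff-swap f g = trans (diff-neg f g)
      (trans (+-congˡ (⁻¹-involutive g)) (+-comm (- f) g))

    diff-trans : ∀ f g h → (f - g) + (g - h) ≈ f - h
    diff-trans f g h = trans (+-assoc f (- g) (g - h))
      (+-congˡ (trans (sym (+-assoc (- g) g (- h)))
        (trans (+-congʳ (-‿inverseˡ g)) (+-identityˡ (- h)))))

    diff-+ : ∀ f g f′ g′ → (f - g) + (f′ - g′) ≈ (f + f′) - (g + g′)
    diff-+ f g f′ g′ = trans (+-assoc f (- g) (f′ - g′))
      (trans (+-congˡ (trans (sym (+-assoc (- g) f′ (- g′)))
        (trans (+-congʳ (+-comm (- g) f′))
        (trans (+-assoc f′ (- g) (- g′))
          (+-congˡ (⁻¹-∙-comm g g′))))))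
        (sym (+-assoc f f′ (- (g + g′)))))

    diff-*ˡ : ∀ h f g → h * (f - g) ≈ h * f - h * g
    diff-*ˡ h f g = trans (distribˡ h f (- g))
      (+-congˡ (sym (-‿distribʳ-* h g)))

    split : ∀ f g → g ≈ f + (g - f)
    split f g = sym (trans (+-comm f (g - f)) (trans (+-assoc g (- f) f)
      (trans (+-congˡ (-‿inverseˡ f)) (+-identityʳ g))))

------------------------------------------------------------------------
-- Real numbers: Cauchy sequences of rationals modulo null sequences

module Real where

  Cauchy : (ℕ → ℚ) → Set
  Cauchy f = ∀ ε → 0ℚ ℚ.< ε →
    ∃[ N ] (∀ m n → N ℕ.≤ m → N ℕ.≤ n → ∣ f m ℚ.- f n ∣ ℚ.< ε)

  Null : (ℕ → ℚ) → Set
  Null f = ∀ ε → 0ℚ ℚ.< ε → ∃[ N ] (∀ n → N ℕ.≤ n → ∣ f n ∣ ℚ.< ε)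

  record ℝ : Set where
    constructor mkℝ
    field
      seq    : ℕ → ℚ
      cauchy : Cauchy seq

  open ℝ public

  infix 4 _≈_

  _≈_ : Rel ℝ 0ℓ
  x ≈ y = Null (λ n → seq x n ℚ.- seq y n)

  private
    open Differences ℚ.+-*-ring

    half-pos : ∀ {ε} → 0ℚ ℚ.< ε → 0ℚ ℚ.< ε ℚ.* ½
    half-pos {ε} ε>0 =
      ≡.subst (ℚ._< ε ℚ.* ½) (ℚ.*-zeroˡ ½) (ℚ.*-monoˡ-<-pos ½ ε>0)

    halves : ∀ ε → ε ℚ.* ½ ℚ.+ ε ℚ.* ½ ≡ ε
    halves ε = ≡.trans (≡.sym (ℚ.*-distribˡ-+ ε ½ ½)) (ℚ.*-identityʳ ε)

    small-+ : ∀ a b {ε} → ∣ a ∣ ℚ.< ε ℚ.* ½ → ∣ b ∣ ℚ.< ε ℚ.* ½ →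
              ∣ a ℚ.+ b ∣ ℚ.< ε
    small-+ a b {ε} p q = ≡.subst (∣ a ℚ.+ b ∣ ℚ.<_) (halves ε)
      (ℚ.≤-<-trans (ℚ.∣p+q∣≤∣p∣+∣q∣ a b) (ℚ.+-mono-< p q))

    -- the quotient ε / B together with its defining properties
    divide : ∀ ε B → 0ℚ ℚ.< ε → 0ℚ ℚ.< B →
             ∃[ δ ] (0ℚ ℚ.< δ × B ℚ.* δ ≡ ε)
    divide ε B ε>0 B>0 = ℚ.1/ B ℚ.* ε , δ>0 , eq
      where
      instance
        _ = ℚ.positive B>0
        _ = ℚ.positive ε>0
        B≢0 = ℚ.pos⇒nonZero B
        _ = ℚ.1/pos⇒pos B
      δ>0 = ℚ.positive⁻¹ (ℚ.1/ B ℚ.* ε) {{ℚ.pos*pos⇒pos (ℚ.1/ B) ε}}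
      eq : B ℚ.* (ℚ.1/ B ℚ.* ε) ≡ ε
      eq = ≡.trans (≡.sym (ℚ.*-assoc B (ℚ.1/ B) ε))
          (≡.trans (≡.cong (ℚ._* ε) (ℚ.*-inverseʳ B)) (ℚ.*-identityˡ ε))

    small-* : ∀ a b {B δ ε} → 0ℚ ℚ.< B → ∣ a ∣ ℚ.≤ B → ∣ b ∣ ℚ.< δ →
              B ℚ.* δ ≡ ε → ∣ a ℚ.* b ∣ ℚ.< ε
    small-* a b {B} {δ} {ε} B>0 p q eq = begin-strict
      ∣ a ℚ.* b ∣      ≡⟨ ℚ.∣p*q∣≡∣p∣*∣q∣ a b ⟩
      ∣ a ∣ ℚ.* ∣ b ∣  ≤⟨ ℚ.*-monoʳ-≤-nonNeg ∣ b ∣ p ⟩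
      B ℚ.* ∣ b ∣      <⟨ ℚ.*-monoʳ-<-pos B q ⟩
      B ℚ.* δ          ≡⟨ eq ⟩
      ε                ∎
      where
      open ℚ.≤-Reasoning
      instance
        _ = ℚ.positive B>0
        _ = ℚ.∣-∣-nonNeg b

    bound : ∀ x → ∃₂ λ B N → 0ℚ ℚ.< B × (∀ n → N ℕ.≤ n → ∣ seq x n ∣ ℚ.≤ B)
    bound x with cauchy x 1ℚ (ℚ.positive⁻¹ 1ℚ)
    ... | N , h = ∣ f N ∣ ℚ.+ 1ℚ , N , B>0 , le
      where
      f = seq x
      B>0 : 0ℚ ℚ.< ∣ f N ∣ ℚ.+ 1ℚ
      B>0 = ≡.subst (ℚ._< ∣ f N ∣ ℚ.+ 1ℚ) (ℚ.+-identityˡ 0ℚ)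
              (ℚ.+-mono-≤-< (ℚ.0≤∣p∣ (f N)) (ℚ.positive⁻¹ 1ℚ))
      le : ∀ n → N ℕ.≤ n → ∣ f n ∣ ℚ.≤ ∣ f N ∣ ℚ.+ 1ℚ
      le n N≤n = begin
        ∣ f n ∣                      ≡⟨ ≡.cong ∣_∣ (split (f N) (f n)) ⟩
        ∣ f N ℚ.+ (f n ℚ.- f N) ∣    ≤⟨ ℚ.∣p+q∣≤∣p∣+∣q∣ (f N) (f n ℚ.- f N) ⟩
        ∣ f N ∣ ℚ.+ ∣ f n ℚ.- f N ∣  ≤⟨ ℚ.+-monoʳ-≤ ∣ f N ∣
                                          (ℚ.<⇒≤ (h n N N≤n ℕ.≤-refl)) ⟩
        ∣ f N ∣ ℚ.+ 1ℚ               ∎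
        where
        open ℚ.≤-Reasoning

    null-+ : ∀ {f g} → Null f → Null g → Null (λ n → f n ℚ.+ g n)
    null-+ {f} {g} p q ε ε>0 with p (ε ℚ.* ½) (half-pos ε>0) | q (ε ℚ.* ½) (half-pos ε>0)
    ... | M , h | N , k = M ℕ.⊔ N , λ n l →
      small-+ (f n) (g n) (h n (ℕ.m⊔n≤o⇒m≤o M N l)) (k n (ℕ.m⊔n≤o⇒n≤o M N l))

    null-neg : ∀ {f} → Null f → Null (λ n → ℚ.- f n)
    null-neg {f} p ε ε>0 with p ε ε>0
    ... | N , h = N , λ n l →
      ≡.subst (ℚ._< ε) (≡.sym (ℚ.∣-p∣≡∣p∣ (f n))) (h n l)

    null-ext : ∀ {f g} → (∀ n → f n ≡ g n) → Null f → Null g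
    null-ext e p ε ε>0 with p ε ε>0
    ... | N , h = N , λ n l → ≡.subst (λ q → ∣ q ∣ ℚ.< ε) (e n) (h n l)

    null-* : ∀ x {f} → Null f → Null (λ n → seq x n ℚ.* f n)
    null-* x {f} p ε ε>0 =
      let B , M , B>0 , b = bound x
          δ , δ>0 , eq    = divide ε B ε>0 B>0
          N , h           = p δ δ>0
      in M ℕ.⊔ N , λ n l →
        small-* (seq x n) (f n) {B} {δ} {ε} B>0
          (b n (ℕ.m⊔n≤o⇒m≤o M N l)) (h n (ℕ.m⊔n≤o⇒n≤o M N l)) eq

    pointwise : ∀ {x y} → (∀ n → seq x n ≡ seq y n) → x ≈ y
    pointwise {x} {y} e ε ε>0 = 0 , λ n _ →
      ≡.subst (λ q → ∣ q ∣ ℚ.< ε)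
        (≡.sym (≡.trans (≡.cong (ℚ._- seq y n) (e n)) (ℚ.+-inverseʳ (seq y n))))
        ε>0

    diff-* : ∀ a b c d →
      a ℚ.* (b ℚ.- d) ℚ.+ d ℚ.* (a ℚ.- c) ≡ a ℚ.* b ℚ.- c ℚ.* d
    diff-* a b c d = ≡.trans (≡.cong₂ ℚ._+_ (diff-*ˡ a b d) (diff-*ˡ d a c))
      (≡.trans (≡.cong₂ (λ p q → (a ℚ.* b ℚ.- p) ℚ.+ (d ℚ.* a ℚ.- q))
                        (ℚ.*-comm a d) (ℚ.*-comm d c))
               (diff-trans (a ℚ.* b) (d ℚ.* a) (c ℚ.* d)))

  infixl 6 _+_
  infixl 7 _*_
  infix  8 -_

  fromℚ : ℚ → ℝ
  fromℚ q = mkℝ (λ _ → q) λ ε ε>0 → 0 , λ _ _ _ _ →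
    ≡.subst (λ p → ∣ p ∣ ℚ.< ε) (≡.sym (ℚ.+-inverseʳ q)) ε>0

  _+_ : ℝ → ℝ → ℝ
  x + y = mkℝ (λ n → seq x n ℚ.+ seq y n) c
    where
    c : Cauchy (λ n → seq x n ℚ.+ seq y n)
    c ε ε>0 with cauchy x (ε ℚ.* ½) (half-pos ε>0)
               | cauchy y (ε ℚ.* ½) (half-pos ε>0)
    ... | M , h | N , k = M ℕ.⊔ N , λ m n l l′ →
      ≡.subst (λ p → ∣ p ∣ ℚ.< ε)
        (diff-+ (seq x m) (seq x n) (seq y m) (seq y n))
        (small-+ (seq x m ℚ.- seq x n) (seq y m ℚ.- seq y n)
                 (h m n (ℕ.m⊔n≤o⇒m≤o M N l) (ℕ.m⊔n≤o⇒m≤o M N l′))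
                 (k m n (ℕ.m⊔n≤o⇒n≤o M N l) (ℕ.m⊔n≤o⇒n≤o M N l′)))

  -_ : ℝ → ℝ
  - x = mkℝ (λ n → ℚ.- seq x n) c
    where
    c : Cauchy (λ n → ℚ.- seq x n)
    c ε ε>0 with cauchy x ε ε>0
    ... | N , h = N , λ m n l l′ → ≡.subst (ℚ._< ε)
      (≡.trans (≡.sym (ℚ.∣-p∣≡∣p∣ (seq x m ℚ.- seq x n)))
               (≡.cong ∣_∣ (diff-neg (seq x m) (seq x n))))
      (h m n l l′)

  _*_ : ℝ → ℝ → ℝ
  x * y = mkℝ (λ n → seq x n ℚ.* seq y n) c
    where
    c : Cauchy (λ n → seq x n ℚ.* seq y n)
    c ε ε>0 =
      let A , N₁ , A>0 , a = bound x
          B , N₂ , B>0 , b = bound y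
          α , α>0 , eqA    = divide (ε ℚ.* ½) A (half-pos ε>0) A>0
          β , β>0 , eqB    = divide (ε ℚ.* ½) B (half-pos ε>0) B>0
          N₃ , h           = cauchy y α α>0
          N₄ , k           = cauchy x β β>0
      in (N₁ ℕ.⊔ N₂) ℕ.⊔ (N₃ ℕ.⊔ N₄) , λ m n l l′ →
        let l₁₂  = ℕ.m⊔n≤o⇒m≤o (N₁ ℕ.⊔ N₂) (N₃ ℕ.⊔ N₄) l
            l₃₄  = ℕ.m⊔n≤o⇒n≤o (N₁ ℕ.⊔ N₂) (N₃ ℕ.⊔ N₄) l
            l₁₂′ = ℕ.m⊔n≤o⇒m≤o (N₁ ℕ.⊔ N₂) (N₃ ℕ.⊔ N₄) l′
            l₃₄′ = ℕ.m⊔n≤o⇒n≤o (N₁ ℕ.⊔ N₂) (N₃ ℕ.⊔ N₄) l′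
        in ≡.subst (λ p → ∣ p ∣ ℚ.< ε)
          (diff-* (seq x m) (seq y m) (seq x n) (seq y n))
          (small-+ (seq x m ℚ.* (seq y m ℚ.- seq y n))
                   (seq y n ℚ.* (seq x m ℚ.- seq x n))
            (small-* (seq x m) (seq y m ℚ.- seq y n) {A} {α}
              A>0 (a m (ℕ.m⊔n≤o⇒m≤o N₁ N₂ l₁₂))
              (h m n (ℕ.m⊔n≤o⇒m≤o N₃ N₄ l₃₄) (ℕ.m⊔n≤o⇒m≤o N₃ N₄ l₃₄′)) eqA)
            (small-* (seq y n) (seq x m ℚ.- seq x n) {B} {β}
              B>0 (b n (ℕ.m⊔n≤o⇒n≤o N₁ N₂ l₁₂′))
              (k m n (ℕ.m⊔n≤o⇒n≤o N₃ N₄ l₃₄) (ℕ.m⊔n≤o⇒n≤o N₃ N₄ l₃₄′)) eqB))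

  private
    ≈-refl : ∀ {x} → x ≈ x
    ≈-refl {x} = pointwise {x} {x} λ _ → ≡.refl

    ≈-sym : ∀ {x y} → x ≈ y → y ≈ x
    ≈-sym {x} {y} p =
      null-ext (λ n → diff-swap (seq x n) (seq y n)) (null-neg p)

    ≈-trans : ∀ {x y z} → x ≈ y → y ≈ z → x ≈ z
    ≈-trans {x} {y} {z} p q =
      null-ext (λ n → diff-trans (seq x n) (seq y n) (seq z n)) (null-+ p q)

    +-cong : ∀ {x x′ y y′} → x ≈ x′ → y ≈ y′ → x + y ≈ x′ + y′
    +-cong {x} {x′} {y} {y′} p q =
      null-ext (λ n → diff-+ (seq x n) (seq x′ n) (seq y n) (seq y′ n))
               (null-+ p q)

    neg-cong : ∀ {x y} → x ≈ y → - x ≈ - y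
    neg-cong {x} {y} p =
      null-ext (λ n → diff-neg (seq x n) (seq y n)) (null-neg p)

    *-cong : ∀ {x x′ y y′} → x ≈ x′ → y ≈ y′ → x * y ≈ x′ * y′
    *-cong {x} {x′} {y} {y′} p q =
      null-ext (λ n → diff-* (seq x n) (seq y n) (seq x′ n) (seq y′ n))
               (null-+ (null-* x q) (null-* y′ p))

  commutativeRing : CommutativeRing 0ℓ 0ℓ
  commutativeRing = record
    { Carrier = ℝ
    ; _≈_ = _≈_
    ; _+_ = _+_
    ; _*_ = _*_
    ; -_ = -_
    ; 0# = fromℚ 0ℚ
    ; 1# = fromℚ 1ℚ
    ; isCommutativeRing = record
      { isRing = record
        { +-isAbelianGroup = record
          { isGroup = record
            { isMonoid = record
              { isSemigroup = record
                { isMagma = record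
                  { isEquivalence = record
                    { refl = λ {x} → ≈-refl {x}
                    ; sym = λ {x} {y} → ≈-sym {x} {y}
                    ; trans = λ {x} {y} {z} → ≈-trans {x} {y} {z}
                    }
                  ; ∙-cong = λ {x} {x′} {y} {y′} → +-cong {x} {x′} {y} {y′}
                  }
                ; assoc = λ x y z → pointwise {(x + y) + z} {x + (y + z)} λ n →
                    ℚ.+-assoc (seq x n) (seq y n) (seq z n)
                }
              ; identity =
                  (λ x → pointwise {fromℚ 0ℚ + x} {x} λ n → ℚ.+-identityˡ (seq x n))
                , (λ x → pointwise {x + fromℚ 0ℚ} {x} λ n → ℚ.+-identityʳ (seq x n))
              }
            ; inverse =
                (λ x → pointwise { - x + x} {fromℚ 0ℚ} λ n → ℚ.+-inverseˡ (seq x n))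
              , (λ x → pointwise {x + - x} {fromℚ 0ℚ} λ n → ℚ.+-inverseʳ (seq x n))
            ; ⁻¹-cong = λ {x} {y} → neg-cong {x} {y}
            }
          ; comm = λ x y → pointwise {x + y} {y + x} λ n →
              ℚ.+-comm (seq x n) (seq y n)
          }
        ; *-cong = λ {x} {x′} {y} {y′} → *-cong {x} {x′} {y} {y′}
        ; *-assoc = λ x y z → pointwise {(x * y) * z} {x * (y * z)} λ n →
            ℚ.*-assoc (seq x n) (seq y n) (seq z n)
        ; *-identity =
            (λ x → pointwise {fromℚ 1ℚ * x} {x} λ n → ℚ.*-identityˡ (seq x n))
          , (λ x → pointwise {x * fromℚ 1ℚ} {x} λ n → ℚ.*-identityʳ (seq x n))
        ; distrib =
            (λ x y z → pointwise {x * (y + z)} {x * y + x * z} λ n →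
              ℚ.*-distribˡ-+ (seq x n) (seq y n) (seq z n))
          , (λ x y z → pointwise {(y + z) * x} {y * x + z * x} λ n →
              ℚ.*-distribʳ-+ (seq x n) (seq y n) (seq z n))
        }
      ; *-comm = λ x y → pointwise {x * y} {y * x} λ n →
          ℚ.*-comm (seq x n) (seq y n)
      }
    }

------------------------------------------------------------------------
-- Complex numbers

-- R[i] / (i² + 1), with (a , b) standing for a + b i.
module GaussianExtension {c ℓ : Level} (R : CommutativeRing c ℓ) where

  private
    module R = CommutativeRing R
    module A = CommutativeRing (Product.commutativeRing R R)
    open AbelianGroupProperties R.+-abelianGroup using (ε⁻¹≈ε)
    open RingProperties R.ring using (-1*x≈-x)
    open R using (Carrier; _≈_; _+_; _*_; -_; 0#; 1#)
    open SemiringSolver R.commutativeSemiring using (solve; _:=_; _:+_; _:*_)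

  infixl 7 _·_

  _·_ : Carrier × Carrier → Carrier × Carrier → Carrier × Carrier
  (a , b) · (a′ , b′) = a * a′ + - (b * b′) , a * b′ + b * a′

  private
    ·-cong : ∀ {x x′ y y′} → x A.≈ x′ → y A.≈ y′ → (x · y) A.≈ (x′ · y′)
    ·-cong (p , q) (p′ , q′) =
        R.+-cong (R.*-cong p p′) (R.-‿cong (R.*-cong q q′))
      , R.+-cong (R.*-cong p q′) (R.*-cong q p′)

    neg : ∀ z → - z ≈ - 1# * z
    neg z = R.sym (-1*x≈-x z)

    assoc-re : ∀ a b c d e f →
      (a * c + - (b * d)) * e + - ((a * d + b * c) * f) ≈
      a * (c * e + - (d * f)) + - (b * (c * f + d * e))
    assoc-re a b c d e f = R.trans
      (R.+-cong (R.*-congʳ (R.+-congˡ (neg (b * d)))) (neg ((a * d + b * c) * f)))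
      (R.trans (identity (- 1#) a b c d e f) (R.sym
        (R.+-cong (R.*-congˡ (R.+-congˡ (neg (d * f)))) (neg (b * (c * f + d * e))))))
      where
      identity : ∀ u a b c d e f →
        (a * c + u * (b * d)) * e + u * ((a * d + b * c) * f) ≈
        a * (c * e + u * (d * f)) + u * (b * (c * f + d * e))
      identity = solve 7 (λ u a b c d e f →
        (a :* c :+ u :* (b :* d)) :* e :+ u :* ((a :* d :+ b :* c) :* f) :=
        a :* (c :* e :+ u :* (d :* f)) :+ u :* (b :* (c :* f :+ d :* e))) R.refl

    assoc-im : ∀ a b c d e f →
      (a * c + - (b * d)) * f + (a * d + b * c) * e ≈
      a * (c * f + d * e) + b * (c * e + - (d * f))
    assoc-im a b c d e f = R.trans
      (R.+-congʳ (R.*-congʳ (R.+-congˡ (neg (b * d)))))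
      (R.trans (identity (- 1#) a b c d e f) (R.sym
        (R.+-congˡ (R.*-congˡ (R.+-congˡ (neg (d * f)))))))
      where
      identity : ∀ u a b c d e f →
        (a * c + u * (b * d)) * f + (a * d + b * c) * e ≈
        a * (c * f + d * e) + b * (c * e + u * (d * f))
      identity = solve 7 (λ u a b c d e f →
        (a :* c :+ u :* (b :* d)) :* f :+ (a :* d :+ b :* c) :* e :=
        a :* (c :* f :+ d :* e) :+ b :* (c :* e :+ u :* (d :* f))) R.refl

    idˡ-re : ∀ a b → 1# * a + - (0# * b) ≈ a
    idˡ-re a b = R.trans
      (R.+-cong (R.*-identityˡ a) (R.trans (R.-‿cong (R.zeroˡ b)) ε⁻¹≈ε))
      (R.+-identityʳ a)

    idˡ-im : ∀ a b → 1# * b + 0# * a ≈ b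
    idˡ-im a b =
      R.trans (R.+-cong (R.*-identityˡ b) (R.zeroˡ a)) (R.+-identityʳ b)

    comm-re : ∀ a b c d → a * c + - (b * d) ≈ c * a + - (d * b)
    comm-re a b c d = R.+-cong (R.*-comm a c) (R.-‿cong (R.*-comm b d))

    comm-im : ∀ a b c d → a * d + b * c ≈ c * b + d * a
    comm-im = solve 4 (λ a b c d →
      a :* d :+ b :* c :=
      c :* b :+ d :* a) R.refl

    distribˡ-re : ∀ a b c d e f →
      a * (c + e) + - (b * (d + f)) ≈ (a * c + - (b * d)) + (a * e + - (b * f))
    distribˡ-re a b c d e f = R.trans (R.+-congˡ (neg (b * (d + f))))
      (R.trans (identity (- 1#) a b c d e f) (R.sym
        (R.+-cong (R.+-congˡ (neg (b * d))) (R.+-congˡ (neg (b * f))))))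
      where
      identity : ∀ u a b c d e f →
        a * (c + e) + u * (b * (d + f)) ≈
        (a * c + u * (b * d)) + (a * e + u * (b * f))
      identity = solve 7 (λ u a b c d e f →
        a :* (c :+ e) :+ u :* (b :* (d :+ f)) :=
        (a :* c :+ u :* (b :* d)) :+ (a :* e :+ u :* (b :* f))) R.refl

    distribˡ-im : ∀ a b c d e f →
      a * (d + f) + b * (c + e) ≈ (a * d + b * c) + (a * f + b * e)
    distribˡ-im = solve 6 (λ a b c d e f →
      a :* (d :+ f) :+ b :* (c :+ e) :=
      (a :* d :+ b :* c) :+ (a :* f :+ b :* e)) R.refl

    ·-comm : ∀ x y → (x · y) A.≈ (y · x)
    ·-comm (a , b) (c , d) = comm-re a b c d , comm-im a b c d

    ·-identityˡ : ∀ x → ((1# , 0#) · x) A.≈ x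
    ·-identityˡ (a , b) = idˡ-re a b , idˡ-im a b

    ·-distribˡ : ∀ x y z → (x · (y A.+ z)) A.≈ ((x · y) A.+ (x · z))
    ·-distribˡ (a , b) (c , d) (e , f) =
      distribˡ-re a b c d e f , distribˡ-im a b c d e f

  commutativeRing : CommutativeRing c ℓ
  commutativeRing = record
    { Carrier = Carrier × Carrier
    ; _≈_ = A._≈_
    ; _+_ = A._+_
    ; _*_ = _·_
    ; -_ = A.-_
    ; 0# = A.0#
    ; 1# = 1# , 0#
    ; isCommutativeRing = record
      { isRing = record
        { +-isAbelianGroup = A.+-isAbelianGroup
        ; *-cong = ·-cong
        ; *-assoc = λ { (a , b) (c , d) (e , f) →
            assoc-re a b c d e f , assoc-im a b c d e f }
        ; *-identity = ·-identityˡ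
                     , λ x → A.trans (·-comm x (1# , 0#)) (·-identityˡ x)
        ; distrib = ·-distribˡ
                  , λ x y z → A.trans (·-comm (y A.+ z) x)
                      (A.trans (·-distribˡ x y z)
                        (A.+-cong (·-comm x y) (·-comm x z)))
        }
      ; *-comm = ·-comm
      }
    }

ℂ : CommutativeRing 0ℓ 0ℓ
ℂ = GaussianExtension.commutativeRing Real.commutativeRing

module _ {c ℓ : Level} (K : CommutativeRing c ℓ) where

  open CommutativeRing K
  open Exp semiring using (_^_)

  record IsPrimitiveRoot (r : ℕ) (ζ : Carrier) : Set ℓ where
    field
      isRoot  : ζ ^ r ≈ 1#
      minimal : ∀ k → 0 ℕ.< k → k ℕ.< r → ¬ (ζ ^ k ≈ 1#)

------------------------------------------------------------------------
-- Bases

module _ {r ℓr m ℓm i : Level} {R : Ring r ℓr} (M : LeftModule R m ℓm)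
         {I : Set i} (b : I → LeftModule.Carrierᴹ M)
  where

  private
    module R = Ring R
  open LeftModule M

  linearCombination : (I → R.Carrier) → List I → Carrierᴹ
  linearCombination a []       = 0ᴹ
  linearCombination a (i ∷ is) = a i *ₗ b i +ᴹ linearCombination a is

  -- The family (b i), for i ranging over the subset P of I, is a basis of M.
  record IsBasis {p : Level} (P : Pred I p) : Set (r ⊔ ℓr ⊔ m ⊔ ℓm ⊔ i ⊔ p) where
    field
      independent : ∀ a is → Unique is → All P is →
                    linearCombination a is ≈ᴹ 0ᴹ → All (λ i → a i R.≈ R.0#) is
      spanning    : ∀ v → ∃₂ λ a is → All P is × v ≈ᴹ linearCombination a is

------------------------------------------------------------------------
-- Superspace

module Superspace {c ℓ : Level} (K : CommutativeRing c ℓ) (n : ℕ) where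

  private
    module K = CommutativeRing K

  infixl 6 _+_ _-_
  infixl 7 _*_
  infix  8 -_
  infix  4 _≈_

  -- The unital associative K-algebra presented by the generators x i, θ i
  -- and the stated relations: its elements are algebra expressions, and _≈_
  -- is the least congruence containing the algebra axioms and the relations.
  data Ω : Set c where
    con : K.Carrier → Ω
    x θ : Fin n → Ω
    _+_ : Ω → Ω → Ω
    _*_ : Ω → Ω → Ω
    -_  : Ω → Ω

  0Ω 1Ω : Ω
  0Ω = con K.0#
  1Ω = con K.1#

  _-_ : Ω → Ω → Ω
  f - g = f + - g

  data _≈_ : Rel Ω (c ⊔ ℓ) where
    refl  : ∀ {f} → f ≈ f
    sym   : ∀ {f g} → f ≈ g → g ≈ f
    trans : ∀ {f g h} → f ≈ g → g ≈ h → f ≈ h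

    con-cong : ∀ {a b} → a K.≈ b → con a ≈ con b
    +-cong   : ∀ {f f′ g g′} → f ≈ f′ → g ≈ g′ → f + g ≈ f′ + g′
    *-cong   : ∀ {f f′ g g′} → f ≈ f′ → g ≈ g′ → f * g ≈ f′ * g′
    neg-cong : ∀ {f g} → f ≈ g → - f ≈ - g

    +-assoc     : ∀ f g h → (f + g) + h ≈ f + (g + h)
    +-comm      : ∀ f g → f + g ≈ g + f
    +-identityˡ : ∀ f → 0Ω + f ≈ f
    +-inverseˡ  : ∀ f → - f + f ≈ 0Ω
    *-assoc     : ∀ f g h → (f * g) * h ≈ f * (g * h)
    *-identityˡ : ∀ f → 1Ω * f ≈ f
    distribˡ    : ∀ f g h → f * (g + h) ≈ f * g + f * h
    distribʳ    : ∀ f g h → (g + h) * f ≈ g * f + h * f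

    con-+       : ∀ a b → con (a K.+ b) ≈ con a + con b
    con-*       : ∀ a b → con (a K.* b) ≈ con a * con b
    con-central : ∀ a f → con a * f ≈ f * con a

    xx-comm     : ∀ i j → x i * x j ≈ x j * x i
    xθ-comm     : ∀ i j → x i * θ j ≈ θ j * x i
    θθ-anticomm : ∀ i j → θ i * θ j ≈ - (θ j * θ i)

  ring : Ring c (c ⊔ ℓ)
  ring = record
    { Carrier = Ω
    ; _≈_ = _≈_
    ; _+_ = _+_
    ; _*_ = _*_
    ; -_ = -_
    ; 0# = 0Ω
    ; 1# = 1Ω
    ; isRing = record
      { +-isAbelianGroup = record
        { isGroup = record
          { isMonoid = record
            { isSemigroup = record
              { isMagma = record
                { isEquivalence = record { refl = refl; sym = sym; trans = trans }
                ; ∙-cong = +-cong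
                }
              ; assoc = +-assoc
              }
            ; identity = +-identityˡ
                       , λ f → trans (+-comm f 0Ω) (+-identityˡ f)
            }
          ; inverse = +-inverseˡ
                    , λ f → trans (+-comm f (- f)) (+-inverseˡ f)
          ; ⁻¹-cong = neg-cong
          }
        ; comm = +-comm
        }
      ; *-cong = *-cong
      ; *-assoc = *-assoc
      ; *-identity = *-identityˡ
                   , λ f → trans (sym (con-central K.1# f)) (*-identityˡ f)
      ; distrib = distribˡ , distribʳ
      }
    }

  private
    module ΩRing = Ring ring
    open Exp ΩRing.semiring using (_^_)

  -- The two-sided ideal generated by P.
  data Ideal {p : Level} (P : Pred Ω p) : Pred Ω (c ⊔ ℓ ⊔ p) where
    generator : ∀ {f} → P f → Ideal P f
    resp      : ∀ {f g} → f ≈ g → Ideal P f → Ideal P g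
    zeroᴵ     : Ideal P 0Ω
    addᴵ      : ∀ {f g} → Ideal P f → Ideal P g → Ideal P (f + g)
    mulˡ      : ∀ g {f} → Ideal P f → Ideal P (g * f)
    mulʳ      : ∀ g {f} → Ideal P f → Ideal P (f * g)

  -- The quotient of Ω by the ideal generated by P, as a K-module: its
  -- elements are those of Ω, with f and g identified when f - g is in the ideal.
  module _ {p : Level} (P : Pred Ω p) where

    private
      open Differences ring
      open RingProperties ring using (-1*x≈-x)

      infix 4 _∼_
      _∼_ : Rel Ω (c ⊔ ℓ ⊔ p)
      f ∼ g = Ideal P (f - g)

      ≈⇒∼ : ∀ {f g} → f ≈ g → f ∼ g
      ≈⇒∼ {f} {g} f≈g =
        resp (sym (trans (+-cong f≈g refl) (ΩRing.-‿inverseʳ g))) zeroᴵ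

      negᴵ : ∀ {f} → Ideal P f → Ideal P (- f)
      negᴵ {f} p = resp (-1*x≈-x f) (mulˡ (- 1Ω) p)

      ∼-isEquivalence : IsEquivalence _∼_
      ∼-isEquivalence = record
        { refl  = ≈⇒∼ refl
        ; sym   = λ {f} {g} p → resp (diff-swap f g) (negᴵ p)
        ; trans = λ {f} {g} {h} p q → resp (diff-trans f g h) (addᴵ p q)
        }

    quotient : LeftModule K.ring c (c ⊔ ℓ ⊔ p)
    quotient = record
      { Carrierᴹ = Ω
      ; _≈ᴹ_ = _∼_
      ; _+ᴹ_ = _+_
      ; _*ₗ_ = λ a f → con a * f
      ; 0ᴹ = 0Ω
      ; -ᴹ_ = -_
      ; isLeftModule = record
        { isLeftSemimodule = record
          { +ᴹ-isCommutativeMonoid = record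
            { isMonoid = record
              { isSemigroup = record
                { isMagma = record
                  { isEquivalence = ∼-isEquivalence
                  ; ∙-cong = λ {f} {g} {f′} {g′} p q →
                      resp (diff-+ f g f′ g′) (addᴵ p q)
                  }
                ; assoc = λ f g h → ≈⇒∼ (+-assoc f g h)
                }
              ; identity = (λ f → ≈⇒∼ (+-identityˡ f))
                         , (λ f → ≈⇒∼ (ΩRing.+-identityʳ f))
              }
            ; comm = λ f g → ≈⇒∼ (+-comm f g)
            }
          ; isPreleftSemimodule = record
            { *ₗ-cong = λ {a} {b} {f} {g} a≈b p →
                IsEquivalence.trans ∼-isEquivalence
                  (≈⇒∼ (*-cong (con-cong a≈b) refl))
                  (resp (diff-*ˡ (con b) f g) (mulˡ (con b) p))
            ; *ₗ-zeroˡ = λ f → ≈⇒∼ (ΩRing.zeroˡ f)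
            ; *ₗ-distribʳ = λ f a b → ≈⇒∼
                (trans (*-cong (con-+ a b) refl) (distribʳ f (con a) (con b)))
            ; *ₗ-identityˡ = λ f → ≈⇒∼ (*-identityˡ f)
            ; *ₗ-assoc = λ a b f → ≈⇒∼
                (trans (*-cong (con-* a b) refl) (*-assoc (con a) (con b) f))
            ; *ₗ-zeroʳ = λ a → ≈⇒∼ (ΩRing.zeroʳ (con a))
            ; *ₗ-distribˡ = λ a f g → ≈⇒∼ (distribˡ (con a) f g)
            }
          }
        ; -ᴹ‿cong = λ {f} {g} p → resp (diff-neg f g) (negᴵ p)
        ; -ᴹ‿inverse = (λ f → ≈⇒∼ (+-inverseˡ f))
                     , (λ f → ≈⇒∼ (ΩRing.-‿inverseʳ f))
        }
      }

  -- The augmentation sending every x i and θ i to 0.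
  constantTerm : Ω → K.Carrier
  constantTerm (con a) = a
  constantTerm (x i)   = K.0#
  constantTerm (θ i)   = K.0#
  constantTerm (f + g) = constantTerm f K.+ constantTerm g
  constantTerm (f * g) = constantTerm f K.* constantTerm g
  constantTerm (- f)   = K.- constantTerm f

  product : (Fin n → Ω) → Ω
  product = Vector.foldr _*_ 1Ω

  θ-factor : Side → Fin n → Ω
  θ-factor inside  i = θ i
  θ-factor outside i = 1Ω

  -- (J , a) stands for the monomial x₁^a₁ ⋯ xₙ^aₙ θ_J.
  monomial : Subset n × Vec ℕ n → Ω
  monomial (J , a) =
    product (λ i → x i ^ lookup a i) * product (λ i → θ-factor (lookup J i) i)

  module _ (r : ℕ) where

    -- ℤ_r ≀ 𝔖_n: exponents e and a permutation w stand for the monomial matrix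
    -- diag (ζ ^ e₁ , … , ζ ^ eₙ) · w, where w also denotes its permutation
    -- matrix.
    record WreathProduct : Set where
      constructor monomialMatrix
      field
        exponents   : Fin n → Fin r
        permutation : Permutation′ n

    module _ (ζ : K.Carrier) where

      open Exp K.semiring using () renaming (_^_ to _^ᴷ_)

      -- x i ↦ x (w i) ↦ ζ ^ (- e (w i)) · x (w i), and likewise for θ.  The
      -- inverse powers of ζ are written as ζ ^ (r - e), using ζ ^ r = 1.
      act : WreathProduct → Ω → Ω
      act _                    (con a) = con a
      act (monomialMatrix e w) (x i)   =
        con (ζ ^ᴷ (r ∸ toℕ (e (w ⟨$⟩ʳ i)))) * x (w ⟨$⟩ʳ i)
      act (monomialMatrix e w) (θ i)   =
        con (ζ ^ᴷ (r ∸ toℕ (e (w ⟨$⟩ʳ i)))) * θ (w ⟨$⟩ʳ i)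
      act g                    (f + h) = act g f + act g h
      act g                    (f * h) = act g f * act g h
      act g                    (- f)   = - act g f

      Invariant : Pred Ω (c ⊔ ℓ)
      Invariant f = ∀ g → act g f ≈ f

      SI-generators : Pred Ω (c ⊔ ℓ)
      SI-generators f = Invariant f × constantTerm f K.≈ K.0#

      SI : Pred Ω (c ⊔ ℓ)
      SI = Ideal SI-generators

      -- Ω / SI
      SR : LeftModule K.ring c (c ⊔ ℓ)
      SR = quotient SI-generators

------------------------------------------------------------------------
-- Staircases

-- With [n] - J = {u₁ < ⋯ < u_k}, the argument i is the index such that the
-- head of the remaining part of J lies at a position p with
-- u_{i-1} < p ≤ u_i (u_{k+1} = n + 1).
staircase : ∀ {m} → ℕ → ℕ → Subset m → Vec ℤ.ℤ m
staircase r i []            = []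
staircase r i (outside ∷ J) = (ℤ.+ (i ℕ.* r) ℤ.- ℤ.+ 1) ∷ staircase r (suc i) J
staircase r i (inside  ∷ J) = (ℤ.+ (i ℕ.* r) ℤ.- ℤ.+ 2) ∷ staircase r i J

st : ∀ {n} → Subset n → ℕ → Vec ℤ.ℤ n
st J r = staircase r 1 J

-- The exponent data of the monomials in 𝒜_{n,r}; entries of st J r may be
-- negative, in which case no exponent vector qualifies.
𝒜 : (n r : ℕ) → Pred (Subset n × Vec ℕ n) 0ℓ
𝒜 n r (J , a) = ∀ i → ℤ.+ lookup a i ℤ.≤ lookup (st J r) i

{-# OPTIONS --safe #-}

-- Write y i = x i ^ r.
--
-- Spanning.  The invariants ∑ y i ^ k and ∑ x i ^ (r k + r - 1) θ i produce,
-- for each J, elements of the ideal of those h for which h θ_J is congruent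
-- modulo SI to a combination of θ_L with larger L.  Splitting a polynomial by
-- one variable after another, through the ideals 𝔞 : x i and 𝔞 + (x i), shows
-- that modulo these elements the exponents can be kept below the staircase.
--
-- Independence.  Let φ be the Vandermonde product of the y i applied to the
-- linear form dual to the monomial ∏ x i ^ (r n - 1).  As φ is alternating of
-- least degree, every invariant without constant term kills it.  The odd
-- derivations θ i ↦ x i ^ (r k + 1) commute with the group, so applying any
-- number of them to an element of SI gives another element that kills φ.  Their
-- combinations θ i ↦ x i ∏ (y s - y i) single out one θ_J in a linear relation
-- and multiply its coefficient by a polynomial F_J.  Again by splitting off one
-- variable after another, g F_J kills φ only if g = 0, for g below the staircase.

module Submission where

open import Defs
open import Algebra.Bundles using (CommutativeRing; Ring)
open import Algebra.Module.Bundles using (LeftModule)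
import Algebra.Properties.AbelianGroup as AbelianGroupProperties
import Algebra.Properties.CommutativeMonoid.Sum as Sum
import Algebra.Properties.CommutativeSemigroup as CommutativeSemigroupProperties
import Algebra.Properties.Monoid.Mult as Mult
import Algebra.Properties.Ring as RingProperties
import Algebra.Properties.Semiring.Exp as Exp
import Algebra.Properties.Semiring.Mult as SemiringMult
import Algebra.Properties.Semiring.Sum as SemiringSum
import Algebra.Solver.Ring as RingSolver
import Algebra.Solver.Ring.AlmostCommutativeRing as ACR
open import Data.Bool.Base using (if_then_else_)
import Data.Bool.Properties as Bool
open import Data.Empty using (⊥-elim)
open import Data.Fin.Base using (Fin; zero; suc; toℕ; fromℕ<) renaming (_<_ to _<ᶠ_)
open import Data.Fin.Permutation using (_⟨$⟩ʳ_; Permutation′; _⟨$⟩ˡ_; inverseˡ; inverseʳ; transpose) renaming (id to idᵖ)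
import Data.Fin.Properties as Fin
open import Data.Fin.Subset using (Subset; inside; outside; Side)
import Data.Integer.Base as ℤ
import Data.Integer.Properties as ℤ
open import Data.List.Base as List using (List; []; _∷_; _++_; length; map; _ʳ++_; filter; reverse)
import Data.List.Membership.DecPropositional as DecMembership
open import Data.List.Membership.Propositional using (_∈_; _∉_)
open import Data.List.Membership.Propositional.Properties using (∈-∃++; ∈-++⁺ʳ; ∈-++⁺ˡ; ∈-++⁻; ∈-filter⁺; ∈-filter⁻; ∈-map⁺; ∈-map⁻)
open import Data.List.Properties using (ʳ++-defn; ++-assoc; length-reverse; length-++; map-++; map-∘; length-tabulate; map-id-local; length-map; length-ʳ++; map-cong-local; map-id; ++-identityʳ)
open import Data.List.Relation.Binary.Permutation.Propositional as Perm using (_↭_; prep; swap)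
open import Data.List.Relation.Binary.Permutation.Propositional.Properties as Perm using (↭-reverse; ++⁺ʳ)
open import Data.List.Relation.Unary.All as All using (All; []; _∷_)
open import Data.List.Relation.Unary.All.Properties as All using (All¬⇒¬Any; ¬Any⇒All¬)
open import Data.List.Relation.Unary.AllPairs using (_∷_; []; AllPairs)
import Data.List.Relation.Unary.AllPairs.Properties as AllPairs
open import Data.List.Relation.Unary.Any using (here; there)
open import Data.List.Relation.Unary.Unique.Propositional using (Unique)
import Data.List.Relation.Unary.Unique.Propositional.Properties as Unique
open import Data.Maybe.Base using (just; nothing)
open import Data.Nat.Base as ℕ using (ℕ; zero; suc; _≤_; _<_; z≤n; s≤s; _∸_; NonZero; _≥_)
open import Data.Nat.DivMod using (_/_; _%_; m≡m%n+[m/n]*n; m%n<n)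
import Data.Nat.ListAction as ListAction
import Data.Nat.Properties as ℕ
open import Data.Product.Base using (∃-syntax; _×_; _,_; proj₁; proj₂; ∃₂)
open import Data.Product.Properties using (≡-dec)
open import Data.Rational.Base as ℚ using (ℚ; 0ℚ; 1ℚ; ½; ∣_∣)
import Data.Rational.Properties as ℚ
open import Data.Sum.Base using (_⊎_; inj₁; inj₂)
open import Data.Unit.Base using (⊤; tt)
open import Data.Vec.Base as Vec using (Vec; lookup; updateAt; []; _∷_; replicate; _[_]≔_; tabulate)
import Data.Vec.Functional as Vector
open import Data.Vec.Properties as Vec using (lookup∘updateAt; lookup∘updateAt′; lookup-replicate; updateAt-updateAt-local; updateAt-id-local; tabulate∘lookup; tabulate-cong)
open import Function.Base using (_∘_)
open import Level using (Level; _⊔_; Lift)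
open import Relation.Binary.Definitions using (WeaklyDecidable; DecidableEquality)
open import Relation.Binary.PropositionalEquality as ≡ using (_≡_; _≢_)
open import Relation.Nullary.Decidable using (yes; no; Dec; ¬?; does; _×-dec_; decidable-stable)
open import Relation.Nullary.Negation using (¬_; contradiction)
open import Relation.Unary using (Pred)

-- Equality of complex numbers cannot be decided here, so neither half compares dimensions or looks
-- for leading coefficients. Both follow one recursion on boxes of exponents: those with exponent 0
-- at `x i` form a box with `x i` removed, and the others are `x i` times a box that is narrower by
-- one at `i`. Spanning pairs the two parts with the ideals 𝔞 + (x i) and 𝔞 : x i. Independence
-- pairs the first with 𝔟 : X, where X is the last power of `x i` before one known to lie in 𝔟, and
-- keeps 𝔟 for the second while its factor F grows by `x i`. The scalars enter through inverses of
-- natural numbers and cancellation of `ζ ^ k - 1`. The former come from differentiating ξ^m: once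
-- the symmetric functions vanish, the product of all y - t with t different from y becomes m
-- y^(m-1). The exponent r k + r - 1 makes the scalar of `θ i` complete a multiple of r; with r k +
-- 1 a derivation scales its values exactly as `θ i` is scaled.

module _ {c ℓ : Level} (R : CommutativeRing c ℓ) where

  open CommutativeRing R
  open Exp semiring using (_^_)
  open Mult +-monoid using () renaming (_×_ to _·_)

  InvertibleNaturals : Set (c ⊔ ℓ)
  InvertibleNaturals = ∀ m → ∃[ u ] u * (suc m · 1#) ≈ 1#

  NoTwoTorsion : Set (c ⊔ ℓ)
  NoTwoTorsion = ∀ a → a ≈ - a → a ≈ 0#

  IsRootOfUnity : ℕ → Carrier → Set ℓ
  IsRootOfUnity r ζ = ζ ^ r ≈ 1#

  -- The form in which primitivity of the root is used: `ζ ^ k - 1#` can be cancelled. In a general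
  -- ring this is more than `ζ ^ k` being different from `1#`.
  PowersCancel : ℕ → Carrier → Set (c ⊔ ℓ)
  PowersCancel r ζ = ∀ k → 0 < k → k < r → ∀ a → ζ ^ k * a ≈ a → a ≈ 0#

  -- Asymmetric, since neither factor can be tested for 0: a refutation for `a` has to yield an
  -- equation for `b`.
  NoZeroDivisors : Set (c ⊔ ℓ)
  NoZeroDivisors = ∀ {a b} → a * b ≈ 0# → ¬ (a ≈ 0#) → b ≈ 0#

  SquaresVanish : Set (c ⊔ ℓ)
  SquaresVanish = ∀ {a b} → a * a + b * b ≈ 0# → a ≈ 0#

module IntegerSolver {c ℓ : Level} (R : CommutativeRing c ℓ) where

  open CommutativeRing R
  open Mult +-monoid using (×-homo-+) renaming (_×_ to _·_)
  open SemiringMult semiring using (×1-homo-*)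
  open RingProperties ring using (-‿distribˡ-*; -‿distribʳ-*)
  open AbelianGroupProperties +-abelianGroup using (⁻¹-∙-comm; ⁻¹-involutive; ε⁻¹≈ε)
  open import Relation.Binary.Reasoning.Setoid setoid

  -- Integers serve as coefficients of the solver because their equality is decidable, whereas that
  -- of `R` need not be.
  fromℤ : ℤ.ℤ → Carrier
  fromℤ (ℤ.+ n)      = n · 1#
  fromℤ (ℤ.-[1+ n ]) = - (suc n · 1#)

  private
    ⊖-homo : ∀ m n → fromℤ (m ℤ.⊖ n) ≈ m · 1# + - (n · 1#)
    ⊖-homo zero    zero    = sym (-‿inverseʳ 0#)
    ⊖-homo zero    (suc n) = sym (+-identityˡ _)
    ⊖-homo (suc m) zero    = sym (trans (+-congˡ ε⁻¹≈ε) (+-identityʳ _))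
    ⊖-homo (suc m) (suc n) = begin
      fromℤ (suc m ℤ.⊖ suc n)                   ≡⟨ ≡.cong fromℤ (ℤ.[1+m]⊖[1+n]≡m⊖n m n) ⟩
      fromℤ (m ℤ.⊖ n)                           ≈⟨ ⊖-homo m n ⟩
      m · 1# + - (n · 1#)                       ≈⟨ +-congˡ (+-identityˡ _) ⟨
      m · 1# + (0# + - (n · 1#))                ≈⟨ +-congˡ (+-congʳ (-‿inverseʳ 1#)) ⟨
      m · 1# + (1# + - 1# + - (n · 1#))         ≈⟨ +-congˡ (+-assoc _ _ _) ⟩
      m · 1# + (1# + (- 1# + - (n · 1#)))       ≈⟨ +-assoc _ _ _ ⟨
      m · 1# + 1# + (- 1# + - (n · 1#))         ≈⟨ +-cong (+-comm _ _) (⁻¹-∙-comm _ _) ⟩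
      suc m · 1# + - (suc n · 1#)               ∎

    +-homo : ∀ i j → fromℤ (i ℤ.+ j) ≈ fromℤ i + fromℤ j
    +-homo (ℤ.+ m)      (ℤ.+ n)      = ×-homo-+ 1# m n
    +-homo (ℤ.+ m)      (ℤ.-[1+ n ]) = ⊖-homo m (suc n)
    +-homo (ℤ.-[1+ m ]) (ℤ.+ n)      = trans (⊖-homo n (suc m)) (+-comm _ _)
    +-homo (ℤ.-[1+ m ]) (ℤ.-[1+ n ]) = begin
      - (suc (suc (m ℕ.+ n)) · 1#)          ≡⟨ ≡.cong (λ k → - (suc k · 1#)) (ℕ.+-suc m n) ⟨
      - ((suc m ℕ.+ suc n) · 1#)            ≈⟨ -‿cong (×-homo-+ 1# (suc m) (suc n)) ⟩
      - (suc m · 1# + suc n · 1#)           ≈⟨ ⁻¹-∙-comm _ _ ⟨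
      - (suc m · 1#) + - (suc n · 1#)       ∎

    neg-homo : ∀ i → fromℤ (ℤ.- i) ≈ - fromℤ i
    neg-homo (ℤ.+ zero)   = sym ε⁻¹≈ε
    neg-homo (ℤ.+ suc n)  = refl
    neg-homo (ℤ.-[1+ n ]) = sym (⁻¹-involutive _)

    pos-homo : ∀ m n → fromℤ (ℤ.+ m ℤ.* ℤ.+ n) ≈ fromℤ (ℤ.+ m) * fromℤ (ℤ.+ n)
    pos-homo m n = begin
      fromℤ (ℤ.+ m ℤ.* ℤ.+ n)   ≡⟨ ≡.cong fromℤ (ℤ.pos-* m n) ⟨
      (m ℕ.* n) · 1#        ≈⟨ ×1-homo-* m n ⟩
      m · 1# * n · 1#       ∎

    *-homo : ∀ i j → fromℤ (i ℤ.* j) ≈ fromℤ i * fromℤ j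
    *-homo (ℤ.+ m)      (ℤ.+ n)      = pos-homo m n
    *-homo (ℤ.+ m)      (ℤ.-[1+ n ]) = begin
      fromℤ (ℤ.+ m ℤ.* (ℤ.- (ℤ.+ suc n)))       ≡⟨ ≡.cong fromℤ (ℤ.neg-distribʳ-* (ℤ.+ m) (ℤ.+ suc n)) ⟨
      fromℤ (ℤ.- (ℤ.+ m ℤ.* ℤ.+ suc n))         ≈⟨ neg-homo (ℤ.+ m ℤ.* ℤ.+ suc n) ⟩
      - fromℤ (ℤ.+ m ℤ.* ℤ.+ suc n)             ≈⟨ -‿cong (pos-homo m (suc n)) ⟩
      - (fromℤ (ℤ.+ m) * fromℤ (ℤ.+ suc n))     ≈⟨ -‿distribʳ-* _ _ ⟩
      fromℤ (ℤ.+ m) * fromℤ (ℤ.-[1+ n ])        ∎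
    *-homo (ℤ.-[1+ m ]) (ℤ.+ n)      = begin
      fromℤ ((ℤ.- (ℤ.+ suc m)) ℤ.* ℤ.+ n)       ≡⟨ ≡.cong fromℤ (ℤ.neg-distribˡ-* (ℤ.+ suc m) (ℤ.+ n)) ⟨
      fromℤ (ℤ.- (ℤ.+ suc m ℤ.* ℤ.+ n))         ≈⟨ neg-homo (ℤ.+ suc m ℤ.* ℤ.+ n) ⟩
      - fromℤ (ℤ.+ suc m ℤ.* ℤ.+ n)             ≈⟨ -‿cong (pos-homo (suc m) n) ⟩
      - (fromℤ (ℤ.+ suc m) * fromℤ (ℤ.+ n))     ≈⟨ -‿distribˡ-* _ _ ⟩
      fromℤ (ℤ.-[1+ m ]) * fromℤ (ℤ.+ n)        ∎
    *-homo (ℤ.-[1+ m ]) (ℤ.-[1+ n ]) = begin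
      fromℤ (ℤ.+ suc m ℤ.* ℤ.+ suc n)           ≈⟨ pos-homo (suc m) (suc n) ⟩
      suc m · 1# * suc n · 1#               ≈⟨ ⁻¹-involutive _ ⟨
      - - (suc m · 1# * suc n · 1#)         ≈⟨ -‿cong (-‿distribˡ-* _ _) ⟩
      - (- (suc m · 1#) * suc n · 1#)       ≈⟨ -‿distribʳ-* _ _ ⟩
      - (suc m · 1#) * - (suc n · 1#)       ∎

    almostCommutativeRing : ACR.AlmostCommutativeRing c ℓ
    almostCommutativeRing = ACR.fromCommutativeRing R

    morphism : CommutativeRing.rawRing ℤ.+-*-commutativeRing ACR.-Raw-AlmostCommutative⟶ almostCommutativeRing
    morphism = record
      { ⟦_⟧ = fromℤ ; +-homo = +-homo ; *-homo = *-homo ; -‿homo = neg-homo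
      ; 0-homo = refl ; 1-homo = +-identityʳ 1# }

    _≟ᶜ_ : WeaklyDecidable (ACR.Induced-equivalence morphism)
    i ≟ᶜ j with i ℤ.≟ j
    ... | yes ≡.refl = just refl
    ... | no  _      = nothing

  open RingSolver (CommutativeRing.rawRing ℤ.+-*-commutativeRing) almostCommutativeRing morphism _≟ᶜ_
    public using (solve; _:=_; _:+_; _:*_; _:-_; :-_; con)

-- Commutative algebra

module Ideals {c ℓ : Level} (R : CommutativeRing c ℓ) where

  open CommutativeRing R hiding (zero)
  open RingProperties ring using (-1*x≈-x)
  open IntegerSolver R

  record IsIdeal {p : Level} (𝔞 : Pred Carrier p) : Set (c ⊔ ℓ ⊔ p) where
    field
      resp  : ∀ {f g} → f ≈ g → 𝔞 f → 𝔞 g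
      zero∈ : 𝔞 0#
      add   : ∀ {f g} → 𝔞 f → 𝔞 g → 𝔞 (f + g)
      mul   : ∀ h {f} → 𝔞 f → 𝔞 (h * f)

    neg : ∀ {f} → 𝔞 f → 𝔞 (- f)
    neg p = resp (-1*x≈-x _) (mul (- 1#) p)

    sub : ∀ {f g} → 𝔞 f → 𝔞 g → 𝔞 (f - g)
    sub p q = add p (neg q)

    mulʳ : ∀ h {f} → 𝔞 f → 𝔞 (f * h)
    mulʳ h p = resp (*-comm _ _) (mul h p)

    shift : ∀ {f g} → 𝔞 (f - g) → 𝔞 g → 𝔞 f
    shift {f} {g} p q = resp (solve 2 (λ f g → (f :- g) :+ g := f) refl f g) (add p q)

  module _ {p : Level} {𝔞 : Pred Carrier p} (I : IsIdeal 𝔞) (z : Carrier) where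
    open IsIdeal I

    colon : IsIdeal (λ h → 𝔞 (z * h))
    colon = record
      { resp  = λ e → resp (*-congˡ e)
      ; zero∈ = resp (sym (zeroʳ z)) zero∈
      ; add   = λ p q → resp (sym (distribˡ _ _ _)) (add p q)
      ; mul   = λ h {f} p → resp (solve 3 (λ h z f → h :* (z :* f) := z :* (h :* f)) refl h z f) (mul h p)
      }

    plus : IsIdeal (λ h → ∃[ q ] 𝔞 (h - z * q))
    plus = record
      { resp  = λ e (q , p) → q , resp (+-congʳ e) p
      ; zero∈ = 0# , resp (solve 1 (λ z → con (ℤ.+ 0) := con (ℤ.+ 0) :- z :* con (ℤ.+ 0)) refl z) zero∈
      ; add   = λ {f} {g} (q , p) (q′ , p′) → q + q′ , resp
          (solve 5 (λ f g z q q′ → (f :- z :* q) :+ (g :- z :* q′) := (f :+ g) :- z :* (q :+ q′)) refl f g z q q′)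
          (add p p′)
      ; mul   = λ h {f} (q , p) → h * q , resp
          (solve 4 (λ h f z q → h :* (f :- z :* q) := h :* f :- z :* (h :* q)) refl h f z q) (mul h p)
      }

    plus-base : ∀ {h} → 𝔞 h → ∃[ q ] 𝔞 (h - z * q)
    plus-base {h} p = 0# , resp (solve 2 (λ h z → h := h :- z :* con (ℤ.+ 0)) refl h z) p

    plus-gen : ∃[ q ] 𝔞 (z - z * q)
    plus-gen = 1# , resp (sym (trans (+-congˡ (-‿cong (*-identityʳ z))) (-‿inverseʳ z))) zero∈

module SymmetricFunctions {c ℓ : Level} (R : CommutativeRing c ℓ) where

  open CommutativeRing R hiding (zero)
  open IntegerSolver R
  open Ideals R
  open Exp semiring using (_^_)
  open Mult +-monoid using () renaming (_×_ to _·_)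
  open import Relation.Binary.Reasoning.Setoid setoid

  -- The two differ by the sign (-1)^(length L). Keeping both avoids carrying signs along; they are
  -- absorbed where an ideal does not see them.
  monic comonic : List Carrier → Carrier → Carrier
  monic []      ξ = 1#
  monic (t ∷ L) ξ = (ξ - t) * monic L ξ
  comonic []      ξ = 1#
  comonic (t ∷ L) ξ = (t - ξ) * comonic L ξ

  -- The coefficients of ∏ (1 - t X).
  elem : ℕ → List Carrier → Carrier
  elem zero    L       = 1#
  elem (suc k) []      = 0#
  elem (suc k) (t ∷ L) = elem (suc k) L - t * elem k L

  ∑ : List Carrier → (Carrier → Carrier) → Carrier
  ∑ []      Q = 0#
  ∑ (t ∷ L) Q = Q t + ∑ L Q

  monic-++ : ∀ A B ξ → monic (A ++ B) ξ ≈ monic A ξ * monic B ξ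
  monic-++ []      B ξ = sym (*-identityˡ _)
  monic-++ (t ∷ A) B ξ = trans (*-congˡ (monic-++ A B ξ)) (sym (*-assoc _ _ _))

  comonic-++ : ∀ A B ξ → comonic (A ++ B) ξ ≈ comonic A ξ * comonic B ξ
  comonic-++ []      B ξ = sym (*-identityˡ _)
  comonic-++ (t ∷ A) B ξ = trans (*-congˡ (comonic-++ A B ξ)) (sym (*-assoc _ _ _))

  ∑-cong : ∀ L {P Q : Carrier → Carrier} → (∀ t → P t ≈ Q t) → ∑ L P ≈ ∑ L Q
  ∑-cong []      e = refl
  ∑-cong (t ∷ L) e = +-cong (e t) (∑-cong L e)

  ∑-++ : ∀ A B Q → ∑ (A ++ B) Q ≈ ∑ A Q + ∑ B Q
  ∑-++ []      B Q = sym (+-identityˡ _)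
  ∑-++ (t ∷ A) B Q = trans (+-congˡ (∑-++ A B Q)) (sym (+-assoc _ _ _))

  ∑-+ : ∀ L P Q → ∑ L (λ t → P t + Q t) ≈ ∑ L P + ∑ L Q
  ∑-+ []      P Q = sym (+-identityˡ _)
  ∑-+ (t ∷ L) P Q = trans (+-congˡ (∑-+ L P Q))
    (solve 4 (λ p q s s′ → (p :+ q) :+ (s :+ s′) := (p :+ s) :+ (q :+ s′)) refl (P t) (Q t) (∑ L P) (∑ L Q))

  ∑-* : ∀ L h Q → ∑ L (λ t → h * Q t) ≈ h * ∑ L Q
  ∑-* []      h Q = sym (zeroʳ h)
  ∑-* (t ∷ L) h Q = trans (+-congˡ (∑-* L h Q)) (sym (distribˡ _ _ _))

  -- Comparison of coefficients after splitting the factor 1 - y X off the product.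
  elem-remove : ∀ k A {y} B → elem (suc k) (A ++ y ∷ B) ≈ elem (suc k) (A ++ B) - y * elem k (A ++ B)
  elem-remove k       []      B = refl
  elem-remove zero    (a ∷ A) {y} B = trans (+-congʳ (elem-remove zero A B))
    (solve 4 (λ p y u a → (p :- y :* u) :- a :* u := (p :- a :* u) :- y :* u) refl (elem 1 (A ++ B)) y 1# a)
  elem-remove (suc k) (a ∷ A) {y} B = trans
    (+-cong (elem-remove (suc k) A B) (-‿cong (*-congˡ (elem-remove k A B))))
    (solve 5 (λ p q s y a → (p :- y :* q) :- a :* (q :- y :* s) := (p :- a :* q) :- y :* (q :- a :* s)) refl
      (elem (2 ℕ.+ k) (A ++ B)) (elem (suc k) (A ++ B)) (elem k (A ++ B)) y a)

  elem-vanish : ∀ L k → elem (suc k ℕ.+ length L) L ≈ 0#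
  elem-vanish []      k = refl
  elem-vanish (t ∷ L) k = begin
    elem (suc k ℕ.+ suc (length L)) L - t * elem (k ℕ.+ suc (length L)) L
      ≡⟨ ≡.cong (λ j → elem (suc j) L - t * elem j L) (ℕ.+-suc k (length L)) ⟩
    elem (suc (suc k) ℕ.+ length L) L - t * elem (suc k ℕ.+ length L) L
      ≈⟨ +-cong (elem-vanish L (suc k)) (-‿cong (*-congˡ (elem-vanish L k))) ⟩
    0# - t * 0#
      ≈⟨ solve 1 (λ t → con (ℤ.+ 0) :- t :* con (ℤ.+ 0) := con (ℤ.+ 0)) refl t ⟩
    0# ∎

  private
    -- Truncations of ∏ (1 - t X) / (1 - ξ X)
    horner : ℕ → List Carrier → Carrier → Carrier
    horner zero    L ξ = 1#
    horner (suc j) L ξ = ξ * horner j L ξ + elem (suc j) L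

    horner-∷ : ∀ j t L ξ → horner (suc j) (t ∷ L) ξ ≈ horner (suc j) L ξ - t * horner j L ξ
    horner-∷ zero    t L ξ = sym (+-assoc _ _ _)
    horner-∷ (suc j) t L ξ = trans (+-congʳ (*-congˡ (horner-∷ j t L ξ)))
      (solve 6 (λ ξ t p q u v → ξ :* (p :- t :* q) :+ (u :- t :* v) := (ξ :* p :+ u) :- t :* (ξ :* q :+ v)) refl
        ξ t (horner (suc j) L ξ) (horner j L ξ) (elem (2 ℕ.+ j) L) (elem (suc j) L))

    -- The product of the ξ - t has the coefficients of ∏ (1 - t X) in reverse order, and Horner's
    -- scheme evaluates it.
    monic-horner : ∀ L ξ → monic L ξ ≈ horner (length L) L ξ
    monic-horner []      ξ = refl
    monic-horner (t ∷ L) ξ = sym (begin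
      horner (suc (length L)) (t ∷ L) ξ
        ≈⟨ horner-∷ (length L) t L ξ ⟩
      (ξ * horner (length L) L ξ + elem (suc (length L)) L) - t * horner (length L) L ξ
        ≈⟨ +-congʳ (+-congˡ (elem-vanish L 0)) ⟩
      (ξ * horner (length L) L ξ + 0#) - t * horner (length L) L ξ
        ≈⟨ solve 3 (λ ξ t p → (ξ :* p :+ con (ℤ.+ 0)) :- t :* p := (ξ :- t) :* p) refl ξ t (horner (length L) L ξ) ⟩
      (ξ - t) * horner (length L) L ξ
        ≈⟨ *-congˡ (monic-horner L ξ) ⟨
      (ξ - t) * monic L ξ ∎)

  module _ {p : Level} {𝔟 : Pred Carrier p} (I : IsIdeal 𝔟) {y : Carrier} (A B : List Carrier)
           (sym∈ : ∀ k → 𝔟 (elem (suc k) (A ++ y ∷ B))) where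
    open IsIdeal I

    private
      -- Modulo `𝔟` the product of all 1 - t X is 1, so without the factor of `y` it is the
      -- geometric series of y X.
      elem≡power : ∀ k → 𝔟 (elem k (A ++ B) - y ^ k)
      elem≡power zero    = resp (sym (-‿inverseʳ 1#)) zero∈
      elem≡power (suc k) = resp
        (trans (+-congʳ (elem-remove k A B))
        (solve 4 (λ p q y u → (p :- y :* q) :+ y :* (q :- u) := p :- y :* u) refl
          (elem (suc k) (A ++ B)) (elem k (A ++ B)) y (y ^ k)))
        (add (sym∈ k) (mul y (elem≡power k)))

      -- At the point `y` Horner's scheme adds the terms y^(j-i) · elem i for i ≤ j, and each of
      -- them is y^j modulo `𝔟`. This multiplicity is what has to be inverted later.
      horner≡ : ∀ j → 𝔟 (horner j (A ++ B) y - suc j · (y ^ j))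
      horner≡ zero    = resp (solve 1 (λ u → con (ℤ.+ 0) := u :- (u :+ con (ℤ.+ 0))) refl 1#) zero∈
      horner≡ (suc j) = resp (trans
        (solve 5 (λ h y e s u → y :* (h :- s) :+ (e :- u) := (y :* h :+ e) :- (u :+ y :* s)) refl
          (horner j (A ++ B) y) y (elem (suc j) (A ++ B)) (suc j · (y ^ j)) (y ^ suc j))
        (+-congˡ (-‿cong (+-congˡ (SemiringMult.×-comm-* semiring (suc j) y (y ^ j))))))
        (add (mul y (horner≡ j)) (elem≡power (suc j)))

    -- The remaining factors of ∏ (ξ - t) = ξ^m at the root y.
    derivative : 𝔟 (monic (A ++ B) y - suc (length (A ++ B)) · (y ^ length (A ++ B)))
    derivative = resp (+-congʳ (sym (monic-horner (A ++ B) y))) (horner≡ (length (A ++ B)))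

    -- `elem` vanishes beyond the length, so the geometric series breaks off.
    nilpotent : 𝔟 (y ^ suc (length (A ++ B)))
    nilpotent = resp
      (trans (-‿cong (+-congʳ (elem-vanish (A ++ B) 0)))
        (solve 1 (λ u → :- (con (ℤ.+ 0) :- u) := u) refl (y ^ suc (length (A ++ B)))))
      (neg (elem≡power (suc (length (A ++ B)))))

-- Deletion and contraction of variables

-- Positions are marked free if they lie outside J, bound if they lie in J, and
-- dead once their variable has been set to 0.  A position t of weight e may
-- carry exponents below r·k + e, where k counts the free positions before t.
-- Positions before the cursor are stored in reverse; free ones have weight r.
-- All positions after the cursor have weight 0.
module States {n : ℕ} (r : ℕ) (positions : List (Fin n)) (distinct : Unique positions) where

  data Mark : Set where
    free dead : Mark
    bound     : (e : ℕ) → e ≤ r → Mark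

  Entries : Set
  Entries = List (Fin n × Mark)

  data Kind : Set where
    free bound : Kind

  mark : Kind → Mark
  mark free  = free
  mark bound = bound 0 z≤n

  count : Entries → ℕ
  count []                    = 0
  count ((i , free)      ∷ l) = suc (count l)
  count ((i , dead)      ∷ l) = count l
  count ((i , bound _ _) ∷ l) = count l

  -- Used when a free position dies; the cursor then returns to the far end. A bound position behind
  -- it had the limit r·k at weight 0. With one free position fewer before it, the same limit reads
  -- r·(k-1) + r, hence weight `r`.
  refill : Entries → Entries → Entries
  refill pre []                      = pre
  refill pre ((i , free)      ∷ suf) = refill ((i , free) ∷ pre) suf
  refill pre ((i , dead)      ∷ suf) = refill ((i , dead) ∷ pre) suf
  refill pre ((i , bound _ _) ∷ suf) = refill ((i , bound r ℕ.≤-refl) ∷ pre) suf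

  places : Entries → List (Fin n)
  places = map proj₁

  Fresh : Fin n → Entries → Set
  Fresh i l = All (_≢ i) (places l)

  -- Recursion trees of deletion and contraction, with the cursor between positions (`Full`) or on
  -- one (`Cur`). Termination is proved once, in `build`; spanning and independence then both
  -- recurse structurally.
  data Full : Entries → Entries → Set
  data Cur  : Entries → Fin n → Kind → ℕ → Entries → Set

  data Full where
    end   : ∀ {suf} → places suf ≡ positions → Full [] suf
    free  : ∀ {pre i suf} → Cur pre i free r suf → Full ((i , free) ∷ pre) suf
    bound : ∀ {pre i e e≤r suf} → Cur pre i bound e suf → Full ((i , bound e e≤r) ∷ pre) suf
    dead  : ∀ {pre i suf} → Full pre ((i , dead) ∷ suf) → Full ((i , dead) ∷ pre) suf

  data Cur where
    done  : ∀ {pre i κ suf} → Full pre ((i , mark κ) ∷ suf) → Cur pre i κ 0 suf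
    free  : ∀ {pre i e suf} → suc e ≤ r → Fresh i pre → Fresh i suf → Cur pre i free e suf →
            Full (refill ((i , dead) ∷ pre) suf) [] → Cur pre i free (suc e) suf
    bound : ∀ {pre i e suf} → suc e ≤ r → Fresh i pre → Fresh i suf → Cur pre i bound e suf →
            Full pre ((i , dead) ∷ suf) → Cur pre i bound (suc e) suf

  private
    count-refill : ∀ pre suf → count (refill pre suf) ≡ count pre ℕ.+ count suf
    count-refill pre []                      = ≡.sym (ℕ.+-identityʳ _)
    count-refill pre ((i , free)      ∷ suf) = ≡.trans (count-refill _ suf) (≡.sym (ℕ.+-suc _ _))
    count-refill pre ((i , dead)      ∷ suf) = count-refill _ suf
    count-refill pre ((i , bound _ _) ∷ suf) = count-refill _ suf

    places-refill : ∀ pre suf → places (refill pre suf) ʳ++ [] ≡ places pre ʳ++ places suf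
    places-refill pre []                      = ≡.refl
    places-refill pre ((i , free)      ∷ suf) = places-refill _ suf
    places-refill pre ((i , dead)      ∷ suf) = places-refill _ suf
    places-refill pre ((i , bound _ _) ∷ suf) = places-refill _ suf

    unique-suffix : ∀ (p : List (Fin n)) {s} → Unique (p ʳ++ s) → Unique s
    unique-suffix []      u = u
    unique-suffix (a ∷ p) u with unique-suffix p u
    ... | _ ∷ v = v

    unique-prefix : ∀ (p : List (Fin n)) {s i} → i ∈ s → Unique (p ʳ++ s) → All (_≢ i) p
    unique-prefix []      m u = []
    unique-prefix (a ∷ p) m u with unique-suffix p u
    ... | a≢s ∷ _ = All.lookup a≢s m ∷ unique-prefix p (there m) u

    Located : Entries → Entries → Set
    Located pre suf = places pre ʳ++ places suf ≡ positions

    fresh-pre : ∀ pre {i μ suf} → Located pre ((i , μ) ∷ suf) → Fresh i pre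
    fresh-pre pre l = unique-prefix (places pre) (here ≡.refl) (≡.subst Unique (≡.sym l) distinct)

    fresh-suf : ∀ pre {i μ suf} → Located pre ((i , μ) ∷ suf) → Fresh i suf
    fresh-suf pre l with unique-suffix (places pre) (≡.subst Unique (≡.sym l) distinct)
    ... | i≢s ∷ _ = All.map (λ e → e ∘ ≡.sym) i≢s

    -- Lexicographic descent: `f` bounds the number of free positions and drops when a free one is
    -- contracted. Otherwise `pre` gets shorter or the weight at the cursor falls.
    build    : ∀ f pre suf → Located pre suf → count pre ℕ.+ count suf ≤ f → Full pre suf
    buildCur : ∀ f pre i κ e suf → e ≤ r → Located pre ((i , mark κ) ∷ suf) →
               count ((i , mark κ) ∷ pre) ℕ.+ count suf ≤ f → Cur pre i κ e suf

    build f []                        suf l p = end l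
    build f ((i , free)        ∷ pre) suf l p = free (buildCur f pre i free r suf ℕ.≤-refl l p)
    build f ((i , dead)        ∷ pre) suf l p = dead (build f pre _ l p)
    build f ((i , bound e e≤r) ∷ pre) suf l p = bound (buildCur f pre i bound e suf e≤r l p)

    buildCur f       pre i free  zero    suf q l p =
      done (build f pre _ l (≡.subst (_≤ f) (≡.sym (ℕ.+-suc _ _)) p))
    buildCur f       pre i bound zero    suf q l p = done (build f pre _ l p)
    buildCur (suc f) pre i free  (suc e) suf q l (s≤s p) =
      free q (fresh-pre pre {μ = free} {suf} l) (fresh-suf pre {μ = free} {suf} l) (buildCur (suc f) pre i free e suf (ℕ.<⇒≤ q) l (s≤s p))
        (build f (refill ((i , dead) ∷ pre) suf) [] (≡.trans (places-refill _ suf) l)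
          (≡.subst (_≤ f) (≡.sym (≡.trans (ℕ.+-identityʳ _) (count-refill _ suf))) p))
    buildCur f       pre i bound (suc e) suf q l p =
      bound q (fresh-pre pre {μ = free} {suf} l) (fresh-suf pre {μ = free} {suf} l) (buildCur f pre i bound e suf (ℕ.<⇒≤ q) l p) (build f pre _ l p)

  full : ∀ pre suf → places pre ʳ++ places suf ≡ positions → Full pre suf
  full pre suf l = build _ pre suf l ℕ.≤-refl

  Exponents : Set
  Exponents = Vec ℕ n

  PreBox : Entries → Exponents → Set
  PreBox []                        a = ⊤
  PreBox ((i , free)        ∷ pre) a = lookup a i < r ℕ.* count pre ℕ.+ r × PreBox pre a
  PreBox ((i , dead)        ∷ pre) a = lookup a i < 1 × PreBox pre a
  PreBox ((i , bound e e≤r) ∷ pre) a = lookup a i < r ℕ.* count pre ℕ.+ e × PreBox pre a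

  SufBox : ℕ → Entries → Exponents → Set
  SufBox k []                      a = ⊤
  SufBox k ((i , free)      ∷ suf) a = lookup a i < r ℕ.* k × SufBox (suc k) suf a
  SufBox k ((i , dead)      ∷ suf) a = lookup a i < 1 × SufBox k suf a
  SufBox k ((i , bound _ _) ∷ suf) a = lookup a i < r ℕ.* k × SufBox k suf a

  Box : Entries → Entries → Exponents → Set
  Box pre suf a = PreBox pre a × SufBox (count pre) suf a

  CurBox : Entries → Fin n → Kind → ℕ → Entries → Exponents → Set
  CurBox pre i κ e suf a =
    PreBox pre a × lookup a i < r ℕ.* count pre ℕ.+ e × SufBox (count ((i , mark κ) ∷ pre)) suf a

  private
    r*suc : ∀ k → r ℕ.* k ℕ.+ r ≡ r ℕ.* suc k
    r*suc k = ≡.trans (ℕ.+-comm _ r) (≡.sym (ℕ.*-suc r k))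

  -- The extra one in `k` is the free position that has just died: the limits behind the cursor
  -- still count it.
  refill-box⁺ : ∀ pre suf {k a} → k ≡ suc (count pre) →
                PreBox pre a → SufBox k suf a → PreBox (refill pre suf) a
  refill-box⁺ pre []                      e p q       = p
  refill-box⁺ pre ((i , free)      ∷ suf) {a = a} ≡.refl p (b , q) =
    refill-box⁺ _ suf ≡.refl (≡.subst (lookup a i <_) (≡.sym (r*suc (count pre))) b , p) q
  refill-box⁺ pre ((i , dead)      ∷ suf) e p (b , q) = refill-box⁺ _ suf e (b , p) q
  refill-box⁺ pre ((i , bound _ _) ∷ suf) {a = a} ≡.refl p (b , q) =
    refill-box⁺ _ suf ≡.refl (≡.subst (lookup a i <_) (≡.sym (r*suc (count pre))) b , p) q

  refill-box⁻ : ∀ pre suf {k a} → k ≡ suc (count pre) →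
                PreBox (refill pre suf) a → PreBox pre a × SufBox k suf a
  refill-box⁻ pre []                      e p = p , tt
  refill-box⁻ pre ((i , free)      ∷ suf) {a = a} ≡.refl p =
    let (b , p) , q = refill-box⁻ _ suf ≡.refl p
    in p , ≡.subst (lookup a i <_) (r*suc (count pre)) b , q
  refill-box⁻ pre ((i , dead)      ∷ suf) e p =
    let (b , p) , q = refill-box⁻ _ suf e p in p , b , q
  refill-box⁻ pre ((i , bound _ _) ∷ suf) {a = a} ≡.refl p =
    let (b , p) , q = refill-box⁻ _ suf ≡.refl p
    in p , ≡.subst (lookup a i <_) (r*suc (count pre)) b , q

  increment decrement : Fin n → Exponents → Exponents
  increment i a = updateAt a i suc
  decrement i a = updateAt a i ℕ.pred

  private
    Agree : Fin n → Exponents → Exponents → Set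
    Agree i a b = ∀ j → j ≢ i → lookup a j ≡ lookup b j

    preBox-agree : ∀ {i a b} pre → Agree i a b → Fresh i pre → PreBox pre a → PreBox pre b
    preBox-agree []                       e f       p = p
    preBox-agree ((j , free)      ∷ pre) e (g ∷ f) (q , p) = ≡.subst (_< _) (e j g) q , preBox-agree pre e f p
    preBox-agree ((j , dead)      ∷ pre) e (g ∷ f) (q , p) = ≡.subst (_< _) (e j g) q , preBox-agree pre e f p
    preBox-agree ((j , bound _ _) ∷ pre) e (g ∷ f) (q , p) = ≡.subst (_< _) (e j g) q , preBox-agree pre e f p

    sufBox-agree : ∀ {i a b k} suf → Agree i a b → Fresh i suf → SufBox k suf a → SufBox k suf b
    sufBox-agree []                       e f       p = p
    sufBox-agree ((j , free)      ∷ suf) e (g ∷ f) (q , p) = ≡.subst (_< _) (e j g) q , sufBox-agree suf e f p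
    sufBox-agree ((j , dead)      ∷ suf) e (g ∷ f) (q , p) = ≡.subst (_< _) (e j g) q , sufBox-agree suf e f p
    sufBox-agree ((j , bound _ _) ∷ suf) e (g ∷ f) (q , p) = ≡.subst (_< _) (e j g) q , sufBox-agree suf e f p

    agree-update : ∀ i (f : ℕ → ℕ) a → Agree i a (updateAt a i f)
    agree-update i f a j j≢i = ≡.sym (lookup∘updateAt′ j i j≢i a)

  curBox-increment : ∀ {pre i κ e suf a} → Fresh i pre → Fresh i suf →
                     CurBox pre i κ e suf a → CurBox pre i κ (suc e) suf (increment i a)
  curBox-increment {pre} {i} {κ} {e} {suf} {a} f g (p , b , q) =
    preBox-agree pre (agree-update i suc a) f p ,
    ≡.subst₂ _<_ (≡.sym (lookup∘updateAt i a)) (≡.sym (ℕ.+-suc _ e)) (s≤s b) ,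
    sufBox-agree suf (agree-update i suc a) g q

  curBox-decrement : ∀ {pre i κ e suf a} → Fresh i pre → Fresh i suf → lookup a i ≢ 0 →
                     CurBox pre i κ (suc e) suf a → CurBox pre i κ e suf (decrement i a)
  curBox-decrement {pre} {i} {κ} {e} {suf} {a} f g a≢0 (p , b , q) =
    preBox-agree pre (agree-update i ℕ.pred a) f p ,
    ≡.subst (_< r ℕ.* count pre ℕ.+ e) (≡.sym (lookup∘updateAt i a)) (bound′ a≢0 (≡.subst (lookup a i <_) (ℕ.+-suc _ e) b)) ,
    sufBox-agree suf (agree-update i ℕ.pred a) g q
    where
    bound′ : ∀ {k m} → k ≢ 0 → k < suc m → ℕ.pred k < m
    bound′ {zero}  k≢0 l       = contradiction ≡.refl k≢0
    bound′ {suc k} k≢0 (s≤s l) = l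

  contractFree⁺ : ∀ {pre i e suf a} → Box (refill ((i , dead) ∷ pre) suf) [] a → CurBox pre i free (suc e) suf a
  contractFree⁺ {pre} {i} {e} {suf} (p , _) =
    let (b , p) , q = refill-box⁻ ((i , dead) ∷ pre) suf ≡.refl p
    in p , ℕ.<-≤-trans b (ℕ.≤-trans (s≤s z≤n) (ℕ.m≤n+m _ (r ℕ.* count pre))) , q

  contractFree⁻ : ∀ {pre i e suf a} → lookup a i ≡ 0 → CurBox pre i free (suc e) suf a →
                  Box (refill ((i , dead) ∷ pre) suf) [] a
  contractFree⁻ {suf = suf} z (p , _ , q) = refill-box⁺ _ suf ≡.refl (≡.subst (_< 1) (≡.sym z) (s≤s z≤n) , p) q , tt

  contractBound⁺ : ∀ {pre i e suf a} → Box pre ((i , dead) ∷ suf) a → CurBox pre i bound (suc e) suf a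
  contractBound⁺ {pre} (p , b , q) = p , ℕ.<-≤-trans b (ℕ.≤-trans (s≤s z≤n) (ℕ.m≤n+m _ (r ℕ.* count pre))) , q

  contractBound⁻ : ∀ {pre i e suf a} → lookup a i ≡ 0 → CurBox pre i bound (suc e) suf a → Box pre ((i , dead) ∷ suf) a
  contractBound⁻ z (p , _ , q) = p , ≡.subst (_< 1) (≡.sym z) (s≤s z≤n) , q

  curBox-done⁺ : ∀ {pre i suf a} κ → Box pre ((i , mark κ) ∷ suf) a → CurBox pre i κ 0 suf a
  curBox-done⁺ {pre} {i} {a = a} free  (p , b , q) = p , ≡.subst (lookup a i <_) (≡.sym (ℕ.+-identityʳ _)) b , q
  curBox-done⁺ {pre} {i} {a = a} bound (p , b , q) = p , ≡.subst (lookup a i <_) (≡.sym (ℕ.+-identityʳ _)) b , q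

  curBox-done⁻ : ∀ {pre i suf a} κ → CurBox pre i κ 0 suf a → Box pre ((i , mark κ) ∷ suf) a
  curBox-done⁻ {pre} {i} {a = a} free  (p , b , q) = p , ≡.subst (lookup a i <_) (ℕ.+-identityʳ _) b , q
  curBox-done⁻ {pre} {i} {a = a} bound (p , b , q) = p , ≡.subst (lookup a i <_) (ℕ.+-identityʳ _) b , q

module Monomials {c ℓ : Level} (R : CommutativeRing c ℓ) where

  open CommutativeRing R hiding (zero)
  open IntegerSolver R
  open Exp semiring using (_^_)

  monomial : ∀ {n} → (Fin n → Carrier) → Vec ℕ n → Carrier
  monomial x a = Vector.foldr _*_ 1# (λ i → x i ^ lookup a i)

  monomial-0 : ∀ {n} (x : Fin n → Carrier) → monomial x (replicate n 0) ≈ 1#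
  monomial-0 {zero}  x = refl
  monomial-0 {suc n} x = trans (*-identityˡ _) (monomial-0 (λ i → x (suc i)))

  monomial-suc : ∀ {n} (x : Fin n → Carrier) i a → monomial x (updateAt a i suc) ≈ x i * monomial x a
  monomial-suc x zero    (k ∷ a) = *-assoc _ _ _
  monomial-suc x (suc i) (k ∷ a) = trans (*-congˡ (monomial-suc (λ i → x (suc i)) i a))
    (solve 3 (λ p q m → p :* (q :* m) := q :* (p :* m)) refl (x zero ^ k) (x (suc i)) (monomial (λ i → x (suc i)) a))

module Configurations {c ℓ : Level} (R : CommutativeRing c ℓ) {n : ℕ} (r : ℕ) (x : Fin n → CommutativeRing.Carrier R)
         (positions : List (Fin n)) (distinct : Unique positions) where

  open CommutativeRing R hiding (zero)
  open Exp semiring using (_^_)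
  open IntegerSolver R
  open Ideals R
  open SymmetricFunctions R
  open States r positions distinct public

  y : Fin n → Carrier
  y i = x i ^ r

  active : Entries → List Carrier
  active []                    = []
  active ((i , free)      ∷ l) = y i ∷ active l
  active ((i , dead)      ∷ l) = active l
  active ((i , bound _ _) ∷ l) = y i ∷ active l

  freeRoots : Entries → Carrier → Carrier
  freeRoots []                    ξ = 1#
  freeRoots ((i , free)      ∷ l) ξ = (ξ - y i) * freeRoots l ξ
  freeRoots ((i , dead)      ∷ l) ξ = freeRoots l ξ
  freeRoots ((i , bound _ _) ∷ l) ξ = freeRoots l ξ

  ∑-insert : ∀ A {z} B Q → ∑ (A ++ z ∷ B) Q ≈ Q z + ∑ (A ++ B) Q
  ∑-insert []      B Q = refl
  ∑-insert (a ∷ A) {z} B Q = trans (+-congˡ (∑-insert A B Q))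
    (solve 3 (λ p q s → p :+ (q :+ s) := q :+ (p :+ s)) refl (Q a) (Q z) (∑ (A ++ B) Q))

  ∑-refill : ∀ pre suf Q → ∑ (active (refill pre suf)) Q ≈ ∑ (active pre ++ active suf) Q
  ∑-refill pre []                      Q = sym (trans (∑-++ (active pre) [] Q) (+-identityʳ _))
  ∑-refill pre ((i , free)      ∷ suf) Q = trans (∑-refill _ suf Q) (sym (∑-insert (active pre) (active suf) Q))
  ∑-refill pre ((i , dead)      ∷ suf) Q = ∑-refill _ suf Q
  ∑-refill pre ((i , bound _ _) ∷ suf) Q = trans (∑-refill _ suf Q) (sym (∑-insert (active pre) (active suf) Q))

  module _ {p : Level} {𝔞 : Pred Carrier p} (I : IsIdeal 𝔞) where
    open IsIdeal I

    -- Power sums in 𝔞 generate all ∑ Q(t) for polynomials Q without constant term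
    ∑-freeRoots : ∀ L pre → (∀ k → 𝔞 (∑ L (λ t → t ^ suc k))) → ∀ k → 𝔞 (∑ L (λ t → t ^ suc k * freeRoots pre t))
    ∑-freeRoots L []                      s k = resp (∑-cong L (λ t → sym (*-identityʳ _))) (s k)
    ∑-freeRoots L ((i , dead)      ∷ pre) s k = ∑-freeRoots L pre s k
    ∑-freeRoots L ((i , bound _ _) ∷ pre) s k = ∑-freeRoots L pre s k
    ∑-freeRoots L ((i , free)      ∷ pre) s k = resp
      (trans (+-congˡ (trans (solve 2 (λ z s → :- (z :* s) := (:- z) :* s) refl (y i) _) (sym (∑-* L (- y i) _))))
        (trans (sym (∑-+ L _ _)) (∑-cong L λ t →
          solve 4 (λ t u z g → (t :* u) :* g :+ (:- z) :* (u :* g) := u :* ((t :- z) :* g)) refl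
            t (t ^ suc k) (y i) (freeRoots pre t))))
      (sub (∑-freeRoots L pre s (suc k)) (mul (y i) (∑-freeRoots L pre s k)))

-- Spanning: remainders modulo an ideal with exponents in a box

module Spanning {c ℓ : Level} (R : CommutativeRing c ℓ) {n : ℕ} (r : ℕ) (x : Fin n → CommutativeRing.Carrier R)
         (positions : List (Fin n)) (distinct : Unique positions)
         {s : Level} {A : Set s} (scalar : A → CommutativeRing.Carrier R) where

  open CommutativeRing R hiding (zero)
  open Exp semiring using (_^_)
  open Mult +-monoid using () renaming (_×_ to _·_)
  open IntegerSolver R
  open Ideals R
  open SymmetricFunctions R
  open Monomials R
  open Configurations R r x positions distinct

  data Span (B : Exponents → Set) : Carrier → Set (c ⊔ ℓ ⊔ s) where
    nil  : ∀ {h} → h ≈ 0# → Span B h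
    cons : ∀ k {a g h} → B a → Span B g → h ≈ scalar k * monomial x a + g → Span B h

  span-map : ∀ {B B′ : Exponents → Set} → (∀ {a} → B a → B′ a) → ∀ {h} → Span B h → Span B′ h
  span-map f (nil e)        = nil e
  span-map f (cons k b s e) = cons k (f b) (span-map f s) e

  span-resp : ∀ {B g h} → h ≈ g → Span B g → Span B h
  span-resp e (nil e′)        = nil (trans e e′)
  span-resp e (cons k b s e′) = cons k b s (trans e e′)

  span-+ : ∀ {B g h} → Span B g → Span B h → Span B (g + h)
  span-+ (nil e)        t = span-resp (trans (+-congʳ e) (+-identityˡ _)) t
  span-+ (cons k b s e) t = cons k b (span-+ s t) (trans (+-congʳ e) (+-assoc _ _ _))

  span-shift : ∀ {B B′ : Exponents → Set} i → (∀ {a} → B a → B′ (increment i a)) → ∀ {h} → Span B h → Span B′ (x i * h)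
  span-shift i f (nil e) = nil (trans (*-congˡ e) (zeroʳ _))
  span-shift i f (cons k {a} {g} b s e) = cons k (f b) (span-shift i f s)
    (trans (*-congˡ e) (trans (solve 4 (λ z k m g → z :* (k :* m :+ g) := k :* (z :* m) :+ z :* g) refl
      (x i) (scalar k) (monomial x a) g) (+-congʳ (*-congˡ (sym (monomial-suc x i a))))))

  module _ {p : Level} (𝔞 : Pred Carrier p) where

    PreGens : Entries → Set p
    PreGens []                      = Lift p ⊤
    PreGens ((i , free)      ∷ pre) = PreGens pre
    PreGens ((i , dead)      ∷ pre) = 𝔞 (x i) × PreGens pre
    PreGens ((i , bound e _) ∷ pre) = 𝔞 (x i ^ e * freeRoots pre (y i)) × PreGens pre

    SufGens : (Carrier → Carrier) → Entries → Set p
    SufGens g []                      = Lift p ⊤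
    SufGens g ((i , free)      ∷ suf) = SufGens (λ ξ → (ξ - y i) * g ξ) suf
    SufGens g ((i , dead)      ∷ suf) = 𝔞 (x i) × SufGens g suf
    SufGens g ((i , bound _ _) ∷ suf) = 𝔞 (g (y i)) × SufGens g suf

    -- At `t = y i` the leading power of `x i` is r·(count pre) + e, the limit of the box. A bound
    -- position has this generator by itself. At a free one only sums with the later active `t` are
    -- available, and all powers `t ^ k` are kept because `leave` turns them into `tails`.
    OwnGens : Entries → Fin n → Kind → ℕ → Entries → Set p
    OwnGens pre i free  e suf = ∀ k → 𝔞 (x i ^ e * ∑ (y i ∷ active suf) (λ t → t ^ k * freeRoots pre t))
    OwnGens pre i bound e suf = 𝔞 (x i ^ e * freeRoots pre (y i))

    record FullGens (pre suf : Entries) : Set p where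
      field
        preGens : PreGens pre
        sufGens : SufGens (freeRoots pre) suf
        sums    : ∀ k → 𝔞 (∑ (active pre ++ active suf) (λ t → t ^ suc k))
        tails   : ∀ k → 𝔞 (∑ (active suf) (λ t → t ^ k * freeRoots pre t))

    record CurGens (pre : Entries) (i : Fin n) (κ : Kind) (e : ℕ) (suf : Entries) : Set p where
      field
        preGens : PreGens pre
        sufGens : SufGens (freeRoots ((i , mark κ) ∷ pre)) suf
        sums    : ∀ k → 𝔞 (∑ (active pre ++ y i ∷ active suf) (λ t → t ^ suc k))
        tails   : ∀ k → 𝔞 (∑ (active suf) (λ t → t ^ k * freeRoots ((i , mark κ) ∷ pre) t))
        own     : OwnGens pre i κ e suf

  module _ {p q : Level} {𝔞 : Pred Carrier p} {𝔟 : Pred Carrier q} (f : ∀ {h} → 𝔞 h → 𝔟 h) where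

    preGens-map : ∀ pre → PreGens 𝔞 pre → PreGens 𝔟 pre
    preGens-map []                      g       = _
    preGens-map ((i , free)      ∷ pre) g       = preGens-map pre g
    preGens-map ((i , dead)      ∷ pre) (h , g) = f h , preGens-map pre g
    preGens-map ((i , bound e _) ∷ pre) (h , g) = f h , preGens-map pre g

    sufGens-map : ∀ {u} suf → SufGens 𝔞 u suf → SufGens 𝔟 u suf
    sufGens-map []                      g       = _
    sufGens-map ((i , free)      ∷ suf) g       = sufGens-map suf g
    sufGens-map ((i , dead)      ∷ suf) (h , g) = f h , sufGens-map suf g
    sufGens-map ((i , bound e _) ∷ suf) (h , g) = f h , sufGens-map suf g

  power-split : ∀ z {e} → e ≤ r → z ^ r ≈ z ^ (r ℕ.∸ e) * z ^ e
  power-split z {e} e≤r = trans (reflexive (≡.cong (z ^_) (≡.sym (ℕ.m∸n+n≡m e≤r)))) (Exp.^-homo-* semiring z (r ℕ.∸ e) e)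

  module _ {p : Level} {𝔞 : Pred Carrier p} (I : IsIdeal 𝔞) where
    open IsIdeal I

    -- A free `t` is a root of `freeRoots`. For a bound position of weight `e` the factor t = x i ^
    -- r contains the `x i ^ e` required by its generator.
    preGens-∑ : ∀ pre → PreGens 𝔞 pre → ∀ Q → 𝔞 (∑ (active pre) (λ t → t * freeRoots pre t * Q t))
    preGens-∑ []                      g       Q = zero∈
    preGens-∑ ((i , dead)      ∷ pre) (_ , g) Q = preGens-∑ pre g Q
    preGens-∑ ((i , free)      ∷ pre) g       Q = resp
      (sym (trans (+-cong
        (solve 3 (λ z w q → z :* ((z :- z) :* w) :* q := con (ℤ.+ 0)) refl (y i) (freeRoots pre (y i)) (Q (y i)))
        (∑-cong (active pre) λ t → solve 4 (λ t z w q → t :* ((t :- z) :* w) :* q := t :* w :* ((t :- z) :* q)) refl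
          t (y i) (freeRoots pre t) (Q t))) (+-identityˡ _)))
      (preGens-∑ pre g (λ t → (t - y i) * Q t))
    preGens-∑ ((i , bound e e≤r) ∷ pre) (h , g) Q = add
      (resp (trans (solve 4 (λ u v w q → (u :* q) :* (v :* w) := (u :* v) :* w :* q) refl
          (x i ^ (r ℕ.∸ e)) (x i ^ e) (freeRoots pre (y i)) (Q (y i)))
          (*-congʳ (*-congʳ (sym (power-split (x i) e≤r)))))
        (mul (x i ^ (r ℕ.∸ e) * Q (y i)) h))
      (preGens-∑ pre g Q)

    enter-free : ∀ {pre i suf} → FullGens 𝔞 ((i , free) ∷ pre) suf → CurGens 𝔞 pre i free r suf
    enter-free {pre} {i} {suf} g = record
      { preGens = G.preGens ; sufGens = G.sufGens ; sums = sums′ ; tails = G.tails ; own = own′ }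
      where
      module G = FullGens g
      sums′ : ∀ k → 𝔞 (∑ (active pre ++ y i ∷ active suf) (λ t → t ^ suc k))
      sums′ k = resp (sym (∑-insert (active pre) (active suf) _)) (G.sums k)
      -- From the sum of t^(k+1) · freeRoots over all active `t`, remove the part in `pre` and then
      -- `tails`. The factor t - y i in `tails` leaves `y i` times a sum, and y i = x i ^ r is the
      -- starting weight of a free position.
      own′ : ∀ k → 𝔞 (y i * ∑ (y i ∷ active suf) (λ t → t ^ k * freeRoots pre t))
      own′ k = resp
        (trans (+-congʳ (+-congʳ (∑-++ (active pre) (y i ∷ active suf) _)))
          (trans (+-cong (+-congˡ (-‿cong (∑-cong (active pre) λ t →
             solve 3 (λ t g u → t :* g :* u := t :* u :* g) refl t (freeRoots pre t) (t ^ k))))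
             (-‿cong (trans (∑-cong (active suf) λ t →
               solve 4 (λ t z u g → u :* ((t :- z) :* g) := (t :* u) :* g :+ (:- z) :* (u :* g)) refl
                 t (y i) (t ^ k) (freeRoots pre t)) (trans (∑-+ (active suf) _ _) (+-congˡ (∑-* (active suf) (- y i) _))))))
          (solve 6 (λ P z u g S S′ → ((P :+ ((z :* u) :* g :+ S)) :- P) :- (S :+ (:- z) :* S′) := z :* (u :* g :+ S′)) refl
            (∑ (active pre) (λ t → t ^ suc k * freeRoots pre t)) (y i) (y i ^ k) (freeRoots pre (y i))
            (∑ (active suf) (λ t → t ^ suc k * freeRoots pre t)) (∑ (active suf) (λ t → t ^ k * freeRoots pre t)))))
        (sub (sub (∑-freeRoots I (active pre ++ y i ∷ active suf) pre sums′ k) (preGens-∑ pre G.preGens (_^ k))) (G.tails k))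

    enter-bound : ∀ {pre i e e≤r suf} → FullGens 𝔞 ((i , bound e e≤r) ∷ pre) suf → CurGens 𝔞 pre i bound e suf
    enter-bound {pre} {i} {e} {_} {suf} g = record
      { preGens = proj₂ G.preGens ; sufGens = G.sufGens
      ; sums = λ k → resp (sym (∑-insert (active pre) (active suf) _)) (G.sums k)
      ; tails = G.tails ; own = proj₁ G.preGens }
      where module G = FullGens g

    enter-dead : ∀ {pre i suf} → FullGens 𝔞 ((i , dead) ∷ pre) suf → FullGens 𝔞 pre ((i , dead) ∷ suf)
    enter-dead g = record
      { preGens = proj₂ G.preGens ; sufGens = proj₁ G.preGens , G.sufGens ; sums = G.sums ; tails = G.tails }
      where module G = FullGens g

    leave : ∀ {pre i suf} κ → CurGens 𝔞 pre i κ 0 suf → FullGens 𝔞 pre ((i , mark κ) ∷ suf)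
    leave free  g = record
      { preGens = G.preGens ; sufGens = G.sufGens ; sums = G.sums ; tails = λ k → resp (*-identityˡ _) (G.own k) }
      where module G = CurGens g
    leave bound g = record
      { preGens = G.preGens ; sufGens = resp (*-identityˡ _) G.own , G.sufGens ; sums = G.sums
      ; tails = λ k → add (mul _ (resp (*-identityˡ _) G.own)) (G.tails k) }
      where module G = CurGens g

    -- Passing to the colon ideal strips one `x i` off the generator at the cursor; all other
    -- generators are merely carried over.
    delete : ∀ {pre i e suf} κ → CurGens 𝔞 pre i κ (suc e) suf → CurGens (λ h → 𝔞 (x i * h)) pre i κ e suf
    delete {pre} {i} {e} {suf} κ g = record
      { preGens = preGens-map (mul (x i)) pre G.preGens ; sufGens = sufGens-map (mul (x i)) suf G.sufGens
      ; sums = λ k → mul (x i) (G.sums k) ; tails = λ k → mul (x i) (G.tails k) ; own = own′ κ G.own }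
      where
      module G = CurGens g
      own′ : ∀ κ → OwnGens 𝔞 pre i κ (suc e) suf → OwnGens (λ h → 𝔞 (x i * h)) pre i κ e suf
      own′ free  o k = resp (*-assoc _ _ _) (o k)
      own′ bound o   = resp (*-assoc _ _ _) o

  module _ {p : Level} {𝔞 : Pred Carrier p} (I : IsIdeal 𝔞) where
    open IsIdeal I

    power∈ : 1 ≤ r → ∀ {i} → 𝔞 (x i) → 𝔞 (y i)
    power∈ 1≤r {i} h = resp (trans (*-congˡ (sym (*-identityʳ _))) (sym (power-split (x i) 1≤r))) (mul (x i ^ (r ℕ.∸ 1)) h)

    -- As `z` lies in `𝔞`, the factor y i - z in a generator behind the cursor becomes y i = x i ^
    -- r. That is the generator of weight `r` required after `refill`.
    refill-gens : ∀ {u z} pre suf → 𝔞 z → (∀ ξ → u ξ ≈ (ξ - z) * freeRoots pre ξ) →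
                  PreGens 𝔞 pre → SufGens 𝔞 u suf → PreGens 𝔞 (refill pre suf)
    refill-gens pre []                      z∈ eq g h       = g
    refill-gens {u} {z} pre ((i , free) ∷ suf) z∈ eq g h =
      refill-gens _ suf z∈ (λ ξ → trans (*-congˡ (eq ξ))
        (solve 4 (λ a b ξ w → (ξ :- a) :* ((ξ :- b) :* w) := (ξ :- b) :* ((ξ :- a) :* w)) refl
          (y i) z ξ (freeRoots pre ξ))) g h
    refill-gens pre ((i , dead)      ∷ suf) z∈ eq g (h , hs) = refill-gens _ suf z∈ eq (h , g) hs
    refill-gens {u} {z} pre ((i , bound _ _) ∷ suf) z∈ eq g (h , hs) = refill-gens _ suf z∈ eq
      (resp (trans (+-congʳ (eq (y i)))
          (solve 3 (λ a b w → ((a :- b) :* w) :+ w :* b := a :* w) refl (y i) z (freeRoots pre (y i))))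
        (add h (mul (freeRoots pre (y i)) z∈)) , g) hs

    contract-sums : ∀ {i} A B → 𝔞 (y i) → (∀ k → 𝔞 (∑ (A ++ y i ∷ B) (λ t → t ^ suc k))) → ∀ k → 𝔞 (∑ (A ++ B) (λ t → t ^ suc k))
    contract-sums {i} A B z∈ s k = resp
      (trans (+-congʳ (∑-insert A B _)) (solve 3 (λ z u s → (z :* u :+ s) :- z :* u := s) refl (y i) (y i ^ k) _))
      (sub (s k) (mulʳ (y i ^ k) z∈))

    contract-free : 1 ≤ r → ∀ {pre i e suf} → 𝔞 (x i) → CurGens 𝔞 pre i free e suf →
                    FullGens 𝔞 (refill ((i , dead) ∷ pre) suf) []
    contract-free 1≤r {pre} {i} {e} {suf} x∈ g = record
      { preGens = refill-gens ((i , dead) ∷ pre) suf z∈ (λ ξ → refl) (x∈ , G.preGens) G.sufGens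
      ; sufGens = _
      ; sums = λ k → resp (sym (trans (∑-++ (active (refill ((i , dead) ∷ pre) suf)) [] _) (trans (+-identityʳ _)
                 (∑-refill ((i , dead) ∷ pre) suf _)))) (contract-sums (active pre) (active suf) z∈ G.sums k)
      ; tails = λ k → zero∈ }
      where
      module G = CurGens g
      z∈ = power∈ 1≤r x∈

    contract-bound : 1 ≤ r → ∀ {pre i e suf} → 𝔞 (x i) → CurGens 𝔞 pre i bound e suf → FullGens 𝔞 pre ((i , dead) ∷ suf)
    contract-bound 1≤r {pre} {i} {e} {suf} x∈ g = record
      { preGens = G.preGens ; sufGens = x∈ , G.sufGens
      ; sums = contract-sums (active pre) (active suf) (power∈ 1≤r x∈) G.sums ; tails = G.tails }
      where module G = CurGens g

  curGens-map : ∀ {p q} {𝔞 : Pred Carrier p} {𝔟 : Pred Carrier q} → (∀ {h} → 𝔞 h → 𝔟 h) →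
                ∀ {pre i e suf} κ → CurGens 𝔞 pre i κ e suf → CurGens 𝔟 pre i κ e suf
  curGens-map {𝔞 = 𝔞} {𝔟} f {pre} {i} {e} {suf} κ g = record
    { preGens = preGens-map f pre G.preGens ; sufGens = sufGens-map f suf G.sufGens
    ; sums = λ k → f (G.sums k) ; tails = λ k → f (G.tails k) ; own = own′ κ G.own }
    where
    module G = CurGens g
    own′ : ∀ κ → OwnGens 𝔞 pre i κ e suf → OwnGens 𝔟 pre i κ e suf
    own′ free  o k = f (o k)
    own′ bound o   = f o

  dead-or-active : ∀ {p} {𝔞 : Pred Carrier p} suf {u} → SufGens 𝔞 u suf →
                   (∃[ z ] ∃[ L ] active suf ≡ z ∷ L) ⊎ ((∀ {i} → i ∈ places suf → 𝔞 (x i)) × SufBox 0 suf (replicate n 0))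
  dead-or-active []                      g       = inj₂ ((λ ()) , tt)
  dead-or-active ((i , free)      ∷ suf) g       = inj₁ (_ , _ , ≡.refl)
  dead-or-active ((i , bound _ _) ∷ suf) g       = inj₁ (_ , _ , ≡.refl)
  dead-or-active ((i , dead)      ∷ suf) (h , g) with dead-or-active suf g
  ... | inj₁ q        = inj₁ q
  ... | inj₂ (q , b) = inj₂ ((λ { (here ≡.refl) → h ; (there m) → q m }) ,
                              ≡.subst (_< 1) (≡.sym (lookup-replicate i 0)) (s≤s z≤n) , b)

  module _ (1≤r : 1 ≤ r) (complete : ∀ i → i ∈ positions)
           (invert : InvertibleNaturals R)
           (p : Level)
           (augment : ∀ h → ∃[ k ] ∀ {𝔞 : Pred Carrier (c ⊔ p)} → IsIdeal 𝔞 → (∀ i → 𝔞 (x i)) → 𝔞 (h - scalar k))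
    where

    private
      -- The level `c ⊔ p` is stable under the recursion: `plus` quantifies over `Carrier`, which
      -- would lift a predicate at level `p`.
      Reduces : (Exponents → Set) → Pred Carrier (c ⊔ p) → Set _
      Reduces B 𝔞 = ∀ h → ∃[ g ] Span B g × 𝔞 (h - g)

      ∑-ones : ∀ L → ∑ L (λ t → t ^ 0 * 1#) ≈ length L · 1#
      ∑-ones []      = refl
      ∑-ones (t ∷ L) = +-cong (*-identityˡ _) (∑-ones L)

      -- With nothing before the cursor, `tails` at `k = 0` is the number of active positions. If it
      -- is positive it is a unit, and the ideal is everything. Otherwise all variables are dead,
      -- and what remains of `h` is a constant.
      base : ∀ {𝔞} suf → IsIdeal 𝔞 → places suf ≡ positions → FullGens 𝔞 [] suf → Reduces (Box [] suf) 𝔞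
      base {𝔞} suf I l g h with dead-or-active {𝔞 = 𝔞} suf (FullGens.sufGens g)
      ... | inj₁ (z , L , eq) = 0# , nil refl ,
        resp (trans (*-assoc _ _ _) (trans (*-congˡ (proj₂ (invert (length L)))) (trans (*-identityʳ h)
               (solve 1 (λ h → h := h :- con (ℤ.+ 0)) refl h))))
          (mul (h * proj₁ (invert (length L)))
            (resp (trans (reflexive (≡.cong (λ L → ∑ L (λ t → t ^ 0 * 1#)) eq)) (∑-ones (z ∷ L))) (FullGens.tails g 0)))
        where open IsIdeal I
      ... | inj₂ (q , b) with augment h
      ...   | k , f = scalar k , cons k (tt , b) (nil refl)
                (sym (trans (+-identityʳ _) (trans (*-congˡ (monomial-0 x)) (*-identityʳ _)))) ,
              f I (λ i → q (≡.subst (i ∈_) (≡.sym l) (complete i)))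

      -- g₀ is a remainder modulo 𝔞 + (x i), and g₁ one of the quotient modulo 𝔞 : x i.
      combine : ∀ {𝔞 B B₀ B₁} i → IsIdeal 𝔞 → (∀ {a} → B₀ a → B a) → (∀ {a} → B₁ a → B (increment i a)) →
                Reduces B₀ (λ h → ∃[ q ] 𝔞 (h - x i * q)) → Reduces B₁ (λ h → 𝔞 (x i * h)) → Reduces B 𝔞
      combine i I f₀ f₁ red₀ red₁ h with red₀ h
      ... | g₀ , s₀ , q , a₀ with red₁ q
      ...   | g₁ , s₁ , a₁ = g₀ + x i * g₁ , span-+ (span-map f₀ s₀) (span-shift i f₁ s₁) ,
        resp (solve 5 (λ h g z q g′ → ((h :- g) :- z :* q) :+ z :* (q :- g′) := h :- (g :+ z :* g′)) refl h g₀ (x i) q g₁)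
          (add a₀ a₁)
        where open IsIdeal I

      reduceCur : ∀ {pre i κ e suf} → Cur pre i κ e suf → ∀ {𝔞} → IsIdeal 𝔞 → CurGens 𝔞 pre i κ e suf → Reduces (CurBox pre i κ e suf) 𝔞

    reduce : ∀ {pre suf} → Full pre suf → ∀ {𝔞} → IsIdeal 𝔞 → FullGens 𝔞 pre suf → Reduces (Box pre suf) 𝔞
    reduce (end {suf} l) I g = base suf I l g
    reduce (free {pre} {i} {suf} t) I g h =
      let u , s , q = reduceCur t I (enter-free I g) h in u , span-map (λ (b , b′ , b″) → (b′ , b) , b″) s , q
    reduce (bound {pre} {i} {e} {e≤r} {suf} t) I g h =
      let u , s , q = reduceCur t I (enter-bound I g) h in u , span-map (λ (b , b′ , b″) → (b′ , b) , b″) s , q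
    reduce (dead t) I g h =
      let u , s , q = reduce t I (enter-dead I g) h in u , span-map (λ (b , b′ , b″) → (b′ , b) , b″) s , q

    reduceCur (done {κ = κ} t) I g h =
      let u , s , q = reduce t I (leave I κ g) h in u , span-map (curBox-done⁺ κ) s , q
    reduceCur (free {pre} {i} {e} {suf} e<r f f′ t t′) I g =
      combine i I contractFree⁺ (curBox-increment {κ = free} f f′)
        (reduce t′ (plus I (x i)) (contract-free (plus I (x i)) 1≤r (plus-gen I (x i)) (curGens-map (plus-base I (x i)) free g)))
        (reduceCur t (colon I (x i)) (delete I free g))
    reduceCur (bound {pre} {i} {e} {suf} e<r f f′ t t′) I g =
      combine i I contractBound⁺ (curBox-increment {κ = bound} f f′)
        (reduce t′ (plus I (x i)) (contract-bound (plus I (x i)) 1≤r (plus-gen I (x i)) (curGens-map (plus-base I (x i)) bound g)))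
        (reduceCur t (colon I (x i)) (delete I bound g))

-- Independence: complementary factors and coinvariant ideals

module SymmetricLists {c ℓ : Level} (R : CommutativeRing c ℓ) where

  open CommutativeRing R hiding (zero)
  open Exp semiring using (_^_)
  open IntegerSolver R
  open Ideals R
  open SymmetricFunctions R

  elem-↭ : ∀ {A B} → A ↭ B → ∀ k → elem k A ≈ elem k B
  elem-↭ p               zero          = refl
  elem-↭ Perm.refl       (suc k)       = refl
  elem-↭ (prep t p)      (suc k)       = +-cong (elem-↭ p (suc k)) (-‿cong (*-congˡ (elem-↭ p k)))
  elem-↭ (Perm.trans p q) (suc k)       = trans (elem-↭ p (suc k)) (elem-↭ q (suc k))
  elem-↭ (swap {xs = A} {ys = B} s t p) (suc zero) = trans
    (+-congʳ (+-congʳ (elem-↭ p 1)))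
    (solve 4 (λ b u s t → (b :- t :* u) :- s :* u := (b :- s :* u) :- t :* u) refl (elem 1 B) 1# s t)
  elem-↭ (swap {xs = A} {ys = B} s t p) (suc (suc k)) = trans
    (+-cong (+-cong (elem-↭ p (2 ℕ.+ k)) (-‿cong (*-congˡ (elem-↭ p (suc k)))))
      (-‿cong (*-congˡ (+-cong (elem-↭ p (suc k)) (-‿cong (*-congˡ (elem-↭ p k)))))))
    (solve 5 (λ a b d s t → (a :- t :* b) :- s :* (b :- t :* d) := (a :- s :* b) :- t :* (b :- s :* d)) refl
      (elem (2 ℕ.+ k) B) (elem (suc k) B) (elem k B) s t)

  ∑-↭ : ∀ {A B} → A ↭ B → ∀ Q → ∑ A Q ≈ ∑ B Q
  ∑-↭ Perm.refl    Q = refl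
  ∑-↭ (prep t p)   Q = +-congˡ (∑-↭ p Q)
  ∑-↭ (Perm.trans p q) Q = trans (∑-↭ p Q) (∑-↭ q Q)
  ∑-↭ (swap s t p) Q = trans (+-congˡ (+-congˡ (∑-↭ p Q)))
    (solve 3 (λ a b c → a :+ (b :+ c) := b :+ (a :+ c)) refl (Q s) (Q t) _)

  ʳ++-↭ : ∀ (A B : List Carrier) → A ʳ++ B ↭ A ++ B
  ʳ++-↭ A B = ≡.subst (_↭ A ++ B) (≡.sym (ʳ++-defn A)) (++⁺ʳ B (↭-reverse A))

  comonic-insert : ∀ A {z} B ξ → comonic (A ++ z ∷ B) ξ ≈ (z - ξ) * comonic (A ++ B) ξ
  comonic-insert []      B ξ = refl
  comonic-insert (a ∷ A) {z} B ξ = trans (*-congˡ (comonic-insert A B ξ))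
    (solve 3 (λ a z m → a :* (z :* m) := z :* (a :* m)) refl (a - ξ) (z - ξ) (comonic (A ++ B) ξ))

  monic-insert : ∀ A {z} B ξ → monic (A ++ z ∷ B) ξ ≈ (ξ - z) * monic (A ++ B) ξ
  monic-insert []      B ξ = refl
  monic-insert (a ∷ A) {z} B ξ = trans (*-congˡ (monic-insert A B ξ))
    (solve 3 (λ a z m → a :* (z :* m) := z :* (a :* m)) refl (ξ - a) (ξ - z) (monic (A ++ B) ξ))

  comonic-sign : ∀ L ξ → ∃[ s ] comonic L ξ ≈ s * monic L ξ
  comonic-sign []      ξ = 1# , sym (*-identityˡ 1#)
  comonic-sign (t ∷ L) ξ = let s , e = comonic-sign L ξ in - s ,
    trans (*-congˡ e) (solve 4 (λ t ξ s m → (t :- ξ) :* (s :* m) := (:- s) :* ((ξ :- t) :* m)) refl t ξ s (monic L ξ))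

  -- This allows the product of the t - ξ to be replaced by the product of the `t` wherever a
  -- multiple of `ξ` is already known to vanish.
  comonic-split : ∀ L ξ → ∃[ q ] comonic L 0# - comonic L ξ ≈ ξ * q
  comonic-split []      ξ = 0# , trans (-‿inverseʳ 1#) (sym (zeroʳ ξ))
  comonic-split (t ∷ L) ξ = let q , e = comonic-split L ξ in t * q + comonic L ξ ,
    trans (solve 4 (λ t ξ a b → (t :- con (ℤ.+ 0)) :* a :- (t :- ξ) :* b := t :* (a :- b) :+ ξ :* b) refl t ξ (comonic L 0#) (comonic L ξ))
    (trans (+-congʳ (*-congˡ e)) (solve 4 (λ t ξ q b → t :* (ξ :* q) :+ ξ :* b := ξ :* (t :* q :+ b)) refl t ξ q (comonic L ξ)))

  comonic-root : ∀ {L t} → t ∈ L → comonic L t ≈ 0#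
  comonic-root {s ∷ L} (here ≡.refl) = trans (*-congʳ (-‿inverseʳ s)) (zeroˡ _)
  comonic-root {s ∷ L} (there m)     = trans (*-congˡ (comonic-root m)) (zeroʳ _)

  vandermonde : List Carrier → Carrier
  vandermonde []      = 1#
  vandermonde (t ∷ L) = monic L t * vandermonde L

  vandermonde-remove : ∀ A {z} B → vandermonde (A ++ z ∷ B) ≈ comonic A z * monic B z * vandermonde (A ++ B)
  vandermonde-remove []      B = *-congʳ (sym (*-identityˡ _))
  vandermonde-remove (a ∷ A) {z} B = trans
    (*-cong (monic-insert A B a) (vandermonde-remove A B))
    (solve 5 (λ p q m n v → (p :* q) :* (m :* n :* v) := (p :* m) :* n :* (q :* v)) refl
      (a - z) (monic (A ++ B) a) (comonic A z) (monic B z) (vandermonde (A ++ B)))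

  module _ {p : Level} {𝔟 : Pred Carrier p} (I : IsIdeal 𝔟) where
    open IsIdeal I

    flip : ∀ L ξ {g} → 𝔟 (g * comonic L ξ) → 𝔟 (g * monic L ξ)
    flip []      ξ h = h
    flip (t ∷ L) ξ {g} h = resp (*-assoc _ _ _) (flip L ξ (resp
      (solve 4 (λ g t ξ m → :- (g :* ((t :- ξ) :* m)) := g :* (ξ :- t) :* m) refl g t ξ (comonic L ξ)) (neg h)))

    unflip : ∀ L ξ {g} → 𝔟 (g * monic L ξ) → 𝔟 (g * comonic L ξ)
    unflip []      ξ h = h
    unflip (t ∷ L) ξ {g} h = resp (*-assoc _ _ _) (unflip L ξ (resp
      (solve 4 (λ g t ξ m → :- (g :* ((ξ :- t) :* m)) := g :* (t :- ξ) :* m) refl g t ξ (monic L ξ)) (neg h)))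

    ∑∈ : ∀ L {Q f} → (∀ {t} → t ∈ L → 𝔟 (Q t * f)) → 𝔟 (∑ L Q * f)
    ∑∈ []      h = resp (sym (zeroˡ _)) zero∈
    ∑∈ (t ∷ L) h = resp (sym (distribʳ _ _ _)) (add (h (here ≡.refl)) (∑∈ L (λ m → h (there m))))

    ∑-comonic : ∀ L B {Q : Carrier → Carrier} → (∀ k → 𝔟 (∑ L (λ t → t ^ suc k * Q t))) →
                ∀ k → 𝔟 (∑ L (λ t → t ^ suc k * (comonic B t * Q t)))
    ∑-comonic L []      h k = resp (∑-cong L λ t → *-congˡ (sym (*-identityˡ _))) (h k)
    ∑-comonic L (b ∷ B) {Q} h k = resp
      (trans (+-cong (sym (∑-* L b _)) (trans (solve 1 (λ s → :- s := con (ℤ.- (ℤ.+ 1)) :* s) refl _) (sym (∑-* L _ _))))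
        (trans (sym (∑-+ L _ _)) (∑-cong L λ t → solve 5 (λ b t u m q →
          b :* (u :* (m :* q)) :+ con (ℤ.- (ℤ.+ 1)) :* ((t :* u) :* (m :* q)) := u :* ((b :- t) :* m :* q)) refl
          b t (t ^ suc k) (comonic B t) (Q t))))
      (sub (mul b (∑-comonic L B h k)) (∑-comonic L B h (suc k)))

module Complements {c ℓ : Level} (R : CommutativeRing c ℓ) {n : ℕ} (r : ℕ) (x : Fin n → CommutativeRing.Carrier R)
         (positions : List (Fin n)) (distinct : Unique positions) where

  open CommutativeRing R hiding (zero)
  open Exp semiring using (_^_)
  open IntegerSolver R
  open SymmetricFunctions R
  open SymmetricLists R
  open Configurations R r x positions distinct

  -- ∏ x i ^ (r - weight) over the entries of pre, times the factors (y t - y i)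
  -- for i bound in pre and t active after i; the list holds those t outside pre.
  preFactor : Entries → List Carrier → Carrier
  preFactor []                      A = 1#
  preFactor ((i , free)      ∷ pre) A = preFactor pre (y i ∷ A)
  preFactor ((i , dead)      ∷ pre) A = preFactor pre A
  preFactor ((i , bound e _) ∷ pre) A = x i ^ (r ℕ.∸ e) * comonic A (y i) * preFactor pre (y i ∷ A)

  -- Weight 0 behind the cursor makes each active entry contribute the full power x i ^ r = y i.
  -- `boundFactor` omits these powers, as is right after `refill`, where the weight is `r`.
  sufFactor boundFactor : Entries → Carrier
  sufFactor []                      = 1#
  sufFactor ((i , free)      ∷ suf) = y i * sufFactor suf
  sufFactor ((i , dead)      ∷ suf) = sufFactor suf
  sufFactor ((i , bound _ _) ∷ suf) = y i * comonic (active suf) (y i) * sufFactor suf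
  boundFactor []                      = 1#
  boundFactor ((i , free)      ∷ suf) = boundFactor suf
  boundFactor ((i , dead)      ∷ suf) = boundFactor suf
  boundFactor ((i , bound _ _) ∷ suf) = comonic (active suf) (y i) * boundFactor suf

  boundRoots : Entries → Carrier → Carrier
  boundRoots []                      ξ = 1#
  boundRoots ((i , free)      ∷ l) ξ = boundRoots l ξ
  boundRoots ((i , dead)      ∷ l) ξ = boundRoots l ξ
  boundRoots ((i , bound _ _) ∷ l) ξ = (ξ - y i) * boundRoots l ξ

  factor : Entries → Entries → Carrier
  factor pre suf = preFactor pre (active suf) * sufFactor suf

  ownFactor : Fin n → Kind → Entries → Carrier
  ownFactor i free  suf = 1#
  ownFactor i bound suf = comonic (active suf) (y i)

  curFactor : Entries → Fin n → Kind → ℕ → Entries → Carrier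
  curFactor pre i κ e suf = x i ^ (r ℕ.∸ e) * (ownFactor i κ suf * (preFactor pre (y i ∷ active suf) * sufFactor suf))

  roots-split : ∀ pre ξ → freeRoots pre ξ * boundRoots pre ξ ≈ monic (active pre) ξ
  roots-split []                      ξ = *-identityˡ 1#
  roots-split ((i , dead)      ∷ pre) ξ = roots-split pre ξ
  roots-split ((i , free)      ∷ pre) ξ = trans (*-assoc _ _ _) (*-congˡ (roots-split pre ξ))
  roots-split ((i , bound _ _) ∷ pre) ξ = trans
    (solve 3 (λ w z b → w :* (z :* b) := z :* (w :* b)) refl (freeRoots pre ξ) (ξ - y i) (boundRoots pre ξ))
    (*-congˡ (roots-split pre ξ))

  preFactor-insert : ∀ pre A {z} B → preFactor pre (A ++ z ∷ B) ≈ boundRoots pre z * preFactor pre (A ++ B)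
  preFactor-insert []                      A B = sym (*-identityˡ 1#)
  preFactor-insert ((i , dead)      ∷ pre) A B = preFactor-insert pre A B
  preFactor-insert ((i , free)      ∷ pre) A B = preFactor-insert pre (y i ∷ A) B
  preFactor-insert ((i , bound e _) ∷ pre) A {z} B = trans
    (*-cong (*-congˡ (comonic-insert A B (y i))) (preFactor-insert pre (y i ∷ A) B))
    (solve 5 (λ u w d b f → (u :* (w :* d)) :* (b :* f) := (w :* b) :* (u :* d :* f)) refl
      (x i ^ (r ℕ.∸ e)) (z - y i) (comonic (A ++ B) (y i)) (boundRoots pre z) (preFactor pre (y i ∷ A ++ B)))

  -- `comonic L 0#` stands for the product of `L`, in a form that `comonic-split` compares with the
  -- other values of `comonic L`.
  sufFactor-split : ∀ suf → sufFactor suf ≈ comonic (active suf) 0# * boundFactor suf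
  sufFactor-split []                      = sym (*-identityˡ 1#)
  sufFactor-split ((i , dead)      ∷ suf) = sufFactor-split suf
  sufFactor-split ((i , free)      ∷ suf) = trans (*-congˡ (sufFactor-split suf))
    (solve 3 (λ z a b → z :* (a :* b) := (z :- con (ℤ.+ 0)) :* a :* b) refl (y i) (comonic (active suf) 0#) (boundFactor suf))
  sufFactor-split ((i , bound _ _) ∷ suf) = trans (*-congˡ (sufFactor-split suf))
    (solve 4 (λ z d a b → (z :* d) :* (a :* b) := ((z :- con (ℤ.+ 0)) :* a) :* (d :* b)) refl
      (y i) (comonic (active suf) (y i)) (comonic (active suf) 0#) (boundFactor suf))

  preFactor-refill : ∀ pre suf → preFactor (refill pre suf) [] ≈ boundFactor suf * preFactor pre (active suf)
  preFactor-refill pre []                      = sym (*-identityˡ _)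
  preFactor-refill pre ((i , dead)      ∷ suf) = preFactor-refill _ suf
  preFactor-refill pre ((i , free)      ∷ suf) = preFactor-refill _ suf
  preFactor-refill pre ((i , bound _ _) ∷ suf) = trans (preFactor-refill _ suf)
    (trans (*-congˡ (*-congʳ (trans (*-congʳ (reflexive (≡.cong (x i ^_) (ℕ.n∸n≡0 r)))) (*-identityˡ _))))
    (solve 3 (λ d b f → b :* (d :* f) := (d :* b) :* f) refl
      (comonic (active suf) (y i)) (boundFactor suf) (preFactor pre (y i ∷ active suf))))

  -- For z active in pre, freeRoots and preFactor together supply all (z - t).
  derivative∣ : ∀ pre A {z} → z ∈ active pre → ∃[ P ] ∃[ Q ] ∃[ q ]
                (active pre ≡ P ++ z ∷ Q) × (freeRoots pre z * preFactor pre A ≈ q * monic ((P ++ Q) ++ A) z)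
  derivative∣ ((i , dead)      ∷ pre) A m = derivative∣ pre A m
  derivative∣ ((i , free)      ∷ pre) A (here ≡.refl) = [] , active pre , 0# , ≡.refl ,
    solve 4 (λ z w f m → ((z :- z) :* w) :* f := con (ℤ.+ 0) :* m) refl
      (y i) (freeRoots pre (y i)) (preFactor pre (y i ∷ A)) (monic (active pre ++ A) (y i))
  derivative∣ ((i , free)      ∷ pre) A {z} (there m) with derivative∣ pre (y i ∷ A) m
  ... | P , Q , q , eq , e = y i ∷ P , Q , (z - y i) * q , ≡.cong (y i ∷_) eq ,
    trans (*-assoc _ _ _) (trans (*-congˡ (trans e (*-congˡ (monic-insert (P ++ Q) A z)))) (sym (*-assoc _ _ _)))
  derivative∣ ((i , bound e _) ∷ pre) A (here ≡.refl) with comonic-sign A (y i)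
  ... | s , es = [] , active pre , x i ^ (r ℕ.∸ e) * s * preFactor pre A , ≡.refl ,
    trans (*-congˡ (*-cong (*-congˡ es) (preFactor-insert pre [] A)))
      (trans (solve 6 (λ w u s m b f → w :* (u :* (s :* m) :* (b :* f)) := u :* s :* f :* ((w :* b) :* m)) refl
        (freeRoots pre (y i)) (x i ^ (r ℕ.∸ e)) s (monic A (y i)) (boundRoots pre (y i)) (preFactor pre A))
      (*-congˡ (trans (*-congʳ (roots-split pre (y i))) (sym (monic-++ (active pre) A (y i))))))
  derivative∣ ((i , bound e _) ∷ pre) A {z} (there m) with derivative∣ pre (y i ∷ A) m
  ... | P , Q , q , eq , e′ = y i ∷ P , Q , x i ^ (r ℕ.∸ e) * comonic A (y i) * q , ≡.cong (y i ∷_) eq ,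
    trans (solve 4 (λ w u d f → w :* (u :* d :* f) := u :* d :* (w :* f)) refl
      (freeRoots pre z) (x i ^ (r ℕ.∸ e)) (comonic A (y i)) (preFactor pre (y i ∷ A)))
    (trans (*-congˡ (trans e′ (*-congˡ (monic-insert (P ++ Q) A z)))) (sym (*-assoc _ _ _)))

module Contraction {c ℓ : Level} (R : CommutativeRing c ℓ) {n : ℕ} (r : ℕ) (x : Fin n → CommutativeRing.Carrier R)
         (positions : List (Fin n)) (distinct : Unique positions) where

  open CommutativeRing R hiding (zero)
  open Exp semiring using (_^_; ^-homo-*; ^-assocʳ)
  open Mult +-monoid using () renaming (_×_ to _·_)
  open SemiringMult semiring using (×-assoc-*; ×-comm-*)
  open IntegerSolver R
  open Ideals R
  open SymmetricFunctions R
  open SymmetricLists R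
  open Configurations R r x positions distinct
  open Complements R r x positions distinct

  module _ (1≤r : 1 ≤ r) (invert : InvertibleNaturals R)
           {p : Level} {𝔟 : Pred Carrier p} (I : IsIdeal 𝔟) where
    open IsIdeal I

    -- Modulo `𝔟` the product is a multiple of z^d by `derivative`, and `nilpotent` kills z^(d+1).
    root-kill : ∀ {z} A B → (∀ k → 𝔟 (elem (suc k) (A ++ z ∷ B))) → 𝔟 (z * monic (A ++ B) z)
    root-kill {z} A B el = shift
      (resp (solve 3 (λ z m u → z :* (m :- u) := z :* m :- z :* u) refl z _ _) (mul z (derivative I A B el)))
      (resp (trans (trans (solve 3 (λ u s z → u :* s := s :* u) refl d·1 (z ^ suc d) z) (×-assoc′)) (sym (×-comm-* (suc d) z (z ^ d))))
        (mul d·1 (nilpotent I A B el)))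
      where
      d = length (A ++ B)
      d·1 = suc d · 1#
      ×-assoc′ : z ^ suc d * d·1 ≈ suc d · (z ^ suc d)
      ×-assoc′ = trans (*-comm _ _) (trans (×-assoc-* (suc d) 1# (z ^ suc d)) (SemiringMult.×-congʳ semiring (suc d) (*-identityˡ _)))

    module _ {i : Fin n} {pre suf : Entries}
             (elems : ∀ k → 𝔟 (elem (suc k) (active pre ++ y i ∷ active suf)))
             (sums : ∀ k → 𝔟 (∑ (active pre ++ y i ∷ active suf) (λ t → t ^ suc k))) where

      private
        A = active pre
        B = active suf
        z = y i
        d = length (A ++ B)
        w = freeRoots pre
        f = preFactor pre (z ∷ B)
        f′ = preFactor pre B
        L = A ++ z ∷ B

        to-power : ∀ {g} → 𝔟 (g * (monic A z * comonic B z)) → 𝔟 (g * z ^ d)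
        to-power {g} h = resp
          (trans (solve 4 (λ u g s m → u :* (g :* s) := g :* (u :* s)) refl u g (suc d · (z ^ d)) 1#)
            (*-congˡ (trans (*-congˡ (trans (SemiringMult.×-congʳ semiring (suc d) (sym (*-identityˡ _))) (sym (×-assoc-* (suc d) 1# (z ^ d)))))
              (trans (sym (*-assoc _ _ _)) (trans (*-congʳ (proj₂ (invert d))) (*-identityˡ _))))))
          (mul u (resp (solve 3 (λ g m s → g :* m :- g :* (m :- s) := g :* s) refl g (monic (A ++ B) z) (suc d · (z ^ d)))
            (sub (resp (trans (*-assoc _ _ _) (*-congˡ (sym (monic-++ A B z))))
                   (flip I B z (resp (sym (*-assoc _ _ _)) h)))
              (mul g (derivative I A B elems)))))
          where u = proj₁ (invert d)

        from-power : 𝔟 (z * (monic A z * comonic B z))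
        from-power = resp (*-assoc _ _ _) (unflip I B z (resp (trans (*-congˡ (monic-++ A B z)) (sym (*-assoc _ _ _))) (root-kill A B elems)))

        split-r : x i * x i ^ (r ℕ.∸ 1) ≈ z
        split-r = reflexive (≡.cong (x i ^_) (ℕ.m+[n∸m]≡n 1≤r))

        power-eq : x i ^ (r ℕ.∸ 1) * z ^ d ≈ x i ^ (r ℕ.* suc d ℕ.∸ 1)
        power-eq = trans (*-congˡ (^-assocʳ (x i) r d)) (trans (sym (^-homo-* (x i) (r ℕ.∸ 1) (r ℕ.* d)))
          (reflexive (≡.cong (x i ^_) (≡.trans (≡.sym (ℕ.+-∸-comm (r ℕ.* d) 1≤r)) (≡.cong (ℕ._∸ 1) (≡.sym (ℕ.*-suc r d)))))))

        -- By `nilpotent`, `y i ^ suc d` lies in `𝔟`, so one more `x i` on top of the exponent r·suc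
        -- d - 1 gives 0: multiplying by this power sets `x i` to 0. The second component lets `E`
        -- remove the multiples of `x i` from a combination before the first is applied.
        Contracts : Carrier → Carrier → Set _
        Contracts E F = (∀ {g} → 𝔟 (g * E) → 𝔟 (x i ^ (r ℕ.* suc d ℕ.∸ 1) * (g * F))) × 𝔟 (x i * E)

        -- Up to sign the product of the z - t is `suc d` times z^d. Together with `x i ^ (r - 1)`
        -- this gives the exponent (r - 1) + r·d, and one further `x i` makes `root-kill`
        -- applicable.
        finish : ∀ {E F} → 𝔟 (E - x i ^ (r ℕ.∸ 1) * (F * (monic A z * comonic B z))) → Contracts E F
        finish {E} {F} h =
          (λ {g} h′ → resp (trans (solve 4 (λ g u F v → ((g :* u) :* F) :* v := (u :* v) :* (g :* F)) refl g u F (z ^ d)) (*-congʳ power-eq))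
            (to-power {g * u * F} (resp (solve 5 (λ g E u F m → g :* E :- g :* (E :- u :* (F :* m)) := (g :* u :* F) :* m) refl g E u F MC)
              (sub h′ (mul g h))))) ,
          resp (trans (+-congˡ (trans (*-congˡ (*-congʳ (sym split-r))) ≈-refl))
                 (solve 5 (λ E u F m x → x :* (E :- u :* (F :* m)) :+ F :* ((x :* u) :* m) := x :* E) refl E u F MC (x i)))
            (add (mul (x i) h) (mul F from-power))
          where
          u = x i ^ (r ℕ.∸ 1)
          MC = monic A z * comonic B z
          ≈-refl = refl

        weight-eq : ∀ {e} → suc e ≤ r → x i ^ e * x i ^ (r ℕ.∸ suc e) ≈ x i ^ (r ℕ.∸ 1)
        weight-eq {e} e<r = trans (sym (^-homo-* (x i) e (r ℕ.∸ suc e))) (reflexive (≡.cong (x i ^_) (eq e<r)))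
          where
          eq : ∀ {e r} → suc e ≤ r → e ℕ.+ (r ℕ.∸ suc e) ≡ r ℕ.∸ 1
          eq (s≤s q) = ℕ.m+[n∸m]≡n q

      -- Here the congruence is an equality: the weights `e` and r - suc e leave `x i ^ (r - 1)`,
      -- `freeRoots` and `boundRoots` make up the product over `A`, and `ownFactor` is the one over
      -- `B`.
      contract-bound′ : ∀ {e} → suc e ≤ r →
        Contracts (x i ^ e * w z * curFactor pre i bound (suc e) suf) (factor pre ((i , dead) ∷ suf))
      contract-bound′ {e} e<r = finish (resp (trans (sym (-‿inverseʳ _)) (+-congʳ (sym
        (trans (solve 6 (λ a w b k f s → a :* w :* (b :* (k :* (f :* s))) := (a :* b) :* (w :* k :* (f :* s))) refl
            (x i ^ e) (w z) (x i ^ (r ℕ.∸ suc e)) (comonic B z) f (sufFactor suf))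
          (*-cong (weight-eq e<r) (trans (*-congˡ (*-congʳ (preFactor-insert pre [] B)))
            (trans (solve 5 (λ w k b f s → w :* k :* (b :* f :* s) := f :* s :* ((w :* b) :* k)) refl
              (w z) (comonic B z) (boundRoots pre z) f′ (sufFactor suf)) (*-congˡ (*-congʳ (roots-split pre z)))))))))) zero∈)

      private
        c₀ = comonic B 0#

        ∑-zero : ∀ L {Q} → (∀ {t} → t ∈ L → Q t ≈ 0#) → ∑ L Q ≈ 0#
        ∑-zero []      h = refl
        ∑-zero (t ∷ L) h = trans (+-cong (h (here ≡.refl)) (∑-zero L (λ m → h (there m)))) (+-identityˡ _)

        -- As a polynomial in `t` the difference has no constant term, so the power sums generate
        -- the sum.
        all∈ : ∀ B′ → 𝔟 (∑ L (λ t → w t * (comonic B′ 0# - comonic B′ t)))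
        all∈ []       = resp (sym (∑-zero L (λ {t} _ → trans (*-congˡ (-‿inverseʳ 1#)) (zeroʳ _)))) zero∈
        all∈ (b ∷ B′) = resp
          (trans (+-congʳ (sym (∑-* L b _))) (trans (sym (∑-+ L _ _)) (∑-cong L λ t →
            solve 6 (λ b w k m t u → b :* (w :* (k :- m)) :+ t :* u :* (m :* w) := w :* ((b :- con (ℤ.+ 0)) :* k :- (b :- t :* u) :* m)) refl
              b (w t) (comonic B′ 0#) (comonic B′ t) t 1# ⟨≈⟩ *-congˡ (+-congˡ (-‿cong (*-congʳ (+-congˡ (-‿cong (*-identityʳ t)))))))))
          (add (mul b (all∈ B′)) (∑-comonic I L B′ (∑-freeRoots I L pre sums) 0))
          where
          _⟨≈⟩_ = trans
          infixl 4 _⟨≈⟩_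

        -- For `t` in `A` the difference is divisible by `t`, and `derivative∣` supplies all
        -- remaining factors, so `root-kill` applies to each summand separately.
        before∈ : 𝔟 (∑ A (λ t → w t * (c₀ - comonic B t)) * f)
        before∈ = ∑∈ I A λ {t} m →
          let P , Q , q , eq , e = derivative∣ pre (z ∷ B) m
              v , e′ = comonic-split B t
          in resp (trans (solve 4 (λ v q t m → (v :* q) :* (t :* m) := (t :* v) :* (q :* m)) refl v q t (monic ((P ++ Q) ++ z ∷ B) t))
               (trans (*-cong (sym e′) (sym e))
                 (solve 3 (λ k w f → k :* (w :* f) := (w :* k) :* f) refl (c₀ - comonic B t) (w t) f)))
             (mul (v * q) (resp (*-congˡ (reflexive (≡.cong (λ M → monic M t) (≡.sym (++-assoc P Q (z ∷ B))))))
               (root-kill P (Q ++ z ∷ B) (λ k → ≡.subst (λ M → 𝔟 (elem (suc k) M))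
                 (≡.trans (≡.cong (_++ z ∷ B) eq) (++-assoc P (t ∷ Q) (z ∷ B))) (elems k)))))

        -- ∑ w(t) ∏ u ≡ w(z) ∏ (u - z) where t runs over z ∷ B and u over B
        exchange : 𝔟 (f * (∑ (z ∷ B) w * c₀ - w z * comonic B z))
        exchange = resp
          (trans (+-congʳ (*-congˡ (∑-++ A (z ∷ B) _)))
          (trans (solve 3 (λ f a t → f :* (a :+ t) :- a :* f := f :* t) refl f _ _)
          (*-congˡ (trans (+-congˡ (trans (∑-cong B (λ t → solve 3 (λ w k m → w :* (k :- m) := k :* w :+ :- (w :* m)) refl (w t) c₀ (comonic B t)))
              (trans (∑-+ B _ _) (trans (+-cong (∑-* B c₀ w) (∑-zero B λ {t} m → trans (-‿cong (trans (*-congˡ (comonic-root m)) (zeroʳ _)))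
                 (solve 0 (:- con (ℤ.+ 0) := con (ℤ.+ 0)) refl))) (+-identityʳ _)))))
            (solve 4 (λ w k m s → w :* (k :- m) :+ k :* s := (w :+ s) :* k :- w :* m) refl (w z) c₀ (comonic B z) (∑ B w))))))
          (sub (mul f (all∈ B)) before∈)

      -- The product `c₀` of the later `y` comes from `sufFactor`. With it, `exchange` trades the
      -- sum for its single term at `z`, and the factors combine as in the bound case.
      contract-free′ : ∀ {e} → suc e ≤ r →
        Contracts (x i ^ e * ∑ (z ∷ B) w * curFactor pre i free (suc e) suf) (factor (refill ((i , dead) ∷ pre) suf) [])
      contract-free′ {e} e<r = finish (resp (sym (trans
        (+-cong
          (trans (solve 6 (λ a S b u f s → a :* S :* (b :* (u :* (f :* s))) := (a :* b) :* ((u :* s) :* (f :* S))) refl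
              (x i ^ e) (∑ (z ∷ B) w) (x i ^ (r ℕ.∸ suc e)) 1# f (sufFactor suf))
            (*-cong (weight-eq e<r) (*-congʳ (trans (*-identityˡ _) (sufFactor-split suf)))))
          (-‿cong (*-congˡ (*-congʳ (trans (*-identityʳ _) (preFactor-refill ((i , dead) ∷ pre) suf))))))
        (trans (+-congˡ (-‿cong (trans (*-congˡ (*-congˡ (*-congʳ (sym (roots-split pre z)))))
          (solve 6 (λ u b f w q k → u :* (b :* f :* (w :* q :* k)) := u :* b :* ((q :* f) :* (w :* k))) refl
            (x i ^ (r ℕ.∸ 1)) (boundFactor suf) f′ (w z) (boundRoots pre z) (comonic B z) ⟨≈⟩
            *-congˡ (*-congʳ (sym (preFactor-insert pre [] B)))))))
        (solve 6 (λ u k b f S v → u :* (k :* b :* (f :* S)) :- u :* b :* (f :* v) := u :* b :* (f :* (S :* k :- v))) refl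
          (x i ^ (r ℕ.∸ 1)) c₀ (boundFactor suf) f (∑ (z ∷ B) w) (w z * comonic B z)))))
        (mul (x i ^ (r ℕ.∸ 1) * boundFactor suf) exchange))
        where
        _⟨≈⟩_ = trans
        infixl 4 _⟨≈⟩_

module Independence {c ℓ : Level} (R : CommutativeRing c ℓ) {n : ℕ} (r : ℕ) (x : Fin n → CommutativeRing.Carrier R)
         (positions : List (Fin n)) (distinct : Unique positions)
         {s z : Level} {K : Set s} (scalar : K → CommutativeRing.Carrier R) (Zero : K → Set z) where

  open CommutativeRing R hiding (zero)
  open Exp semiring using (_^_; ^-homo-*; ^-assocʳ)
  open IntegerSolver R
  open Ideals R
  open Monomials R
  open SymmetricFunctions R
  open SymmetricLists R
  open Configurations R r x positions distinct
  open Complements R r x positions distinct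
  open Contraction R r x positions distinct

  combination : (Exponents → K) → List Exponents → Carrier
  combination k []       = 0#
  combination k (a ∷ as) = scalar (k a) * monomial x a + combination k as

  powers : ℕ → List Carrier → Carrier
  powers k []      = 1#
  powers k (t ∷ L) = t ^ k * powers k L

  private
    powers-insert : ∀ k A {t} B → powers k (A ++ t ∷ B) ≈ t ^ k * powers k (A ++ B)
    powers-insert k []      B = refl
    powers-insert k (a ∷ A) {t} B = trans (*-congˡ (powers-insert k A B))
      (solve 3 (λ a t m → a :* (t :* m) := t :* (a :* m)) refl (a ^ k) (t ^ k) (powers k (A ++ B)))

    powers-suc : ∀ k L → comonic L 0# * powers k L ≈ powers (suc k) L
    powers-suc k []      = *-identityˡ 1#
    powers-suc k (t ∷ L) = trans (solve 4 (λ t m u p → ((t :- con (ℤ.+ 0)) :* m) :* (u :* p) := (t :* u) :* (m :* p)) refl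
      t (comonic L 0#) (t ^ k) (powers k L)) (*-congˡ (powers-suc k L))

  degree : ℕ
  degree = length positions

  top : List (Fin n) → Carrier
  top []      = 1#
  top (i ∷ l) = x i ^ (r ℕ.* degree ℕ.∸ 1) * top l

  private
    top-ʳ++ : ∀ D E → top (D ʳ++ E) ≈ top D * top E
    top-ʳ++ []      E = sym (*-identityˡ _)
    top-ʳ++ (i ∷ D) E = trans (top-ʳ++ D (i ∷ E))
      (solve 3 (λ d u e → d :* (u :* e) := (u :* d) :* e) refl (top D) (x i ^ (r ℕ.* degree ℕ.∸ 1)) (top E))

    top-insert : ∀ D i E → top (D ʳ++ (i ∷ E)) ≈ x i ^ (r ℕ.* degree ℕ.∸ 1) * top (D ʳ++ E)
    top-insert D i E = trans (top-ʳ++ D (i ∷ E)) (trans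
      (solve 3 (λ d u e → d :* (u :* e) := u :* (d :* e)) refl (top D) (x i ^ (r ℕ.* degree ℕ.∸ 1)) (top E)) (*-congˡ (sym (top-ʳ++ D E))))

  deads : Entries → List (Fin n)
  deads []                      = []
  deads ((i , free)      ∷ l) = deads l
  deads ((i , dead)      ∷ l) = i ∷ deads l
  deads ((i , bound _ _) ∷ l) = deads l

  private
    deads-refill : ∀ pre suf → deads (refill pre suf) ʳ++ [] ≡ deads pre ʳ++ deads suf
    deads-refill pre []                      = ≡.refl
    deads-refill pre ((i , free)      ∷ suf) = deads-refill _ suf
    deads-refill pre ((i , dead)      ∷ suf) = deads-refill _ suf
    deads-refill pre ((i , bound _ _) ∷ suf) = deads-refill _ suf

    active-refill : ∀ pre suf → active (refill pre suf) ʳ++ [] ≡ active pre ʳ++ active suf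
    active-refill pre []                      = ≡.refl
    active-refill pre ((i , free)      ∷ suf) = active-refill _ suf
    active-refill pre ((i , dead)      ∷ suf) = active-refill _ suf
    active-refill pre ((i , bound _ _) ∷ suf) = active-refill _ suf

  -- In other words, independence of the monomials from `B` modulo the ideal 𝔟 : F.
  Independent : ∀ {p} → (Exponents → Set) → Pred Carrier p → Carrier → Set _
  Independent B 𝔟 F = ∀ k as → Unique as → (∀ {a} → a ∈ as → B a) → 𝔟 (combination k as * F) → ∀ {a} → a ∈ as → Zero (k a)

  module _ (1≤r : 1 ≤ r) (invert : InvertibleNaturals R)
           (scalar-zero : ∀ {a} → Zero a → scalar a ≈ 0#)
           {p q : Level} {𝔧 : Pred Carrier q} (J : IsIdeal 𝔧)
           (power∈𝔧 : ∀ i → 𝔧 (x i ^ (r ℕ.* degree)))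
           (top∉𝔧 : ∀ a → 𝔧 (scalar a * top positions) → Zero a)
    where
    private module J = IsIdeal J

    -- 𝔟 is a colon ideal of the coinvariant ideal of the active variables; a
    -- nonzero scalar stays out of it because its product with the Vandermonde
    -- product and suitable powers is a nonzero multiple of top positions mod 𝔧.
    record Coinvariant (𝔟 : Pred Carrier p) (L : List Carrier) (M : Carrier) : Set (c ⊔ p ⊔ q) where
      field
        elems    : ∀ k → 𝔟 (elem (suc k) L)
        sums     : ∀ k → 𝔟 (∑ L (λ t → t ^ suc k))
        padding  : ℕ
        padded   : length L ℕ.+ padding ≡ degree
        faithful : ∀ {h} → 𝔟 h → 𝔧 (h * (vandermonde L * (powers padding L * M)))

    private
      -- By `comonic-split` the products of the s - t and of the `s` differ by a multiple of `t`,
      -- and `t * Y` lies in `𝔧`.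
      cancel : ∀ A B {t Y g} → 𝔧 (t * Y) → 𝔧 (g * (comonic A t * monic B t) * Y) → 𝔧 (g * (comonic A 0# * comonic B 0#) * Y)
      cancel A B {t} {Y} {g} h h′ = J.resp (*-congʳ (*-assoc _ _ _))
        (step B {g * comonic A 0#} (J.resp (solve 4 (λ g a b Y → g :* b :* a :* Y := g :* a :* b :* Y) refl g (comonic A 0#) (comonic B t) Y)
          (step A {g * comonic B t} (J.resp (solve 4 (λ g a b Y → g :* a :* Y :* b := g :* b :* a :* Y) refl g (comonic A t) (comonic B t) Y)
            (unflip J B t (J.resp (solve 4 (λ g a b Y → g :* (a :* b) :* Y := g :* a :* Y :* b) refl g (comonic A t) (monic B t) Y) h′))))))
        where
        step : ∀ L {g} → 𝔧 (g * comonic L t * Y) → 𝔧 (g * comonic L 0# * Y)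
        step L {g} h″ = let v , e = comonic-split L t in J.resp
          (trans (+-congˡ (trans (solve 4 (λ g v t Y → (g :* v) :* (t :* Y) := g :* (t :* v) :* Y) refl g v t Y) (*-congʳ (*-congˡ (sym e)))))
            (solve 4 (λ g a b Y → g :* b :* Y :+ g :* (a :- b) :* Y := g :* a :* Y) refl g (comonic L 0#) (comonic L t) Y))
          (J.add h″ (J.mul (g * v) h))

      -- `vandermonde-remove` splits off the factors s - t with t = y i. The power defining the
      -- colon ideal and t ^ pad together give `x i` its final exponent r·degree - 1. A further `t`
      -- would land in `𝔧`, so each s - t may be replaced by `s`, and this raises the padding by
      -- one.
      contract-coinvariant : ∀ {𝔟} → IsIdeal 𝔟 → ∀ i A B {M M′} → M′ ≈ x i ^ (r ℕ.* degree ℕ.∸ 1) * M →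
        Coinvariant 𝔟 (A ʳ++ (y i ∷ B)) M → Coinvariant (λ h → 𝔟 (x i ^ (r ℕ.* suc (length (A ++ B)) ℕ.∸ 1) * h)) (A ʳ++ B) M′
      contract-coinvariant {𝔟} I i A₀ B {M} {M′} eM C = ≡.subst₂
        (λ d L → Coinvariant (λ h → 𝔟 (x i ^ (r ℕ.* suc d ℕ.∸ 1) * h)) L M′) length-eq (≡.sym (ʳ++-defn A₀)) result
        where
        open IsIdeal I
        module C = Coinvariant C
        A = reverse A₀
        t = y i
        d = length (A ++ B)
        length-eq : d ≡ length (A₀ ++ B)
        length-eq = ≡.trans (length-++ A) (≡.trans (≡.cong (ℕ._+ length B) (length-reverse A₀)) (≡.sym (length-++ A₀)))
        L-eq : A₀ ʳ++ (t ∷ B) ≡ A ++ t ∷ B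
        L-eq = ʳ++-defn A₀
        elems : ∀ k → 𝔟 (elem (suc k) (A ++ t ∷ B))
        elems k = ≡.subst (λ L → 𝔟 (elem (suc k) L)) L-eq (C.elems k)
        sums : ∀ k → 𝔟 (∑ (A ++ t ∷ B) (λ t → t ^ suc k))
        sums k = ≡.subst (λ L → 𝔟 (∑ L _)) L-eq (C.sums k)
        X = x i ^ (r ℕ.* suc d ℕ.∸ 1)
        1≤rd : ∀ d → 1 ≤ r ℕ.* suc d
        1≤rd d = ℕ.*-mono-≤ 1≤r (s≤s z≤n)
        Xt∈ : 𝔟 (X * t)
        Xt∈ = resp (trans (*-congˡ (^-assocʳ (x i) r (suc d)))
            (trans (sym (^-homo-* (x i) (r ℕ.∸ 1) (r ℕ.* suc d)))
              (trans (reflexive (≡.cong (x i ^_) (eq 1≤r (1≤rd d)))) (^-homo-* (x i) (r ℕ.* suc d ℕ.∸ 1) r))))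
          (mul (x i ^ (r ℕ.∸ 1)) (nilpotent I A B elems))
          where
          eq : ∀ {a b} → 1 ≤ a → 1 ≤ b → a ℕ.∸ 1 ℕ.+ b ≡ b ℕ.∸ 1 ℕ.+ a
          eq {suc a} {suc b} _ _ = ≡.trans (ℕ.+-suc a b) (≡.trans (≡.cong suc (ℕ.+-comm a b)) (≡.sym (ℕ.+-suc b a)))
        pad = C.padding
        total : suc d ℕ.+ pad ≡ degree
        total = ≡.trans (≡.cong (ℕ._+ pad) (≡.trans (≡.sym (≡.trans (≡.cong length L-eq) (≡.trans (length-++ A) (≡.trans (ℕ.+-suc _ _) (≡.cong suc (≡.sym (length-++ A))))))) ≡.refl)) C.padded
        Xi = x i ^ (r ℕ.* degree ℕ.∸ 1)
        X-power : X * t ^ pad ≈ Xi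
        X-power = trans (*-congˡ (^-assocʳ (x i) r pad)) (trans (sym (^-homo-* (x i) (r ℕ.* suc d ℕ.∸ 1) (r ℕ.* pad)))
          (reflexive (≡.cong (x i ^_) (≡.trans (≡.sym (ℕ.+-∸-comm (r ℕ.* pad) (1≤rd d)))
            (≡.cong (ℕ._∸ 1) (≡.trans (≡.sym (ℕ.*-distribˡ-+ r (suc d) pad)) (≡.cong (r ℕ.*_) total)))))))
        tXi∈ : 𝔧 (t * Xi)
        tXi∈ = J.resp (trans (sym (^-homo-* (x i) (r ℕ.∸ 1) (r ℕ.* degree)))
            (trans (reflexive (≡.cong (x i ^_) (eq 1≤r (≡.subst (λ m → 1 ≤ r ℕ.* m) total (1≤rd (d ℕ.+ pad)))))) (^-homo-* (x i) r _)))
          (J.mul (x i ^ (r ℕ.∸ 1)) (power∈𝔧 i))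
          where
          eq : ∀ {a b} → 1 ≤ a → 1 ≤ b → a ℕ.∸ 1 ℕ.+ b ≡ a ℕ.+ (b ℕ.∸ 1)
          eq {suc a} {suc b} _ _ = ℕ.+-suc a b
        result : Coinvariant (λ h → 𝔟 (X * h)) (A ++ B) M′
        result = record
          { elems = λ k → resp (solve 4 (λ X e t q → X :* (e :- t :* q) :+ q :* (X :* t) := X :* e) refl X (elem (suc k) (A ++ B)) t (elem k (A ++ B)))
              (add (mul X (resp (elem-remove k A B) (elems k))) (mul (elem k (A ++ B)) Xt∈))
          ; sums = λ k → resp (solve 4 (λ X u t S → X :* (t :* u :+ S) :- u :* (X :* t) := X :* S) refl X (t ^ k) t (∑ (A ++ B) (λ t → t ^ suc k)))
              (sub (mul X (resp (∑-insert A B _) (sums k))) (mul (t ^ k) Xt∈))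
          ; padding = suc pad
          ; padded = ≡.trans (ℕ.+-suc _ pad) total
          ; faithful = λ {h} h∈ → J.resp
              (trans (solve 5 (λ g c Y Xi M → g :* c :* (Xi :* (Y :* M)) := g :* ((c :* Y) :* (Xi :* M))) refl
                  (h * vandermonde (A ++ B)) (comonic A 0# * comonic B 0#) (powers pad (A ++ B)) Xi M)
                (trans (*-assoc _ _ _) (*-congˡ (*-congˡ (*-cong (trans (*-congʳ (sym (comonic-++ A B 0#))) (powers-suc pad (A ++ B))) (sym eM))))))
              (cancel A B {t} {Xi * (powers pad (A ++ B) * M)} {h * vandermonde (A ++ B)}
                (J.resp (*-assoc _ _ _) (J.mulʳ (powers pad (A ++ B) * M) tXi∈))
                (J.resp (trans (*-congˡ (*-cong (trans (reflexive (≡.cong vandermonde L-eq)) (vandermonde-remove A B))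
                      (*-congʳ (trans (reflexive (≡.cong (powers pad) L-eq)) (powers-insert pad A B)))))
                    (trans (solve 7 (λ X h k v T P M → (X :* h) :* ((k :* v) :* ((T :* P) :* M)) := (h :* v) :* k :* ((X :* T) :* (P :* M))) refl
                      X h (comonic A t * monic B t) (vandermonde (A ++ B)) (t ^ pad) (powers pad (A ++ B)) M)
                    (*-congˡ (*-congʳ X-power))))
                  (C.faithful h∈))) }

    private
      FullCoinvariant : Pred Carrier p → Entries → Entries → Set _
      FullCoinvariant 𝔟 pre suf = Coinvariant 𝔟 (active pre ʳ++ active suf) (top (deads pre ʳ++ deads suf))

      CurCoinvariant : Pred Carrier p → Entries → Fin n → Entries → Set _
      CurCoinvariant 𝔟 pre i suf = Coinvariant 𝔟 (active pre ʳ++ (y i ∷ active suf)) (top (deads pre ʳ++ deads suf))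

      leave-coinvariant : ∀ {𝔟 pre i suf} κ → CurCoinvariant 𝔟 pre i suf → FullCoinvariant 𝔟 pre ((i , mark κ) ∷ suf)
      leave-coinvariant free  C = C
      leave-coinvariant bound C = C

    private
      combination-zero : ∀ k as → (∀ {a} → a ∈ as → Zero (k a)) → combination k as ≈ 0#
      combination-zero k []       h = refl
      combination-zero k (a ∷ as) h = trans (+-cong (trans (*-congʳ (scalar-zero (h (here ≡.refl)))) (zeroˡ _))
        (combination-zero k as (λ m → h (there m)))) (+-identityˡ _)

      isZero? : ∀ m → Dec (m ≡ 0)
      isZero? zero    = yes ≡.refl
      isZero? (suc m) = no λ ()

      module _ (i : Fin n) where

        vanishing nonvanishing : List Exponents → List Exponents
        vanishing    = filter (λ a → isZero? (lookup a i))
        nonvanishing = filter (λ a → ¬? (isZero? (lookup a i)))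

        increment-decrement : ∀ {a} → lookup a i ≢ 0 → increment i (decrement i a) ≡ a
        increment-decrement {a} a≢0 = ≡.trans (updateAt-updateAt-local i {f = suc} {g = ℕ.pred} {h = λ m → m} a (eq a≢0))
          (updateAt-id-local i a ≡.refl)
          where
          eq : ∀ {m} → m ≢ 0 → suc (ℕ.pred m) ≡ m
          eq {zero}  h = contradiction ≡.refl h
          eq {suc m} h = ≡.refl

        decremented : List Exponents → List Exponents
        decremented as = map (decrement i) (nonvanishing as)

        unique-map : ∀ as → (∀ {a} → a ∈ as → lookup a i ≢ 0) → Unique as → Unique (map (decrement i) as)
        unique-map []       h u       = []
        unique-map (a ∷ as) h (v ∷ u) = All.tabulate (λ m e → let b , b∈ , eq = ∈-map⁻ (decrement i) m in
            All.lookup v b∈ (≡.trans (≡.sym (increment-decrement (h (here ≡.refl))))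
              (≡.trans (≡.cong (increment i) (≡.trans e eq)) (increment-decrement (h (there b∈))))))
          ∷ unique-map as (λ m → h (there m)) u

        combination-split : ∀ k as → combination k as ≈
          combination k (vanishing as) + x i * combination (λ a → k (increment i a)) (decremented as)
        combination-split k [] = sym (trans (+-identityˡ _) (zeroʳ _))
        combination-split k (a ∷ as) with isZero? (lookup a i)
        ... | yes _  = trans (+-congˡ (combination-split k as)) (sym (+-assoc _ _ _))
        ... | no a≢0 = trans (+-cong (*-cong (reflexive (≡.cong (λ b → scalar (k b)) (≡.sym (increment-decrement {a} a≢0))))
              (trans (reflexive (≡.cong (monomial x) (≡.sym (increment-decrement {a} a≢0)))) (monomial-suc x i (decrement i a)))) (combination-split k as))
          (solve 5 (λ s m z g g′ → s :* (z :* m) :+ (g :+ z :* g′) := g :+ z :* (s :* m :+ g′)) refl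
            (scalar (k (increment i (decrement i a)))) (monomial x (decrement i a)) (x i)
            (combination k (vanishing as)) (combination (λ a → k (increment i a)) (decremented as)))

      -- The part of a vanishing combination without x i dies after contraction,
      -- the rest after deletion.
      combine : ∀ {𝔟 : Pred Carrier p} {B B₀ B₁ E F F₀ F₁} {X : Carrier} i → IsIdeal 𝔟 →
        (∀ {a} → lookup a i ≡ 0 → B a → B₀ a) → (∀ {a} → lookup a i ≢ 0 → B a → B₁ (decrement i a)) →
        (∀ {g} → 𝔟 (g * (E * F)) → 𝔟 (X * (g * F₀))) → 𝔟 (x i * (E * F)) → F₁ ≈ x i * F →
        Independent B₀ (λ h → 𝔟 (X * h)) F₀ → Independent B₁ 𝔟 F₁ → Independent B 𝔟 F
      combine {𝔟} {B₁ = B₁} {E = E} {F} {F₀} {F₁} i I f₀ f₁ contracts killed eq ind₀ ind₁ k as u b h = result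
        where
        open IsIdeal I
        g₀ = combination k (vanishing i as)
        k′ = λ a → k (increment i a)
        g₁ = combination k′ (decremented i as)
        split∈ : 𝔟 ((g₀ + x i * g₁) * F)
        split∈ = resp (*-congʳ (combination-split i k as)) h
        vanishing∈ : ∀ {a} → a ∈ vanishing i as → Zero (k a)
        vanishing∈ = ind₀ k (vanishing i as) (Unique.filter⁺ _ u)
          (λ m → let m′ , z = ∈-filter⁻ (λ a → isZero? (lookup a i)) {xs = as} m in f₀ z (b m′))
          (contracts {g₀} (resp (solve 5 (λ g z g′ E F → E :* ((g :+ z :* g′) :* F) :- g′ :* (z :* (E :* F)) := g :* (E :* F)) refl g₀ (x i) g₁ E F)
            (sub (mul E split∈) (mul g₁ killed))))
        decremented∈ : ∀ {a} → a ∈ decremented i as → Zero (k′ a)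
        decremented∈ = ind₁ k′ (decremented i as)
          (unique-map i (nonvanishing i as) (λ m → proj₂ (∈-filter⁻ (λ a → ¬? (isZero? (lookup a i))) {xs = as} m)) (Unique.filter⁺ _ u))
          (λ m → let a , a∈ , e = ∈-map⁻ (decrement i) m
                     a∈′ , nz = ∈-filter⁻ (λ a → ¬? (isZero? (lookup a i))) {xs = as} a∈
                 in ≡.subst B₁ (≡.sym e) (f₁ nz (b a∈′)))
          (resp (trans (*-congʳ (+-congʳ (combination-zero k (vanishing i as) vanishing∈)))
              (trans (solve 3 (λ z g F → (con (ℤ.+ 0) :+ z :* g) :* F := g :* (z :* F)) refl (x i) g₁ F) (*-congˡ (sym eq)))) split∈)
        result : ∀ {a} → a ∈ as → Zero (k a)
        result {a} m with isZero? (lookup a i)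
        ... | yes z = vanishing∈ (∈-filter⁺ (λ a → isZero? (lookup a i)) m z)
        ... | no nz = ≡.subst (λ b → Zero (k b)) (increment-decrement i nz)
          (decremented∈ (∈-map⁺ (decrement i) (∈-filter⁺ (λ a → ¬? (isZero? (lookup a i))) m nz)))

      -- The first active position has the limit r·0. A nonempty box therefore forces all positions
      -- to be dead and leaves the exponent vector 0 alone.
      dead-or-empty : ∀ suf → (∀ {a} → ¬ SufBox 0 suf a) ⊎
        (sufFactor suf ≡ 1# × active suf ≡ [] × deads suf ≡ places suf × (∀ {a} → SufBox 0 suf a → ∀ {i} → i ∈ places suf → lookup a i ≡ 0))
      dead-or-empty []                      = inj₂ (≡.refl , ≡.refl , ≡.refl , λ _ ())
      dead-or-empty ((i , free)      ∷ suf) = inj₁ λ { {a} (b , _) → ℕ.n≮0 (≡.subst (lookup a i <_) (ℕ.*-zeroʳ r) b) }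
      dead-or-empty ((i , bound _ _) ∷ suf) = inj₁ λ { {a} (b , _) → ℕ.n≮0 (≡.subst (lookup a i <_) (ℕ.*-zeroʳ r) b) }
      dead-or-empty ((i , dead)      ∷ suf) with dead-or-empty suf
      ... | inj₁ h = inj₁ λ { (_ , b) → h b }
      ... | inj₂ (e , e′ , e″ , h) = inj₂ (e , e′ , ≡.cong (i ∷_) e″ ,
              λ { (b , _)  (here ≡.refl) → ℕ.n<1⇒n≡0 b ; (_ , b) (there m) → h b m })

      module _ (complete : ∀ i → i ∈ positions) where

        base : ∀ {𝔟} suf → IsIdeal 𝔟 → places suf ≡ positions → FullCoinvariant 𝔟 [] suf → Independent (Box [] suf) 𝔟 (factor [] suf)
        base suf I l C k []           u b h ()
        base suf I l C k (a ∷ a′ ∷ as) ((v ∷ _) ∷ u) b h m with dead-or-empty suf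
        ... | inj₁ e = ⊥-elim (e (proj₂ (b (here ≡.refl))))
        ... | inj₂ (_ , _ , _ , f) = ⊥-elim (v (≡.trans (≡.sym (tabulate∘lookup a)) (≡.trans (tabulate-cong λ i →
                ≡.trans (f (proj₂ (b (here ≡.refl))) (here′ i)) (≡.sym (f (proj₂ (b (there (here ≡.refl)))) (here′ i)))) (tabulate∘lookup a′))))
          where
          here′ : ∀ i → i ∈ places suf
          here′ i = ≡.subst (i ∈_) (≡.sym l) (complete i)
        base {𝔟} suf I l C k (a ∷ []) u b h (here ≡.refl) with dead-or-empty suf
        ... | inj₁ e = ⊥-elim (e (proj₂ (b (here ≡.refl))))
        ... | inj₂ (e , e′ , e″ , f) = top∉𝔧 (k a) (J.resp
          (trans (*-congˡ (trans (*-cong (reflexive (≡.cong vandermonde e′)) (*-cong (reflexive (≡.cong (powers (Coinvariant.padding C)) e′)) (reflexive (≡.cong top (≡.trans e″ l)))))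
            (trans (*-identityˡ _) (*-identityˡ _))))
            (*-congʳ (trans (*-cong (trans (+-identityʳ _) (*-congˡ (trans (reflexive (≡.cong (monomial x) a≡0)) (monomial-0 x)))) (trans (*-identityˡ _) (reflexive e)))
              (trans (*-identityʳ _) (*-identityʳ _)))))
          (Coinvariant.faithful C h))
          where
          a≡0 : a ≡ replicate n 0
          a≡0 = ≡.trans (≡.sym (tabulate∘lookup a)) (≡.trans (tabulate-cong λ i →
            ≡.trans (f (proj₂ (b (here ≡.refl))) (≡.subst (i ∈_) (≡.sym l) (complete i))) (≡.sym (lookup-replicate i 0))) (tabulate∘lookup _))

        symmetric-elems : ∀ {𝔟 M} A B → Coinvariant 𝔟 (A ʳ++ B) M → IsIdeal 𝔟 → ∀ k → 𝔟 (elem (suc k) (A ++ B))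
        symmetric-elems A B C I k = IsIdeal.resp I (elem-↭ (ʳ++-↭ A B) (suc k)) (Coinvariant.elems C k)

        symmetric-sums : ∀ {𝔟 M} A B → Coinvariant 𝔟 (A ʳ++ B) M → IsIdeal 𝔟 → ∀ k → 𝔟 (∑ (A ++ B) (λ t → t ^ suc k))
        symmetric-sums A B C I k = IsIdeal.resp I (∑-↭ (ʳ++-↭ A B) _) (Coinvariant.sums C k)

        change : ∀ {𝔟 : Pred Carrier p} {B B′ F F′} → IsIdeal 𝔟 → (∀ {a} → B a → B′ a) → F ≈ F′ → Independent B′ 𝔟 F′ → Independent B 𝔟 F
        change I f e ind k as u b h = ind k as u (λ m → f (b m)) (IsIdeal.resp I (*-congˡ e) h)

        weight-suc : ∀ {i e} → suc e ≤ r → x i ^ (r ℕ.∸ e) ≈ x i * x i ^ (r ℕ.∸ suc e)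
        weight-suc {i} {e} e<r = reflexive (≡.cong (x i ^_) (ℕ.+-∸-assoc 1 e<r))

        curFactor-suc : ∀ {i e} pre κ suf → suc e ≤ r → curFactor pre i κ e suf ≈ x i * curFactor pre i κ (suc e) suf
        curFactor-suc pre κ suf e<r = trans (*-congʳ (weight-suc e<r)) (*-assoc _ _ _)

        curFactor-0 : ∀ {i} pre κ suf → curFactor pre i κ 0 suf ≈ factor pre ((i , mark κ) ∷ suf)
        curFactor-0 {i} pre free suf = trans (*-congˡ (*-identityˡ _))
          (solve 3 (λ u f s → u :* (f :* s) := f :* (u :* s)) refl (y i) (preFactor pre (y i ∷ active suf)) (sufFactor suf))
        curFactor-0 {i} pre bound suf =
          solve 4 (λ u k f s → u :* (k :* (f :* s)) := f :* (u :* k :* s)) refl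
            (y i) (comonic (active suf) (y i)) (preFactor pre (y i ∷ active suf)) (sufFactor suf)

        independentCur : ∀ {pre i κ e suf} → Cur pre i κ e suf → ∀ {𝔟} → IsIdeal 𝔟 → CurCoinvariant 𝔟 pre i suf →
                         Independent (CurBox pre i κ e suf) 𝔟 (curFactor pre i κ e suf)
        independentFull : ∀ {pre suf} → Full pre suf → ∀ {𝔟} → IsIdeal 𝔟 → FullCoinvariant 𝔟 pre suf →
                          Independent (Box pre suf) 𝔟 (factor pre suf)

        independentFull (end {suf} l) I C = base suf I l C
        independentFull (free {pre} {i} {suf} t) I C = change I (λ ((b , b′) , b″) → b′ , b , b″)
          (sym (trans (*-cong (reflexive (≡.cong (x i ^_) (ℕ.n∸n≡0 r))) (*-identityˡ _)) (*-identityˡ _)))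
          (independentCur t I C)
        independentFull (bound {pre} {i} {e} {e≤r} {suf} t) I C = change I (λ ((b , b′) , b″) → b′ , b , b″)
          (trans (*-assoc _ _ _) (*-assoc _ _ _)) (independentCur t I C)
        independentFull (dead t) I C = change I (λ ((b , b′) , b″) → b′ , b , b″) refl (independentFull t I C)

        independentCur (done {pre} {i} {κ} {suf} t) I C = change I (curBox-done⁻ κ) (curFactor-0 pre κ suf)
          (independentFull t I (leave-coinvariant {pre = pre} {i} {suf} κ C))
        independentCur (free {pre} {i} {e} {suf} e<r f f′ t t′) {𝔟} I C =
          combine i I contractFree⁻ (curBox-decrement {κ = free} f f′) (λ {g} → proj₁ contracts {g}) (proj₂ contracts) (curFactor-suc pre free suf e<r)
            (independentFull t′ (colon I _) (≡.subst₂ (Coinvariant _) (≡.sym (active-refill ((i , dead) ∷ pre) suf)) (≡.cong top (≡.sym (deads-refill ((i , dead) ∷ pre) suf)))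
              (contract-coinvariant I i (active pre) (active suf) (top-insert (deads pre) i (deads suf)) C)))
            (independentCur t I C)
          where contracts = contract-free′ 1≤r invert I {i} {pre} {suf} (symmetric-elems (active pre) _ C I) (symmetric-sums (active pre) _ C I) e<r
        independentCur (bound {pre} {i} {e} {suf} e<r f f′ t t′) {𝔟} I C =
          combine i I contractBound⁻ (curBox-decrement {κ = bound} f f′) (λ {g} → proj₁ contracts {g}) (proj₂ contracts) (curFactor-suc pre bound suf e<r)
            (independentFull t′ (colon I _) (contract-coinvariant I i (active pre) (active suf) (top-insert (deads pre) i (deads suf)) C))
            (independentCur t I C)
          where contracts = contract-bound′ 1≤r invert I {i} {pre} {suf} (symmetric-elems (active pre) _ C I) (symmetric-sums (active pre) _ C I) e<r

    independent : (∀ i → i ∈ positions) → ∀ {pre suf} → Full pre suf → ∀ {𝔟} → IsIdeal 𝔟 →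
                  Coinvariant 𝔟 (active pre ʳ++ active suf) (top (deads pre ʳ++ deads suf)) →
                  Independent (Box pre suf) 𝔟 (factor pre suf)
    independent complete t = independentFull complete t

-- The spanning set

module Polynomials {c ℓ : Level} (K : CommutativeRing c ℓ) (n : ℕ) where

  private
    module K = CommutativeRing K
    module Ω = Superspace K n
  open Ring Ω.ring hiding (zero)
  open RingProperties Ω.ring using (-‿distribˡ-*; -‿distribʳ-*)
  open import Relation.Binary.Reasoning.Setoid setoid

  infixl 6 _⊕_
  infixl 7 _⊛_
  infix  8 ⊝_

  -- The elements of Ω that do not involve θ.
  data Poly : Set c where
    con : K.Carrier → Poly
    x   : Fin n → Poly
    _⊕_ _⊛_ : Poly → Poly → Poly
    ⊝_  : Poly → Poly

  ⟦_⟧ : Poly → Carrier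
  ⟦ con a ⟧ = Ω.con a
  ⟦ x i ⟧   = Ω.x i
  ⟦ p ⊕ q ⟧ = ⟦ p ⟧ + ⟦ q ⟧
  ⟦ p ⊛ q ⟧ = ⟦ p ⟧ * ⟦ q ⟧
  ⟦ ⊝ p ⟧   = - ⟦ p ⟧

  private
    x-central : ∀ i f → Ω.x i * f ≈ f * Ω.x i
    x-central i (Ω.con a) = sym (Ω.con-central a _)
    x-central i (Ω.x j)   = Ω.xx-comm i j
    x-central i (Ω.θ j)   = Ω.xθ-comm i j
    x-central i (f Ω.+ g) = trans (distribˡ _ _ _) (trans (+-cong (x-central i f) (x-central i g)) (sym (distribʳ _ _ _)))
    x-central i (f Ω.* g) = begin
      Ω.x i * (f * g) ≈⟨ *-assoc _ _ _ ⟨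
      Ω.x i * f * g   ≈⟨ *-congʳ (x-central i f) ⟩
      f * Ω.x i * g   ≈⟨ *-assoc _ _ _ ⟩
      f * (Ω.x i * g) ≈⟨ *-congˡ (x-central i g) ⟩
      f * (g * Ω.x i) ≈⟨ *-assoc _ _ _ ⟨
      f * g * Ω.x i   ∎
    x-central i (Ω.- f)   = trans (sym (-‿distribʳ-* _ _)) (trans (-‿cong (x-central i f)) (-‿distribˡ-* _ _))

  central : ∀ p f → ⟦ p ⟧ * f ≈ f * ⟦ p ⟧
  central (con a) f = Ω.con-central a f
  central (x i)   f = x-central i f
  central (p ⊕ q) f = trans (distribʳ _ _ _) (trans (+-cong (central p f) (central q f)) (sym (distribˡ _ _ _)))
  central (p ⊛ q) f = begin
    ⟦ p ⟧ * ⟦ q ⟧ * f   ≈⟨ *-assoc _ _ _ ⟩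
    ⟦ p ⟧ * (⟦ q ⟧ * f) ≈⟨ *-congˡ (central q f) ⟩
    ⟦ p ⟧ * (f * ⟦ q ⟧) ≈⟨ *-assoc _ _ _ ⟨
    ⟦ p ⟧ * f * ⟦ q ⟧   ≈⟨ *-congʳ (central p f) ⟩
    f * ⟦ p ⟧ * ⟦ q ⟧   ≈⟨ *-assoc _ _ _ ⟩
    f * (⟦ p ⟧ * ⟦ q ⟧) ∎
  central (⊝ p)   f = trans (sym (-‿distribˡ-* _ _)) (trans (-‿cong (central p f)) (-‿distribʳ-* _ _))

  -- Equality is borrowed from Ω, so the commutative algebra applies to the subring of Ω generated
  -- by the `x i` before anything is known about normal forms.
  polyRing : CommutativeRing c (c ⊔ ℓ)
  polyRing = record
    { Carrier = Poly
    ; _≈_ = λ p q → ⟦ p ⟧ ≈ ⟦ q ⟧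
    ; _+_ = _⊕_
    ; _*_ = _⊛_
    ; -_ = ⊝_
    ; 0# = con K.0#
    ; 1# = con K.1#
    ; isCommutativeRing = record
      { isRing = record
        { +-isAbelianGroup = record
          { isGroup = record
            { isMonoid = record
              { isSemigroup = record
                { isMagma = record
                  { isEquivalence = record { refl = refl ; sym = sym ; trans = trans }
                  ; ∙-cong = +-cong }
                ; assoc = λ p q s → +-assoc _ _ _ }
              ; identity = (λ p → +-identityˡ _) , (λ p → +-identityʳ _) }
            ; inverse = (λ p → -‿inverseˡ _) , (λ p → -‿inverseʳ _)
            ; ⁻¹-cong = -‿cong }
          ; comm = λ p q → +-comm _ _ }
        ; *-cong = *-cong
        ; *-assoc = λ p q s → *-assoc _ _ _
        ; *-identity = (λ p → *-identityˡ _) , (λ p → *-identityʳ _)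
        ; distrib = (λ p q s → distribˡ _ _ _) , (λ p q s → distribʳ _ _ _) }
      ; *-comm = λ p q → central p ⟦ q ⟧ } }

  module P = CommutativeRing polyRing
  open Exp P.semiring using () renaming (_^_ to _^ᴾ_)
  open Exp semiring using (_^_)
  open Mult P.+-monoid using () renaming (_×_ to _·ᴾ_)
  open Mult K.+-monoid using () renaming (_×_ to _·ᴷ_)

  ⟦^⟧ : ∀ p k → ⟦ p ^ᴾ k ⟧ ≡ ⟦ p ⟧ ^ k
  ⟦^⟧ p zero    = ≡.refl
  ⟦^⟧ p (suc k) = ≡.cong (⟦ p ⟧ *_) (⟦^⟧ p k)

  open Monomials polyRing public using (monomial)

  ⟦monomial⟧ : ∀ a → ⟦ monomial x a ⟧ ≡ Ω.product (λ i → Ω.x i ^ lookup a i)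
  ⟦monomial⟧ a = go (λ i → x i ^ᴾ lookup a i) (λ i → Ω.x i ^ lookup a i) (λ i → ⟦^⟧ (x i) (lookup a i))
    where
    go : ∀ {m} (f : Fin m → Poly) g → (∀ i → ⟦ f i ⟧ ≡ g i) →
         ⟦ Vector.foldr _⊛_ (con K.1#) f ⟧ ≡ Vector.foldr _*_ Ω.1Ω g
    go {zero}  f g e = ≡.refl
    go {suc m} f g e = ≡.cong₂ _*_ (e zero) (go (λ i → f (suc i)) (λ i → g (suc i)) (λ i → e (suc i)))

  invert : InvertibleNaturals K → InvertibleNaturals polyRing
  invert h m = con (proj₁ (h m)) , trans (*-congˡ (multiple (suc m)))
    (trans (sym (Ω.con-* _ _)) (Ω.con-cong (proj₂ (h m))))
    where
    multiple : ∀ m → ⟦ m ·ᴾ P.1# ⟧ ≈ Ω.con (m ·ᴷ K.1#)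
    multiple zero    = refl
    multiple (suc m) = trans (+-congˡ (multiple m)) (sym (Ω.con-+ _ _))

  con-neg : ∀ a → Ω.con (K.- a) ≈ - Ω.con a
  con-neg a = begin
    Ω.con (K.- a)                         ≈⟨ +-identityʳ _ ⟨
    Ω.con (K.- a) + 0#                    ≈⟨ +-congˡ (-‿inverseʳ _) ⟨
    Ω.con (K.- a) + (Ω.con a - Ω.con a)   ≈⟨ +-assoc _ _ _ ⟨
    Ω.con (K.- a) + Ω.con a - Ω.con a     ≈⟨ +-congʳ (Ω.con-+ _ _) ⟨
    Ω.con (K.- a K.+ a) - Ω.con a         ≈⟨ +-congʳ (Ω.con-cong (K.-‿inverseˡ a)) ⟩
    0# - Ω.con a                          ≈⟨ +-identityˡ _ ⟩
    - Ω.con a                             ∎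

  open Ideals polyRing public
  open IntegerSolver polyRing using (solve; _:=_; _:+_; _:*_; _:-_; :-_)

  module _ {p : Level} {𝔞 : Pred Poly p} (I : IsIdeal 𝔞) (x∈ : ∀ i → 𝔞 (x i)) where
    open IsIdeal I

    augmentation : ∀ h → 𝔞 (h P.- con (Ω.constantTerm ⟦ h ⟧))
    augmentation (con a) = resp (sym (-‿inverseʳ _)) zero∈
    augmentation (x i)   = resp (sym (trans (+-congˡ (trans (sym (+-identityˡ _)) (-‿inverseʳ _))) (+-identityʳ _))) (x∈ i)
    augmentation (h ⊕ g) = resp (trans
        (solve 4 (λ h a g b → (h :- a) :+ (g :- b) := (h :+ g) :- (a :+ b)) refl h (con _) g (con _))
        (+-congˡ (-‿cong (sym (Ω.con-+ _ _)))))
      (add (augmentation h) (augmentation g))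
    augmentation (h ⊛ g) = resp (trans
        (solve 4 (λ h a g b → h :* (g :- b) :+ b :* (h :- a) := (h :* g) :- (a :* b)) refl h (con _) g (con _))
        (+-congˡ (-‿cong (sym (Ω.con-* _ _)))))
      (add (mul h (augmentation g)) (mul (con _) (augmentation h)))
    augmentation (⊝ h)   = resp (trans
        (solve 2 (λ h a → :- (h :- a) := (:- h) :- (:- a)) refl h (con _))
        (+-congˡ (-‿cong (sym (con-neg _)))))
      (neg (augmentation h))

module Combinations {r ℓr m ℓm i p : Level} {R : Ring r ℓr} (M : LeftModule R m ℓm)
         {I : Set i} (_≟_ : DecidableEquality I) (b : I → LeftModule.Carrierᴹ M) (P : Pred I p) where

  private module R = Ring R
  open LeftModule M
  open DecMembership _≟_ using (_∈?_)

  private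
    lc = linearCombination M b

    lc-cong : ∀ {a a′} is → (∀ {j} → j ∈ is → a j ≡ a′ j) → lc a is ≈ᴹ lc a′ is
    lc-cong []       e = ≈ᴹ-refl
    lc-cong (j ∷ is) e = +ᴹ-cong (*ₗ-congʳ (R.reflexive (e (here ≡.refl)))) (lc-cong is (λ m → e (there m)))

    override : I → (R.Carrier → R.Carrier) → (I → R.Carrier) → I → R.Carrier
    override i f a j = if does (j ≟ i) then f (a j) else a j

    override-same : ∀ i f a → override i f a i ≡ f (a i)
    override-same i f a with i ≟ i
    ... | yes _   = ≡.refl
    ... | no  i≢i = contradiction ≡.refl i≢i

    override-other : ∀ i f a {j} → j ≡.≢ i → override i f a j ≡ a j
    override-other i f a {j} j≢i with j ≟ i
    ... | yes e = contradiction e j≢i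
    ... | no  _ = ≡.refl

    lc-add : ∀ {k i a} is → Unique is → i ∈ is → lc (override i (k R.+_) a) is ≈ᴹ k *ₗ b i +ᴹ lc a is
    lc-add {k} {i} {a} (j ∷ is) (j∉ ∷ u) (here ≡.refl) = ≈ᴹ-trans
      (+ᴹ-cong (≈ᴹ-trans (*ₗ-congʳ (R.reflexive (override-same j (k R.+_) a))) (*ₗ-distribʳ (b j) k (a j)))
        (lc-cong is (λ m → override-other j (k R.+_) a (λ e → All.lookup j∉ m (≡.sym e)))))
      (+ᴹ-assoc _ _ _)
    lc-add {k} {i} {a} (j ∷ is) (j∉ ∷ u) (there m) = ≈ᴹ-trans
      (+ᴹ-cong (*ₗ-congʳ (R.reflexive (override-other i (k R.+_) a (All.lookup j∉ m)))) (lc-add is u m))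
      (≈ᴹ-trans (≈ᴹ-sym (+ᴹ-assoc _ _ _)) (≈ᴹ-trans (+ᴹ-congʳ (+ᴹ-comm _ _)) (+ᴹ-assoc _ _ _)))

  -- Coefficients are a function of the index. In a list without repetitions, changing its value at
  -- one index changes exactly one summand, which is how a term with an index already present is
  -- added.
  Spanned : Carrierᴹ → Set _
  Spanned v = ∃₂ λ a is → Unique is × All P is × v ≈ᴹ lc a is

  spanned-0 : Spanned 0ᴹ
  spanned-0 = (λ _ → R.0#) , [] , [] , [] , ≈ᴹ-refl

  spanned-resp : ∀ {v w} → v ≈ᴹ w → Spanned w → Spanned v
  spanned-resp e (a , is , u , q , e′) = a , is , u , q , ≈ᴹ-trans e e′

  spanned-add : ∀ k {i v} → P i → Spanned v → Spanned (k *ₗ b i +ᴹ v)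
  spanned-add k {i} p (a , is , u , q , e) with i ∈? is
  ... | yes m = override i (k R.+_) a , is , u , q , ≈ᴹ-trans (+ᴹ-congˡ e) (≈ᴹ-sym (lc-add is u m))
  ... | no i∉ = override i (λ _ → k) a , i ∷ is , ¬Any⇒All¬ is i∉ ∷ u , p ∷ q ,
    +ᴹ-cong (*ₗ-congʳ (R.reflexive (≡.sym (override-same i (λ _ → k) a))))
      (≈ᴹ-trans e (lc-cong is (λ m → ≡.sym (override-other i (λ _ → k) a (λ { ≡.refl → i∉ m })))))

module ExteriorMonomials {c ℓ : Level} (K : CommutativeRing c ℓ) (n : ℕ)
         (half : ∃[ u ] CommutativeRing._≈_ K (CommutativeRing._*_ K u (CommutativeRing._+_ K (CommutativeRing.1# K) (CommutativeRing.1# K))) (CommutativeRing.1# K))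
         where

  private
    module K = CommutativeRing K
    module Ω = Superspace K n
  open Ring Ω.ring hiding (zero)
  open RingProperties Ω.ring using (-‿distribˡ-*; -‿distribʳ-*)
  open AbelianGroupProperties +-abelianGroup using (⁻¹-involutive; ε⁻¹≈ε; ⁻¹-∙-comm)
  open Polynomials K n using (x; con; _⊕_; _⊛_; ⊝_; ⟦_⟧; central)
  open import Relation.Binary.Reasoning.Setoid setoid

  halve : ∀ f → f + f ≈ 0# → f ≈ 0#
  halve f e = begin
    f                                     ≈⟨ *-identityˡ f ⟨
    Ω.con K.1# * f                        ≈⟨ *-congʳ (Ω.con-cong (proj₂ half)) ⟨
    Ω.con (proj₁ half K.* (K.1# K.+ K.1#)) * f ≈⟨ *-congʳ (trans (Ω.con-* _ _) (*-congˡ (Ω.con-+ _ _))) ⟩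
    Ω.con (proj₁ half) * (1# + 1#) * f    ≈⟨ *-assoc _ _ _ ⟩
    Ω.con (proj₁ half) * ((1# + 1#) * f)  ≈⟨ *-congˡ (trans (distribʳ _ _ _) (+-cong (*-identityˡ f) (*-identityˡ f))) ⟩
    Ω.con (proj₁ half) * (f + f)          ≈⟨ *-congˡ e ⟩
    Ω.con (proj₁ half) * 0#               ≈⟨ zeroʳ _ ⟩
    0#                                    ∎

  -- Anticommutation at equal indices gives only twice the square as 0; this is where 2 is inverted.
  θ²≈0 : ∀ i → Ω.θ i * Ω.θ i ≈ 0#
  θ²≈0 i = halve _ (trans (+-congʳ (Ω.θθ-anticomm i i)) (-‿inverseˡ _))

  θ-product : Subset n → Carrier
  θ-product J = Ω.product (λ i → Ω.θ-factor (lookup J i) i)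

  infix 4 _≈±_
  -- The signs from reordering θ are left undetermined, as they do not affect membership in a
  -- submodule.
  _≈±_ : Carrier → Carrier → Set _
  f ≈± g = f ≈ g ⊎ f ≈ - g

  private
    prod : ∀ {m} → (Fin m → Fin n) → Subset m → Carrier
    prod ι J = Vector.foldr _*_ 1# (λ i → Ω.θ-factor (lookup J i) (ι i))

    pass : ∀ s t f → Ω.θ s * (Ω.θ t * f) ≈ - (Ω.θ t * (Ω.θ s * f))
    pass s t f = begin
      Ω.θ s * (Ω.θ t * f)     ≈⟨ *-assoc _ _ _ ⟨
      Ω.θ s * Ω.θ t * f       ≈⟨ *-congʳ (Ω.θθ-anticomm s t) ⟩
      - (Ω.θ t * Ω.θ s) * f   ≈⟨ -‿distribˡ-* _ _ ⟨
      - (Ω.θ t * Ω.θ s * f)   ≈⟨ -‿cong (*-assoc _ _ _) ⟩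
      - (Ω.θ t * (Ω.θ s * f)) ∎

    wedge-inside′ : ∀ {m} (ι : Fin m → Fin n) J s → lookup J s ≡ inside → Ω.θ (ι s) * prod ι J ≈ 0#
    wedge-inside′ ι (inside  ∷ J) zero    e = trans (sym (*-assoc _ _ _)) (trans (*-congʳ (θ²≈0 (ι zero))) (zeroˡ _))
    wedge-inside′ ι (outside ∷ J) (suc s) e =
      trans (*-congˡ (*-identityˡ _)) (wedge-inside′ (λ i → ι (suc i)) J s e)
    wedge-inside′ ι (inside  ∷ J) (suc s) e = trans (pass _ _ _)
      (trans (-‿cong (trans (*-congˡ (wedge-inside′ (λ i → ι (suc i)) J s e)) (zeroʳ _))) ε⁻¹≈ε)

    wedge-outside′ : ∀ {m} (ι : Fin m → Fin n) J s → lookup J s ≡ outside → Ω.θ (ι s) * prod ι J ≈± prod ι (J [ s ]≔ inside)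
    wedge-outside′ ι (outside ∷ J) zero    e = inj₁ (*-congˡ (*-identityˡ _))
    wedge-outside′ ι (outside ∷ J) (suc s) e with wedge-outside′ (λ i → ι (suc i)) J s e
    ... | inj₁ q = inj₁ (trans (*-congˡ (*-identityˡ _)) (trans q (sym (*-identityˡ _))))
    ... | inj₂ q = inj₂ (trans (*-congˡ (*-identityˡ _)) (trans q (-‿cong (sym (*-identityˡ _)))))
    wedge-outside′ ι (inside  ∷ J) (suc s) e with wedge-outside′ (λ i → ι (suc i)) J s e
    ... | inj₁ q = inj₂ (trans (pass _ _ _) (-‿cong (*-congˡ q)))
    ... | inj₂ q = inj₁ (trans (pass _ _ _) (trans (-‿cong (trans (*-congˡ q) (sym (-‿distribʳ-* _ _)))) (⁻¹-involutive _)))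

  wedge-inside : ∀ J s → lookup J s ≡ inside → Ω.θ s * θ-product J ≈ 0#
  wedge-inside = wedge-inside′ (λ i → i)

  wedge-outside : ∀ J s → lookup J s ≡ outside → Ω.θ s * θ-product J ≈± θ-product (J [ s ]≔ inside)
  wedge-outside = wedge-outside′ (λ i → i)

  -- Existence of an expansion into terms h θ_J, phrased as a closure so that terms need not be
  -- collected or ordered.
  data Normal : Carrier → Set (c ⊔ ℓ) where
    resp  : ∀ {f g} → f ≈ g → Normal f → Normal g
    zero∈ : Normal 0#
    add   : ∀ {f g} → Normal f → Normal g → Normal (f + g)
    term  : ∀ h J → Normal (⟦ h ⟧ * θ-product J)

  private
    poly-* : ∀ p {f} → Normal f → Normal (⟦ p ⟧ * f)
    poly-* p (resp e s)  = resp (*-congˡ e) (poly-* p s)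
    poly-* p zero∈       = resp (sym (zeroʳ _)) zero∈
    poly-* p (add s t)   = resp (sym (distribˡ _ _ _)) (add (poly-* p s) (poly-* p t))
    poly-* p (term h J)  = resp (*-assoc _ _ _) (term (p ⊛ h) J)

    θ-* : ∀ s {f} → Normal f → Normal (Ω.θ s * f)
    θ-* s (resp e t)  = resp (*-congˡ e) (θ-* s t)
    θ-* s zero∈       = resp (sym (zeroʳ _)) zero∈
    θ-* s (add t u)   = resp (sym (distribˡ _ _ _)) (add (θ-* s t) (θ-* s u))
    θ-* s (term h J)  = resp
      (trans (sym (*-assoc _ _ _)) (trans (*-congʳ (central h (Ω.θ s))) (*-assoc _ _ _)))
      (poly-* h (go (lookup J s) ≡.refl))
      where
      go : ∀ b → lookup J s ≡ b → Normal (Ω.θ s * θ-product J)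
      go inside  e = resp (sym (wedge-inside J s e)) zero∈
      go outside e with wedge-outside J s e
      ... | inj₁ q = resp (trans (*-identityˡ _) (sym q)) (term (con K.1#) (J [ s ]≔ inside))
      ... | inj₂ q = resp (trans (sym (-‿distribˡ-* _ _)) (trans (-‿cong (*-identityˡ _)) (sym q)))
                       (term (⊝ con K.1#) (J [ s ]≔ inside))

    normal-* : ∀ f {g} → Normal g → Normal (f * g)
    normal-* (Ω.con a) s = poly-* (con a) s
    normal-* (Ω.x i)   s = poly-* (x i) s
    normal-* (Ω.θ i)   s = θ-* i s
    normal-* (f Ω.+ g) s = resp (sym (distribʳ _ _ _)) (add (normal-* f s) (normal-* g s))
    normal-* (f Ω.* g) s = resp (sym (*-assoc _ _ _)) (normal-* f (normal-* g s))
    normal-* (Ω.- f)   s = resp (trans (sym (-‿distribˡ-* _ _)) (trans (-‿cong (*-identityˡ _)) (-‿distribˡ-* _ _)))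
      (poly-* (⊝ con K.1#) (normal-* f s))

    θ-product-∅ : ∀ {m} (ι : Fin m → Fin n) → prod ι (replicate m outside) ≈ 1#
    θ-product-∅ {zero}  ι = refl
    θ-product-∅ {suc m} ι = trans (*-identityˡ _) (θ-product-∅ (λ i → ι (suc i)))

  normal : ∀ f → Normal f
  normal f = resp (trans (*-congˡ (trans (*-identityˡ _) (θ-product-∅ (λ i → i)))) (*-identityʳ f))
    (normal-* f (term (con K.1#) (replicate n outside)))

module InvariantSums {c ℓ : Level} (K : CommutativeRing c ℓ) (n r : ℕ) (1≤r : 1 ≤ r) (ζ : CommutativeRing.Carrier K)
         (ζ^r≈1 : IsRootOfUnity K r ζ) where

  private
    module K = CommutativeRing K
    module Ω = Superspace K n
    module ᴷ = Exp K.semiring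
  open Ring Ω.ring hiding (zero)
  open Exp semiring using (_^_)
  open Sum +-commutativeMonoid using (sum; sum-cong-≋; sum-permute)
  open Ω.WreathProduct
  open import Relation.Binary.Reasoning.Setoid setoid

  act : Ω.WreathProduct r → Carrier → Carrier
  act = Ω.act r ζ

  scale : Ω.WreathProduct r → Fin n → K.Carrier
  scale g i = ζ ᴷ.^ (r ∸ toℕ (exponents g (permutation g ⟨$⟩ʳ i)))

  one^ : ∀ k → K.1# ᴷ.^ k K.≈ K.1#
  one^ zero    = K.refl
  one^ (suc k) = K.trans (K.*-identityˡ _) (one^ k)

  scale^ : ∀ g i k → scale g i ᴷ.^ (r ℕ.* k) K.≈ K.1#
  scale^ g i k = K.trans (ᴷ.^-assocʳ ζ m (r ℕ.* k)) (K.trans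
    (K.reflexive (≡.cong (ζ ᴷ.^_) (≡.trans (≡.sym (ℕ.*-assoc m r k)) (≡.trans (≡.cong (ℕ._* k) (ℕ.*-comm m r)) (ℕ.*-assoc r m k)))))
    (K.trans (K.sym (ᴷ.^-assocʳ ζ r (m ℕ.* k))) (K.trans (ᴷ.^-congˡ (m ℕ.* k) ζ^r≈1) (one^ (m ℕ.* k)))))
    where m = r ∸ toℕ (exponents g (permutation g ⟨$⟩ʳ i))

  act-power : ∀ g i m → act g (Ω.x i ^ m) ≈ Ω.con (scale g i ᴷ.^ m) * Ω.x (permutation g ⟨$⟩ʳ i) ^ m
  act-power g i zero    = sym (*-identityˡ _)
  act-power g i (suc m) = begin
    Ω.con a * X * act g (Ω.x i ^ m)         ≈⟨ *-congˡ (act-power g i m) ⟩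
    Ω.con a * X * (Ω.con (a ᴷ.^ m) * X ^ m) ≈⟨ *-assoc _ _ _ ⟩
    Ω.con a * (X * (Ω.con (a ᴷ.^ m) * X ^ m)) ≈⟨ *-congˡ (*-assoc _ _ _) ⟨
    Ω.con a * (X * Ω.con (a ᴷ.^ m) * X ^ m) ≈⟨ *-congˡ (*-congʳ (Ω.con-central _ _)) ⟨
    Ω.con a * (Ω.con (a ᴷ.^ m) * X * X ^ m) ≈⟨ *-congˡ (*-assoc _ _ _) ⟩
    Ω.con a * (Ω.con (a ᴷ.^ m) * (X * X ^ m)) ≈⟨ *-assoc _ _ _ ⟨
    Ω.con a * Ω.con (a ᴷ.^ m) * (X * X ^ m) ≈⟨ *-congʳ (Ω.con-* _ _) ⟨
    Ω.con (a K.* a ᴷ.^ m) * (X * X ^ m)     ∎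
    where
    a = scale g i
    X = Ω.x (permutation g ⟨$⟩ʳ i)

  act-sum : ∀ g {m} (f : Fin m → Carrier) → act g (sum f) ≡ sum (λ i → act g (f i))
  act-sum g {zero}  f = ≡.refl
  act-sum g {suc m} f = ≡.cong (act g (f zero) +_) (act-sum g (λ i → f (suc i)))

  Permuted : (Fin n → Carrier) → Set _
  Permuted f = ∀ g i → act g (f i) ≈ f (permutation g ⟨$⟩ʳ i)

  sum-invariant : ∀ f → Permuted f → Ω.Invariant r ζ (sum f)
  sum-invariant f e g = begin
    act g (sum f)                          ≡⟨ act-sum g f ⟩
    sum (λ i → act g (f i))                ≈⟨ sum-cong-≋ (e g) ⟩
    sum (λ i → f (permutation g ⟨$⟩ʳ i))   ≈⟨ sum-permute f (permutation g) ⟨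
    sum f                                  ∎

  constantTerm-sum : ∀ {m} (f : Fin m → Carrier) → (∀ i → Ω.constantTerm (f i) K.≈ K.0#) → Ω.constantTerm (sum f) K.≈ K.0#
  constantTerm-sum {zero}  f e = K.refl
  constantTerm-sum {suc m} f e = K.trans (K.+-cong (e zero) (constantTerm-sum (λ i → f (suc i)) (λ i → e (suc i)))) (K.+-identityˡ _)

  power-permuted : ∀ k → Permuted (λ i → Ω.x i ^ (r ℕ.* k))
  power-permuted k g i = trans (act-power g i (r ℕ.* k)) (trans (*-congʳ (Ω.con-cong (scale^ g i k))) (*-identityˡ _))

  powerSum∈SI : ∀ k → Ω.SI r ζ (sum (λ i → Ω.x i ^ (r ℕ.* suc k)))
  powerSum∈SI k = Ω.generator (sum-invariant _ (power-permuted (suc k)) , constantTerm-sum (λ i → Ω.x i ^ (r ℕ.* suc k)) λ i → positive i (r ℕ.* suc k) (ℕ.*-mono-≤ 1≤r (s≤s z≤n)))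
    where
    positive : ∀ i m → 1 ≤ m → Ω.constantTerm (Ω.x i ^ m) K.≈ K.0#
    positive i (suc m) _ = K.zeroˡ _

  -- `θ i` picks up the same scalar as `x i`, which completes the exponent r·k + (r - 1) to the
  -- multiple r·suc k of `r`.
  differential-permuted : ∀ k → Permuted (λ i → Ω.x i ^ (r ℕ.* k ℕ.+ (r ∸ 1)) * Ω.θ i)
  differential-permuted k g i = begin
    act g (Ω.x i ^ m) * (Ω.con a * Θ)       ≈⟨ *-congʳ (act-power g i m) ⟩
    Ω.con (a ᴷ.^ m) * X ^ m * (Ω.con a * Θ) ≈⟨ *-assoc _ _ _ ⟨
    Ω.con (a ᴷ.^ m) * X ^ m * Ω.con a * Θ   ≈⟨ *-congʳ (Ω.con-central _ _) ⟨
    Ω.con a * (Ω.con (a ᴷ.^ m) * X ^ m) * Θ ≈⟨ *-congʳ (*-assoc _ _ _) ⟨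
    Ω.con a * Ω.con (a ᴷ.^ m) * X ^ m * Θ   ≈⟨ *-congʳ (*-congʳ (trans (sym (Ω.con-* _ _)) (Ω.con-cong exponent))) ⟩
    1# * X ^ m * Θ                          ≈⟨ *-congʳ (*-identityˡ _) ⟩
    X ^ m * Θ                               ∎
    where
    m = r ℕ.* k ℕ.+ (r ∸ 1)
    a = scale g i
    X = Ω.x (permutation g ⟨$⟩ʳ i)
    Θ = Ω.θ (permutation g ⟨$⟩ʳ i)
    exponent : a K.* a ᴷ.^ m K.≈ K.1#
    exponent = K.trans (K.reflexive (≡.cong (a ᴷ.^_) (≡.trans (≡.sym (ℕ.+-suc (r ℕ.* k) (r ∸ 1)))
      (≡.trans (≡.cong (r ℕ.* k ℕ.+_) (ℕ.m+[n∸m]≡n 1≤r)) (≡.trans (ℕ.+-comm _ r) (≡.sym (ℕ.*-suc r k))))))) (scale^ g i (suc k))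

  differential∈SI : ∀ k → Ω.SI r ζ (sum (λ i → Ω.x i ^ (r ℕ.* k ℕ.+ (r ∸ 1)) * Ω.θ i))
  differential∈SI k = Ω.generator (sum-invariant _ (differential-permuted k) , constantTerm-sum (λ i → Ω.x i ^ (r ℕ.* k ℕ.+ (r ∸ 1)) * Ω.θ i) λ i → K.zeroʳ _)

-- Orders on the positions, staircases as boxes, and the weight of a subset

descending : ∀ n → List (Fin n)
descending zero    = []
descending (suc n) = map suc (descending n) ++ zero ∷ []

descending-complete : ∀ {n} (i : Fin n) → i ∈ descending n
descending-complete zero    = ∈-++⁺ʳ _ (here ≡.refl)
descending-complete (suc i) = ∈-++⁺ˡ (∈-map⁺ suc (descending-complete i))

descending-sorted : ∀ n → AllPairs (λ i j → j <ᶠ i) (descending n)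
descending-sorted zero    = []
descending-sorted (suc n) = AllPairs.++⁺ (AllPairs.map⁺ (mapAll (descending-sorted n))) ([] ∷ [])
  (All.map⁺ (All.tabulate λ _ → s≤s z≤n ∷ []))
  where
  mapAll : ∀ {l : List (Fin n)} → AllPairs (λ i j → j <ᶠ i) l → AllPairs (λ i j → suc j <ᶠ suc i) l
  mapAll []       = []
  mapAll (a ∷ as) = All.map s≤s a ∷ mapAll as

unique-ʳ++ : ∀ {n} (p {s} : List (Fin n)) → Unique p → Unique s → (∀ {i} → i ∈ p → i ∉ s) → Unique (p ʳ++ s)
unique-ʳ++ []      u v d = v
unique-ʳ++ (i ∷ p) (i∉p ∷ u) v d = unique-ʳ++ p u (All.¬Any⇒All¬ _ (d (here ≡.refl)) ∷ v)
  λ { m (here ≡.refl) → All.lookup i∉p m ≡.refl ; m (there m′) → d (there m) m′ }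

∈-ʳ++ : ∀ {n} (p {s} : List (Fin n)) {i} → i ∈ s → i ∈ p ʳ++ s
∈-ʳ++ []      m = m
∈-ʳ++ (j ∷ p) m = ∈-ʳ++ p (there m)

∈-ʳ++ˡ : ∀ {n} (p {s} : List (Fin n)) {i} → i ∈ p → i ∈ p ʳ++ s
∈-ʳ++ˡ (j ∷ p) (here ≡.refl) = ∈-ʳ++ p (here ≡.refl)
∈-ʳ++ˡ (j ∷ p) (there m)     = ∈-ʳ++ˡ p m

-- Defined by the reversal that `States` uses: the starting state has all positions before the
-- cursor, stored as `descending n`, and undoing its reversal has to give the list of positions.
ascending : ∀ n → List (Fin n)
ascending n = descending n ʳ++ []

ascending-unique : ∀ n → Unique (ascending n)
ascending-unique n = unique-ʳ++ (descending n) (go (descending-sorted n)) [] (λ _ ())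
  where
  go : ∀ {l : List (Fin n)} → AllPairs (λ i j → j <ᶠ i) l → Unique l
  go []       = []
  go (a ∷ as) = All.map (λ { j<i ≡.refl → ℕ.<-irrefl ≡.refl j<i }) a ∷ go as

ascending-complete : ∀ {n} (i : Fin n) → i ∈ ascending n
ascending-complete {n} i = ∈-ʳ++ˡ (descending n) (descending-complete i)

module Staircases {n : ℕ} (r : ℕ) (1≤r : 1 ≤ r) where

  open States {n} r (ascending n) (ascending-unique n)

  -- With k free positions before, the staircase index is k + 1. Its limits, at most (k+1)r - 2
  -- inside and (k+1)r - 1 outside, become strict ones below r·k + (r - 1) and r·k + r.
  sideMark : Side → Mark
  sideMark inside  = bound (r ∸ 1) (ℕ.m∸n≤m r 1)
  sideMark outside = free

  entries : Subset n → List (Fin n) → Entries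
  entries J = map (λ i → i , sideMark (lookup J i))

  private
    ≤-diff⁺ : ∀ {a m} k → a ℕ.+ k ≤ m → ℤ.+ a ℤ.≤ ℤ.+ m ℤ.- ℤ.+ k
    ≤-diff⁺ {a} {m} k p = ≡.subst (ℤ._≤ ℤ.+ m ℤ.- ℤ.+ k)
      (≡.trans (≡.cong (ℤ._- ℤ.+ k) (ℤ.pos-+ a k)) (≡.trans (ℤ.+-assoc (ℤ.+ a) (ℤ.+ k) (ℤ.- ℤ.+ k))
        (≡.trans (≡.cong (λ z → ℤ.+ a ℤ.+ z) (ℤ.+-inverseʳ (ℤ.+ k))) (ℤ.+-identityʳ _))))
      (ℤ.+-monoˡ-≤ (ℤ.- ℤ.+ k) (ℤ.+≤+ p))

    ≤-diff⁻ : ∀ {a m} k → ℤ.+ a ℤ.≤ ℤ.+ m ℤ.- ℤ.+ k → a ℕ.+ k ≤ m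
    ≤-diff⁻ {a} {m} k p = ℤ.drop‿+≤+ (≡.subst₂ ℤ._≤_ (≡.sym (ℤ.pos-+ a k))
      (≡.trans (ℤ.+-assoc (ℤ.+ m) (ℤ.- ℤ.+ k) (ℤ.+ k)) (≡.trans (≡.cong (λ z → ℤ.+ m ℤ.+ z) (ℤ.+-inverseˡ (ℤ.+ k))) (ℤ.+-identityʳ _)))
      (ℤ.+-monoˡ-≤ (ℤ.+ k) p))

    width : ∀ k → suc k ℕ.* r ≡ r ℕ.* k ℕ.+ r
    width k = ≡.trans (ℕ.+-comm r (k ℕ.* r)) (≡.cong (ℕ._+ r) (ℕ.*-comm k r))

    shorten : ∀ k → suc (r ℕ.* k ℕ.+ (r ∸ 1)) ≡ r ℕ.* k ℕ.+ r
    shorten k = ≡.trans (≡.sym (ℕ.+-suc _ _)) (≡.cong (r ℕ.* k ℕ.+_) (ℕ.m+[n∸m]≡n 1≤r))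

    Below : ∀ {m} → (Fin m → Fin n) → ℕ → Subset m → Exponents → Set
    Below ι k J a = ∀ i → ℤ.+ lookup a (ι i) ℤ.≤ lookup (staircase r (suc k) J) i

    module _ {m : ℕ} (ι : Fin m → Fin n) (J : Subset m) where
      list : Entries
      list = map (λ i → ι i , sideMark (lookup J i)) (descending m)

    list-suc : ∀ {m} (ι : Fin (suc m) → Fin n) b J tail →
               list ι (b ∷ J) ++ tail ≡ list (λ i → ι (suc i)) J ++ (ι zero , sideMark b) ∷ tail
    list-suc {m} ι b J tail = ≡.trans (≡.cong (_++ tail) (map-++ _ (map suc (descending m)) (zero ∷ [])))
      (≡.trans (++-assoc (map _ (map suc (descending m))) _ tail) (≡.cong (_++ _) (≡.sym (map-∘ (descending m)))))

    box⁺ : ∀ {m} (ι : Fin m → Fin n) J tail {a} → Below ι (count tail) J a → PreBox tail a → PreBox (list ι J ++ tail) a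
    box⁺ ι []            tail h p = p
    box⁺ ι (outside ∷ J) tail {a} h p = ≡.subst (λ l → PreBox l a) (≡.sym (list-suc ι outside J tail))
      (box⁺ _ J _ (λ i → h (suc i))
        (≡.subst₂ _≤_ (ℕ.+-comm _ 1) (width (count tail)) (≤-diff⁻ 1 (h zero)) , p))
    box⁺ ι (inside  ∷ J) tail {a} h p = ≡.subst (λ l → PreBox l a) (≡.sym (list-suc ι inside J tail))
      (box⁺ _ J _ (λ i → h (suc i))
        (ℕ.≤-pred (≡.subst₂ _≤_ (ℕ.+-comm _ 2) (≡.trans (width (count tail)) (≡.sym (shorten (count tail)))) (≤-diff⁻ 2 (h zero))) , p))

    box⁻ : ∀ {m} (ι : Fin m → Fin n) J tail {a} → PreBox (list ι J ++ tail) a → Below ι (count tail) J a × PreBox tail a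
    box⁻ ι []            tail p = (λ ()) , p
    box⁻ ι (outside ∷ J) tail {a} p =
      let h , b , q = box⁻ _ J _ (≡.subst (λ l → PreBox l a) (list-suc ι outside J tail) p)
      in (λ { zero    → ≤-diff⁺ 1 (≡.subst₂ _≤_ (ℕ.+-comm 1 _) (≡.sym (width (count tail))) b)
            ; (suc i) → h i }) , q
    box⁻ ι (inside  ∷ J) tail {a} p =
      let h , b , q = box⁻ _ J _ (≡.subst (λ l → PreBox l a) (list-suc ι inside J tail) p)
      in (λ { zero    → ≤-diff⁺ 2 (≡.subst₂ _≤_ (ℕ.+-comm 2 _) (≡.trans (shorten (count tail)) (≡.sym (width (count tail)))) (s≤s b))
            ; (suc i) → h i }) , q

    ++-[] : ∀ (l : Entries) → l ++ [] ≡ l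
    ++-[] []      = ≡.refl
    ++-[] (e ∷ l) = ≡.cong (e ∷_) (++-[] l)

  staircase⇒box : ∀ {J a} → 𝒜 n r (J , a) → Box (entries J (descending n)) [] a
  staircase⇒box {J} {a} h = ≡.subst (λ l → PreBox l a) (++-[] _) (box⁺ (λ i → i) J [] h tt) , tt

  box⇒staircase : ∀ {J a} → Box (entries J (descending n)) [] a → 𝒜 n r (J , a)
  box⇒staircase {J} {a} (p , _) = proj₁ (box⁻ (λ i → i) J [] (≡.subst (λ l → PreBox l a) (≡.sym (++-[] _)) p))

-- The elements of J are counted from o.
weight : ∀ {m} → ℕ → Subset m → ℕ
weight o []            = 0
weight o (inside  ∷ J) = o ℕ.+ weight (suc o) J
weight o (outside ∷ J) = weight (suc o) J

weight-insert : ∀ {m} o (J : Subset m) i → lookup J i ≡ outside → weight o (J [ i ]≔ inside) ≡ (o ℕ.+ toℕ i) ℕ.+ weight o J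
weight-insert o (outside ∷ J) zero    e = ≡.cong (ℕ._+ weight (suc o) J) (≡.sym (ℕ.+-identityʳ o))
weight-insert o (outside ∷ J) (suc i) e = ≡.trans (weight-insert (suc o) J i e) (≡.cong (ℕ._+ weight (suc o) J) (≡.sym (ℕ.+-suc o (toℕ i))))
weight-insert o (inside  ∷ J) (suc i) e = ≡.trans (≡.cong (o ℕ.+_) (weight-insert (suc o) J i e))
  (≡.trans (≡.sym (ℕ.+-assoc o _ _)) (≡.trans (≡.cong (ℕ._+ weight (suc o) J) (≡.trans (ℕ.+-comm o _) (≡.cong (ℕ._+ o) (≡.sym (ℕ.+-suc o (toℕ i))))))
    (ℕ.+-assoc (o ℕ.+ suc (toℕ i)) o (weight (suc o) J))))

weight-bounded : ∀ {m} o (J : Subset m) → weight o J ≤ weight o (replicate m inside)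
weight-bounded o []            = z≤n
weight-bounded o (inside  ∷ J) = ℕ.+-monoʳ-≤ o (weight-bounded (suc o) J)
weight-bounded o (outside ∷ J) = ℕ.≤-trans (weight-bounded (suc o) J) (ℕ.m≤n+m _ o)

module SpanningSet {c ℓ : Level} (K : CommutativeRing c ℓ) (n r : ℕ) (1≤r : 1 ≤ r) (ζ : CommutativeRing.Carrier K)
         (ζ^r≈1 : IsRootOfUnity K r ζ)
         (invertᴷ : InvertibleNaturals K)
         where

  private
    module K = CommutativeRing K
    module Ω = Superspace K n
  open Ring Ω.ring hiding (zero)
  open RingProperties Ω.ring using (-‿distribˡ-*; -‿distribʳ-*)
  open AbelianGroupProperties +-abelianGroup using (⁻¹-involutive; ⁻¹-∙-comm)
  open SemiringSum semiring using (sum; sum-cong-≋; *-distribˡ-sum; *-distribʳ-sum)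
  open Exp semiring using (_^_; ^-homo-*; ^-assocʳ)
  open Polynomials K n
  open Exp P.semiring using () renaming (_^_ to _^ᴾ_; ^-homo-* to ^ᴾ-homo-*; ^-assocʳ to ^ᴾ-assocʳ)
  open InvariantSums K n r 1≤r ζ ζ^r≈1
  open import Relation.Binary.Reasoning.Setoid setoid

  half : ∃[ u ] (u K.* (K.1# K.+ K.1#)) K.≈ K.1#
  half = proj₁ (invertᴷ 1) , K.trans (K.*-congˡ (K.+-congˡ (K.sym (K.+-identityʳ _)))) (proj₂ (invertᴷ 1))

  open ExteriorMonomials K n half
  open Staircases {n} r 1≤r
  module SP = Spanning polyRing r x (ascending n) (ascending-unique n) con
  open Configurations polyRing r x (ascending n) (ascending-unique n)
  open SymmetricFunctions polyRing using (∑)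

  SI : Carrier → Set (c ⊔ ℓ)
  SI = Ω.SI r ζ

  active-entries : ∀ J ρ → active (entries J ρ) ≡ map y ρ
  active-entries J []      = ≡.refl
  active-entries J (i ∷ ρ) with lookup J i
  ... | inside  = ≡.cong (y i ∷_) (active-entries J ρ)
  ... | outside = ≡.cong (y i ∷_) (active-entries J ρ)

  private
    coefficient : ℕ → Entries → Fin n → Poly
    coefficient k pre i = x i ^ᴾ (r ∸ 1) ⊛ (y i ^ᴾ k ⊛ freeRoots pre (y i))

  -- Combinations of the invariants ∑ x i ^ (r k + r - 1) θ i.
  differential : ℕ → Entries → Carrier
  differential k pre = sum (λ i → ⟦ coefficient k pre i ⟧ * Ω.θ i)

  -- A new factor t - y u gives the case `suc k` minus `y u` times the case `k`, so the induction
  -- runs over all `k` at once.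
  differential∈ : ∀ pre k → SI (differential k pre)
  differential∈ [] k = Ω.resp (sum-cong-≋ λ i → *-congʳ (sym (trans
      (*-congˡ (trans (*-identityʳ _) (^ᴾ-assocʳ (x i) r k)))
      (trans (sym (^ᴾ-homo-* (x i) (r ∸ 1) (r ℕ.* k))) (reflexive (≡.trans (≡.cong (λ m → ⟦ x i ^ᴾ m ⟧) (ℕ.+-comm (r ∸ 1) (r ℕ.* k))) (⟦^⟧ (x i) (r ℕ.* k ℕ.+ (r ∸ 1)))))))))
    (differential∈SI k)
  differential∈ ((u , free)      ∷ pre) k = Ω.resp (sym (begin
      sum (λ i → ⟦ coefficient k ((u , free) ∷ pre) i ⟧ * Ω.θ i)
        ≈⟨ sum-cong-≋ (λ i → trans (*-congʳ (expand i)) (trans (distribʳ _ _ _) (+-congˡ (*-assoc _ _ _)))) ⟩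
      sum (λ i → ⟦ coefficient (suc k) pre i ⟧ * Ω.θ i + ⟦ ⊝ y u ⟧ * (⟦ coefficient k pre i ⟧ * Ω.θ i))
        ≈⟨ ∑-distrib-+ (λ i → ⟦ coefficient (suc k) pre i ⟧ * Ω.θ i) (λ i → ⟦ ⊝ y u ⟧ * (⟦ coefficient k pre i ⟧ * Ω.θ i)) ⟩
      differential (suc k) pre + sum (λ i → ⟦ ⊝ y u ⟧ * (⟦ coefficient k pre i ⟧ * Ω.θ i))
        ≈⟨ +-congˡ (*-distribˡ-sum ⟦ ⊝ y u ⟧ (λ i → ⟦ coefficient k pre i ⟧ * Ω.θ i)) ⟨
      differential (suc k) pre + ⟦ ⊝ y u ⟧ * differential k pre ∎))
    (Ω.addᴵ (differential∈ pre (suc k)) (Ω.mulˡ _ (differential∈ pre k)))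
    where
    open SemiringSum semiring using (∑-distrib-+)
    open IntegerSolver polyRing
    expand : ∀ i → ⟦ coefficient k ((u , free) ∷ pre) i ⟧ ≈ ⟦ coefficient (suc k) pre i ⊕ (⊝ y u ⊛ coefficient k pre i) ⟧
    expand i = solve 5 (λ a b w t v → a :* (b :* ((t :- v) :* w)) := a :* ((t :* b) :* w) :+ (:- v) :* (a :* (b :* w)))
      refl (x i ^ᴾ (r ∸ 1)) (y i ^ᴾ k) (freeRoots pre (y i)) (y i) (y u)
  differential∈ ((u , dead)      ∷ pre) k = differential∈ pre k
  differential∈ ((u , bound _ _) ∷ pre) k = differential∈ pre k

  -- Larger subsets are those with a larger sum of elements: trading an element of `J` for a later
  -- one raises it, and the full set bounds it.
  data Low (J : Subset n) : Carrier → Set (c ⊔ ℓ) where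
    ideal  : ∀ {f} → SI f → Low J f
    higher : ∀ h L → weight 0 J < weight 0 L → Low J (⟦ h ⟧ * θ-product L)
    resp   : ∀ {f g} → f ≈ g → Low J f → Low J g
    add    : ∀ {f g} → Low J f → Low J g → Low J (f + g)

  low-* : ∀ {J} p {f} → Low J f → Low J (⟦ p ⟧ * f)
  low-* p (ideal s)      = ideal (Ω.mulˡ _ s)
  low-* p (higher h L w) = resp (*-assoc _ _ _) (higher (p ⊛ h) L w)
  low-* p (resp e l)     = resp (*-congˡ e) (low-* p l)
  low-* p (add l l′)     = resp (sym (distribˡ _ _ _)) (add (low-* p l) (low-* p l′))

  low-neg : ∀ {J f} → Low J f → Low J (- f)
  low-neg l = resp (trans (sym (-‿distribˡ-* _ _)) (-‿cong (*-identityˡ _))) (low-* (⊝ con K.1#) l)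

  low-0 : ∀ {J} → Low J 0#
  low-0 = ideal Ω.zeroᴵ

  low-isIdeal : ∀ J → IsIdeal (λ h → Low J (⟦ h ⟧ * θ-product J))
  low-isIdeal J = record
    { resp  = λ e → resp (*-congʳ e)
    ; zero∈ = resp (sym (zeroˡ _)) low-0
    ; add   = λ l l′ → resp (sym (distribʳ _ _ _)) (add l l′)
    ; mul   = λ h l → resp (sym (*-assoc _ _ _)) (low-* h l) }

  low-isolate : ∀ {J m} (f : Fin m → Carrier) j → (∀ i → i ≢ j → Low J (f i)) → Low J (sum f) → Low J (f j)
  low-isolate f zero    l s = resp
    (trans (+-assoc _ _ _) (trans (+-congˡ (-‿inverseʳ _)) (+-identityʳ _)))
    (add s (low-neg (low-sum (λ i → f (suc i)) (λ i → l (suc i) λ ()))))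
    where
    low-sum : ∀ {J m} (f : Fin m → Carrier) → (∀ i → Low J (f i)) → Low J (sum f)
    low-sum {m = zero}  f l = low-0
    low-sum {m = suc m} f l = add (l zero) (low-sum (λ i → f (suc i)) (λ i → l (suc i)))
  low-isolate f (suc j) l s = low-isolate (λ i → f (suc i)) j (λ i i≢j → l (suc i) (λ e → i≢j (Fin.suc-injective e)))
    (resp (trans (+-congʳ (+-comm _ _)) (trans (+-assoc _ _ _) (trans (+-congˡ (-‿inverseʳ _)) (+-identityʳ _))))
      (add s (low-neg (l zero λ ()))))

  ≈±-* : ∀ h {f g} → f ≈± g → h * f ≈± h * g
  ≈±-* h (inj₁ e) = inj₁ (*-congˡ e)
  ≈±-* h (inj₂ e) = inj₂ (trans (*-congˡ e) (sym (-‿distribʳ-* _ _)))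

  low-± : ∀ {J f g} → f ≈± g → Low J g → Low J f
  low-± (inj₁ e) l = resp (sym e) l
  low-± (inj₂ e) l = resp (sym e) (low-neg l)

  low-±⁻ : ∀ {J f g} → f ≈± g → Low J f → Low J g
  low-±⁻ (inj₁ e) l = resp e l
  low-±⁻ (inj₂ e) l = resp (trans (-‿cong e) (⁻¹-involutive _)) (low-neg l)

  -- Multiplying by θ-product (J - j) isolates the terms of the differential
  -- with index j and with free indices after j.
  bound-low : ∀ J j pre → lookup J j ≡ inside →
              (∀ i → i ≢ j → lookup J i ≡ outside → freeRoots pre (y i) P.≈ P.0# ⊎ j <ᶠ i) →
              Low J (⟦ x j ^ᴾ (r ∸ 1) ⊛ freeRoots pre (y j) ⟧ * θ-product J)
  bound-low J j pre j∈J later = low-±⁻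
      (≡.subst (λ L → f j ≈± ⟦ x j ^ᴾ (r ∸ 1) ⊛ freeRoots pre (y j) ⟧ * θ-product L) J′+j
        (sign-trans (trans (*-assoc _ _ _) (*-congʳ (*-congˡ (*-identityˡ _)))) (≈±-* _ (wedge-outside J′ j (Vec.lookup∘updateAt j J)))))
      (low-isolate f j other (resp (*-distribʳ-sum (θ-product J′) (λ i → ⟦ coefficient 0 pre i ⟧ * Ω.θ i)) (ideal (Ω.mulʳ _ (differential∈ pre 0)))))
    where
    J′ : Subset n
    J′ = J [ j ]≔ outside
    f : Fin n → Carrier
    f i = ⟦ coefficient 0 pre i ⟧ * Ω.θ i * θ-product J′
    sign-trans : ∀ {f g h} → f ≈ g → g ≈± h → f ≈± h
    sign-trans e (inj₁ e′) = inj₁ (trans e e′)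
    sign-trans e (inj₂ e′) = inj₂ (trans e e′)
    J′+j : J′ [ j ]≔ inside ≡ J
    J′+j = ≡.trans (Vec.[]≔-idempotent J j) (≡.trans (≡.cong (J [ j ]≔_) (≡.sym j∈J)) (Vec.[]≔-lookup J j))
    weight-J : weight 0 J ≡ toℕ j ℕ.+ weight 0 J′
    weight-J = ≡.trans (≡.cong (weight 0) (≡.sym J′+j)) (weight-insert 0 J′ j (Vec.lookup∘updateAt j J))
    other : ∀ i → i ≢ j → Low J (f i)
    other i i≢j = go (lookup J i) ≡.refl
      where
      same : ∀ {b} → lookup J i ≡ b → lookup J′ i ≡ b
      same e = ≡.trans (Vec.lookup∘updateAt′ i j i≢j J) e
      go : ∀ b → lookup J i ≡ b → Low J (f i)
      go inside  e = resp (sym (trans (*-assoc _ _ _) (trans (*-congˡ (wedge-inside J′ i (same e))) (zeroʳ _)))) low-0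
      go outside e with later i i≢j e
      ... | inj₁ z = resp (sym (trans (*-congʳ (trans (*-congʳ (trans (*-congˡ (trans (*-congˡ z) (zeroʳ _))) (zeroʳ _))) (zeroˡ _))) (zeroˡ _))) low-0
      ... | inj₂ j<i = low-± (sign-trans (*-assoc _ _ _) (≈±-* _ (wedge-outside J′ i (same e))))
        (higher (coefficient 0 pre i) (J′ [ i ]≔ inside) (≡.subst₂ _<_ (≡.sym weight-J) (≡.sym (weight-insert 0 J′ i (same e)))
          (ℕ.+-monoˡ-< (weight 0 J′) j<i)))

  private
    freeRoots-vanish : ∀ J ρ {i} → i ∈ ρ → lookup J i ≡ outside → freeRoots (entries J ρ) (y i) P.≈ P.0#
    freeRoots-vanish J (i ∷ ρ) (here ≡.refl) e rewrite e = trans (*-congʳ (-‿inverseʳ _)) (zeroˡ _)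
    freeRoots-vanish J (j ∷ ρ) (there m) e with lookup J j
    ... | inside  = freeRoots-vanish J ρ m e
    ... | outside = trans (*-congˡ (freeRoots-vanish J ρ m e)) (zeroʳ _)

    -- The second hypothesis on `ρ` makes it an initial segment: an index missing from it lies after
    -- all of it. A free index other than `j` is thus a root of `freeRoots` or later than `j`, as
    -- `bound-low` demands.
    preGens : ∀ J ρ → AllPairs (λ i j → j <ᶠ i) ρ → (∀ i → i ∈ ρ ⊎ All (_<ᶠ i) ρ) →
              SP.PreGens (λ h → Low J (⟦ h ⟧ * θ-product J)) (entries J ρ)
    preGens J []      s       h = _
    preGens J (j ∷ ρ) (j> ∷ s) h with lookup J j in eq
    ... | outside = preGens J ρ s (step j> h)
      where
      step : All (_<ᶠ j) ρ → (∀ i → i ∈ j ∷ ρ ⊎ All (_<ᶠ i) (j ∷ ρ)) → ∀ i → i ∈ ρ ⊎ All (_<ᶠ i) ρ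
      step a h i with h i
      ... | inj₁ (here ≡.refl) = inj₂ a
      ... | inj₁ (there m)     = inj₁ m
      ... | inj₂ (_ ∷ a′)      = inj₂ a′
    ... | inside  = bound-low J j (entries J ρ) eq later , preGens J ρ s step
      where
      later : ∀ i → i ≢ j → lookup J i ≡ outside → freeRoots (entries J ρ) (y i) P.≈ P.0# ⊎ j <ᶠ i
      later i i≢j e with h i
      ... | inj₁ (here i≡j) = contradiction i≡j i≢j
      ... | inj₁ (there m)  = inj₁ (freeRoots-vanish J ρ m e)
      ... | inj₂ (j<i ∷ _)  = inj₂ j<i
      step : ∀ i → i ∈ ρ ⊎ All (_<ᶠ i) ρ
      step i with h i
      ... | inj₁ (here ≡.refl) = inj₂ j>
      ... | inj₁ (there m)     = inj₁ m
      ... | inj₂ (_ ∷ a′)      = inj₂ a′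

    ∑-descending : ∀ {m} (f : Fin m → Poly) Q → ⟦ ∑ (map f (descending m)) Q ⟧ ≈ sum (λ i → ⟦ Q (f i) ⟧)
    ∑-descending {zero}  f Q = refl
    ∑-descending {suc m} f Q = begin
      ⟦ ∑ (map f (map suc (descending m) ++ zero ∷ [])) Q ⟧          ≡⟨ ≡.cong (λ l → ⟦ ∑ l Q ⟧) (map-++ f (map suc (descending m)) (zero ∷ [])) ⟩
      ⟦ ∑ (map f (map suc (descending m)) ++ f zero ∷ []) Q ⟧        ≈⟨ ∑-insert (map f (map suc (descending m))) [] Q ⟩
      ⟦ Q (f zero) ⟧ + ⟦ ∑ (map f (map suc (descending m)) ++ []) Q ⟧ ≈⟨ +-congˡ (trans (SymmetricFunctions.∑-++ polyRing (map f (map suc (descending m))) [] Q) (+-identityʳ _)) ⟩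
      ⟦ Q (f zero) ⟧ + ⟦ ∑ (map f (map suc (descending m))) Q ⟧      ≡⟨ ≡.cong (λ l → ⟦ Q (f zero) ⟧ + ⟦ ∑ l Q ⟧) (map-∘ (descending m)) ⟨
      ⟦ Q (f zero) ⟧ + ⟦ ∑ (map (λ i → f (suc i)) (descending m)) Q ⟧ ≈⟨ +-congˡ (∑-descending (λ i → f (suc i)) Q) ⟩
      sum (λ i → ⟦ Q (f i) ⟧) ∎

  powerSum∈ : ∀ k → SI ⟦ ∑ (map y (descending n)) (λ t → t ^ᴾ suc k) ⟧
  powerSum∈ k = Ω.resp (sym (trans (∑-descending y _) (sum-cong-≋ λ i →
      trans (^ᴾ-assocʳ (x i) r (suc k)) (reflexive (⟦^⟧ (x i) (r ℕ.* suc k)))))) (powerSum∈SI k)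

  gens : ∀ J → SP.FullGens (λ h → Low J (⟦ h ⟧ * θ-product J)) (entries J (descending n)) []
  gens J = record
    { preGens = preGens J (descending n) (descending-sorted n) (λ i → inj₁ (descending-complete i))
    ; sufGens = _
    ; sums = λ k → ideal (Ω.mulʳ _ (Ω.resp (sym (trans (SymmetricFunctions.∑-++ polyRing (active (entries J (descending n))) [] _)
        (trans (+-identityʳ _) (reflexive (≡.cong (λ l → ⟦ ∑ l (λ t → t ^ᴾ suc k) ⟧) (active-entries J (descending n))))))) (powerSum∈ k)))
    ; tails = λ k → IsIdeal.zero∈ (low-isIdeal J) }

  places-entries : ∀ J ρ → places (entries J ρ) ≡ ρ
  places-entries J []      = ≡.refl
  places-entries J (i ∷ ρ) = ≡.cong (i ∷_) (places-entries J ρ)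

  tree : ∀ J → Full (entries J (descending n)) []
  tree J = full (entries J (descending n)) [] (≡.cong (_ʳ++ []) (places-entries J (descending n)))

  reduce : ∀ J h → ∃[ g ] SP.Span (Box (entries J (descending n)) []) g × Low J (⟦ h P.- g ⟧ * θ-product J)
  reduce J = SP.reduce 1≤r ascending-complete (invert invertᴷ) (c ⊔ ℓ)
      (λ h → Ω.constantTerm ⟦ h ⟧ , λ I x∈ → augmentation I x∈ h) (tree J) (low-isIdeal J) (gens J)

  module C = Combinations (Ω.SR r ζ) (≡-dec (Vec.≡-dec Bool._≟_) (Vec.≡-dec ℕ._≟_)) Ω.monomial (𝒜 n r)

  private
    -- Accumulator form: `C.spanned-add` adds one basis term at a time, and closure under sums
    -- becomes composition.
    Absorbed : Carrier → Set _
    Absorbed v = ∀ w → C.Spanned w → C.Spanned (v + w)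

    ≈⇒≈ᴹ : ∀ {f g} → f ≈ g → SI (f - g)
    ≈⇒≈ᴹ e = Ω.resp (sym (trans (+-congʳ e) (-‿inverseʳ _))) Ω.zeroᴵ

    absorbed-resp : ∀ {f g} → f ≈ g → Absorbed f → Absorbed g
    absorbed-resp e a w s = C.spanned-resp (≈⇒≈ᴹ (+-congʳ (sym e))) (a w s)

    absorbed-add : ∀ {f g} → Absorbed f → Absorbed g → Absorbed (f + g)
    absorbed-add a b w s = C.spanned-resp (≈⇒≈ᴹ (+-assoc _ _ _)) (a _ (b w s))

    absorbed-SI : ∀ {f} → SI f → Absorbed f
    absorbed-SI {f} i w s = C.spanned-resp (Ω.resp (sym (trans (+-assoc _ _ _) (trans (+-congˡ (-‿inverseʳ _)) (+-identityʳ _)))) i) s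

    absorbed-0 : Absorbed 0#
    absorbed-0 = absorbed-SI Ω.zeroᴵ

    absorbed-span : ∀ J {g} → SP.Span (Box (entries J (descending n)) []) g → Absorbed (⟦ g ⟧ * θ-product J)
    absorbed-span J (SP.nil e) = absorbed-resp (sym (trans (*-congʳ e) (zeroˡ _))) absorbed-0
    absorbed-span J (SP.cons k {a} {g} b s e) w t = C.spanned-resp
      (≈⇒≈ᴹ (trans (+-congʳ (trans (*-congʳ e) (trans (distribʳ _ _ _)
          (+-congʳ (trans (*-assoc _ _ _) (*-congˡ (*-congʳ (reflexive (⟦monomial⟧ a)))))))))
        (+-assoc _ _ _)))
      (C.spanned-add k {J , a} (box⇒staircase {J} {a} b) (absorbed-span J s w t))

    -- `f` is fuel: it bounds the distance to the weight of the full set, and each passage to a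
    -- higher `L` consumes some of it.
    absorbed-term : ∀ f J → weight 0 (replicate n inside) ≤ weight 0 J ℕ.+ f → ∀ h → Absorbed (⟦ h ⟧ * θ-product J)
    absorbed-term f J p h with reduce J h
    ... | g , s , l = absorbed-resp (trans (sym (distribʳ _ _ _)) (*-congʳ
        (trans (+-comm _ _) (trans (+-assoc _ _ _) (trans (+-congˡ (-‿inverseˡ _)) (+-identityʳ _))))))
      (absorbed-add (absorbed-span J s) (absorbed-low l))
      where
      climb : ∀ f L → weight 0 (replicate n inside) ≤ weight 0 J ℕ.+ f → weight 0 J < weight 0 L → ∀ h → Absorbed (⟦ h ⟧ * θ-product L)
      climb zero    L p q = contradiction (ℕ.<-≤-trans q (ℕ.≤-trans (weight-bounded 0 L) (≡.subst (_ ≤_) (ℕ.+-identityʳ _) p))) (ℕ.<-irrefl ≡.refl)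
      climb (suc f) L p q = absorbed-term f L (ℕ.≤-trans p (≡.subst (_≤ weight 0 L ℕ.+ f) (≡.sym (ℕ.+-suc _ f)) (ℕ.+-monoˡ-≤ f q)))
      absorbed-low : ∀ {v} → Low J v → Absorbed v
      absorbed-low (ideal s)      = absorbed-SI s
      absorbed-low (higher h L q) = climb f L p q h
      absorbed-low (resp e l)     = absorbed-resp e (absorbed-low l)
      absorbed-low (add l l′)     = absorbed-add (absorbed-low l) (absorbed-low l′)

    absorbed-normal : ∀ {f} → Normal f → Absorbed f
    absorbed-normal (resp e s) = absorbed-resp e (absorbed-normal s)
    absorbed-normal zero∈      = absorbed-0
    absorbed-normal (add s t)  = absorbed-add (absorbed-normal s) (absorbed-normal t)
    absorbed-normal (term h J) = absorbed-term _ J (ℕ.m≤n+m _ (weight 0 J)) h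

  spanned : ∀ f → C.Spanned f
  spanned f = C.spanned-resp (≈⇒≈ᴹ (sym (+-identityʳ f))) (absorbed-normal (normal f) 0# C.spanned-0)

-- The alternating functional

-- The dual of the polynomial ring: x i acts on functions of the exponents as
-- the transpose of multiplication by x i, and θ i acts by 0.
module Functionals {c ℓ : Level} (K : CommutativeRing c ℓ) (n : ℕ) where

  private
    module Ω = Superspace K n
  open CommutativeRing K hiding (zero)
  open RingProperties ring using (-‿distribʳ-*)
  open AbelianGroupProperties +-abelianGroup using (⁻¹-∙-comm; ε⁻¹≈ε)
  open CommutativeSemigroupProperties +-commutativeSemigroup using (interchange)
  open CommutativeSemigroupProperties *-commutativeSemigroup using (x∙yz≈y∙xz)
  open Polynomials K n using (Poly; ⟦_⟧; central; polyRing)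
  open Ideals polyRing using (IsIdeal)

  Functional : Set c
  Functional = Vec ℕ n → Carrier

  infix 4 _≗_
  _≗_ : Functional → Functional → Set ℓ
  χ ≗ ψ = ∀ α → χ α ≈ ψ α

  apply : Ω.Ω → Functional → Functional
  apply (Ω.con a) χ α = a * χ α
  apply (Ω.x i)   χ α = χ (updateAt α i suc)
  apply (Ω.θ i)   χ α = 0#
  apply (f Ω.+ g) χ α = apply f χ α + apply g χ α
  apply (f Ω.* g) χ   = apply f (apply g χ)
  apply (Ω.- f)   χ α = - apply f χ α

  apply-cong : ∀ f {χ ψ} → χ ≗ ψ → apply f χ ≗ apply f ψ
  apply-cong (Ω.con a) e α = *-congˡ (e α)
  apply-cong (Ω.x i)   e α = e _
  apply-cong (Ω.θ i)   e α = refl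
  apply-cong (f Ω.+ g) e α = +-cong (apply-cong f e α) (apply-cong g e α)
  apply-cong (f Ω.* g) e α = apply-cong f (apply-cong g e) α
  apply-cong (Ω.- f)   e α = -‿cong (apply-cong f e α)

  apply-+ : ∀ f χ ψ → apply f (λ α → χ α + ψ α) ≗ λ α → apply f χ α + apply f ψ α
  apply-+ (Ω.con a) χ ψ α = distribˡ _ _ _
  apply-+ (Ω.x i)   χ ψ α = refl
  apply-+ (Ω.θ i)   χ ψ α = sym (+-identityˡ _)
  apply-+ (f Ω.+ g) χ ψ α = trans (+-cong (apply-+ f χ ψ α) (apply-+ g χ ψ α)) (interchange _ _ _ _)
  apply-+ (f Ω.* g) χ ψ α = trans (apply-cong f (apply-+ g χ ψ) α) (apply-+ f _ _ α)
  apply-+ (Ω.- f)   χ ψ α = trans (-‿cong (apply-+ f χ ψ α)) (sym (⁻¹-∙-comm _ _))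

  apply-* : ∀ f k χ → apply f (λ α → k * χ α) ≗ λ α → k * apply f χ α
  apply-* (Ω.con a) k χ α = x∙yz≈y∙xz _ _ _
  apply-* (Ω.x i)   k χ α = refl
  apply-* (Ω.θ i)   k χ α = sym (zeroʳ _)
  apply-* (f Ω.+ g) k χ α = trans (+-cong (apply-* f k χ α) (apply-* g k χ α)) (sym (distribˡ _ _ _))
  apply-* (f Ω.* g) k χ α = trans (apply-cong f (apply-* g k χ) α) (apply-* f k _ α)
  apply-* (Ω.- f)   k χ α = trans (-‿cong (apply-* f k χ α)) (-‿distribʳ-* _ _)

  apply-0 : ∀ f {χ} → (∀ α → χ α ≈ 0#) → ∀ α → apply f χ α ≈ 0#
  apply-0 f {χ} e α = trans (apply-cong f (λ α → trans (e α) (sym (zeroˡ (χ α)))) α)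
    (trans (apply-* f 0# χ α) (zeroˡ _))

  increment-comm : ∀ i j (α : Vec ℕ n) → updateAt (updateAt α i suc) j suc ≡ updateAt (updateAt α j suc) i suc
  increment-comm i j α with i Fin.≟ j
  ... | yes ≡.refl = ≡.refl
  ... | no i≢j     = Vec.updateAt-commutes j i (λ e → i≢j (≡.sym e)) α

  -- Functionals are a model of the presentation. Equality in Ω is inductively generated, so
  -- conclusions about scalars have to be drawn through such a model.
  sound : ∀ {f g} → f Ω.≈ g → ∀ χ → apply f χ ≗ apply g χ
  sound Ω.refl                χ α = refl
  sound (Ω.sym e)             χ α = sym (sound e χ α)
  sound (Ω.trans e e′)        χ α = trans (sound e χ α) (sound e′ χ α)
  sound (Ω.con-cong e)        χ α = *-congʳ e
  sound (Ω.+-cong e e′)       χ α = +-cong (sound e χ α) (sound e′ χ α)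
  sound (Ω.*-cong {f′ = f} e e′) χ α = trans (sound e _ α) (apply-cong f (sound e′ χ) α)
  sound (Ω.neg-cong e)        χ α = -‿cong (sound e χ α)
  sound (Ω.+-assoc f g h)     χ α = +-assoc _ _ _
  sound (Ω.+-comm f g)        χ α = +-comm _ _
  sound (Ω.+-identityˡ f)     χ α = trans (+-congʳ (zeroˡ _)) (+-identityˡ _)
  sound (Ω.+-inverseˡ f)      χ α = trans (-‿inverseˡ _) (sym (zeroˡ _))
  sound (Ω.*-assoc f g h)     χ α = refl
  sound (Ω.*-identityˡ f)     χ α = *-identityˡ _
  sound (Ω.distribˡ f g h)    χ α = apply-+ f _ _ α
  sound (Ω.distribʳ f g h)    χ α = refl
  sound (Ω.con-+ a b)         χ α = distribʳ _ _ _
  sound (Ω.con-* a b)         χ α = *-assoc _ _ _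
  sound (Ω.con-central a f)   χ α = sym (apply-* f a χ α)
  sound (Ω.xx-comm i j)       χ α = reflexive (≡.cong χ (increment-comm i j α))
  sound (Ω.xθ-comm i j)       χ α = refl
  sound (Ω.θθ-anticomm i j)   χ α = sym ε⁻¹≈ε

  apply-central : ∀ p f χ → apply ⟦ p ⟧ (apply f χ) ≗ apply f (apply ⟦ p ⟧ χ)
  apply-central p f = sound (central p f)

  Annihilator : Functional → Poly → Set ℓ
  Annihilator χ p = ∀ α → apply ⟦ p ⟧ χ α ≈ 0#

  annihilator-isIdeal : ∀ χ → IsIdeal (Annihilator χ)
  annihilator-isIdeal χ = record
    { resp  = λ e p α → trans (sym (sound e χ α)) (p α)
    ; zero∈ = λ α → zeroˡ _
    ; add   = λ p q α → trans (+-cong (p α) (q α)) (+-identityˡ _)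
    ; mul   = λ h p → apply-0 ⟦ h ⟧ p }

  permute : Permutation′ n → Vec ℕ n → Vec ℕ n
  permute w α = tabulate (λ i → lookup α (w ⟨$⟩ʳ i))

  permute-increment : ∀ w i α → permute w (updateAt α (w ⟨$⟩ʳ i) suc) ≡ updateAt (permute w α) i suc
  permute-increment w i α = ≡.trans (Vec.tabulate-cong go) (Vec.tabulate∘lookup _)
    where
    go : ∀ j → lookup (updateAt α (w ⟨$⟩ʳ i) suc) (w ⟨$⟩ʳ j) ≡ lookup (updateAt (permute w α) i suc) j
    go j with j Fin.≟ i
    ... | yes ≡.refl = ≡.trans (Vec.lookup∘updateAt (w ⟨$⟩ʳ j) α)
      (≡.sym (≡.trans (Vec.lookup∘updateAt j (permute w α)) (≡.cong suc (Vec.lookup∘tabulate _ j))))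
    ... | no j≢i = ≡.trans (Vec.lookup∘updateAt′ (w ⟨$⟩ʳ j) (w ⟨$⟩ʳ i)
        (λ e → j≢i (≡.trans (≡.sym (inverseˡ w)) (≡.trans (≡.cong (w ⟨$⟩ˡ_) e) (inverseˡ w)))) α)
      (≡.sym (≡.trans (Vec.lookup∘updateAt′ j i j≢i (permute w α)) (Vec.lookup∘tabulate _ j)))


  -- Each `x i` evaluates the functional in a higher degree, where it is 0, so only the constant
  -- term of `f` is felt.
  apply-constant : ∀ d f {χ} → (∀ α → d < Vec.sum α → χ α ≈ 0#) → ∀ α → d ≤ Vec.sum α → apply f χ α ≈ Ω.constantTerm f * χ α
  apply-constant d (Ω.con a) z α p = refl
  apply-constant d (Ω.x i)   z α p = trans (z _ (≡.subst (d <_) (≡.sym (sum-increment i α)) (s≤s p))) (sym (zeroˡ _))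
    where
    sum-increment : ∀ {m} (i : Fin m) α → Vec.sum (updateAt α i suc) ≡ suc (Vec.sum α)
    sum-increment zero    (k ∷ α) = ≡.refl
    sum-increment (suc i) (k ∷ α) = ≡.trans (≡.cong (k ℕ.+_) (sum-increment i α)) (ℕ.+-suc k (Vec.sum α))
  apply-constant d (Ω.θ i)   z α p = sym (zeroˡ _)
  apply-constant d (f Ω.+ g) z α p = trans (+-cong (apply-constant d f z α p) (apply-constant d g z α p)) (sym (distribʳ _ _ _))
  apply-constant d (f Ω.* g) z α p = trans
    (apply-constant d f (λ β q → trans (apply-constant d g z β (ℕ.<⇒≤ q)) (trans (*-congˡ (z β q)) (zeroʳ _))) α p)
    (trans (*-congˡ (apply-constant d g z α p)) (sym (*-assoc _ _ _)))
  apply-constant d (Ω.- f)   z α p = trans (-‿cong (apply-constant d f z α p)) (RingProperties.-‿distribˡ-* ring _ _)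

-- Least size of an exponent vector with distinct entries, and transpositions

unique-split : ∀ {a} {A : Set a} (P : List A) {i Q} → Unique (P ++ i ∷ Q) → i ∉ P × i ∉ Q × Unique (P ++ Q)
unique-split []      (i∉ ∷ u) = (λ ()) , All.All¬⇒¬Any i∉ , u
unique-split (p ∷ P) {i} {Q} (p∉ ∷ u) with unique-split P u
... | i∉P , i∉Q , v =
  (λ { (here i≡p) → All.lookup p∉ (∈-++⁺ʳ P (here ≡.refl)) (≡.sym i≡p) ; (there m) → i∉P m }) , i∉Q ,
  All.tabulate (λ m → All.lookup p∉ (weaken m)) ∷ v
  where
  weaken : ∀ {j} → j ∈ P ++ Q → j ∈ P ++ i ∷ Q
  weaken m with ∈-++⁻ P m
  ... | inj₁ m′ = ∈-++⁺ˡ m′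
  ... | inj₂ m′ = ∈-++⁺ʳ P (there m′)

triangle : ℕ → ℕ
triangle zero    = 0
triangle (suc m) = m ℕ.+ triangle m

triangle-double : ∀ m → triangle m ℕ.+ m ℕ.+ triangle m ≡ m ℕ.* m
triangle-double zero    = ≡.refl
triangle-double (suc m) = begin
  (m ℕ.+ t) ℕ.+ suc m ℕ.+ (m ℕ.+ t)     ≡⟨ solve 2 (λ m t → (m :+ t) :+ (con 1 :+ m) :+ (m :+ t) := con 1 :+ (m :+ (m :+ (t :+ m :+ t)))) ≡.refl m t ⟩
  suc (m ℕ.+ (m ℕ.+ (t ℕ.+ m ℕ.+ t)))   ≡⟨ ≡.cong (λ k → suc (m ℕ.+ (m ℕ.+ k))) (triangle-double m) ⟩
  suc (m ℕ.+ (m ℕ.+ m ℕ.* m))           ≡⟨ ≡.cong (λ k → suc (m ℕ.+ k)) (ℕ.*-suc m m) ⟨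
  suc m ℕ.* suc m                       ∎
  where
  open ≡.≡-Reasoning
  open import Data.Nat.Solver using (module +-*-Solver)
  open +-*-Solver
  t = triangle m

private
  sum-insert : ∀ P i Q → ListAction.sum (P ++ i ∷ Q) ≡ i ℕ.+ ListAction.sum (P ++ Q)
  sum-insert []      i Q = ≡.refl
  sum-insert (p ∷ P) i Q = ≡.trans (≡.cong (p ℕ.+_) (sum-insert P i Q))
    (≡.trans (≡.sym (ℕ.+-assoc p i _)) (≡.trans (≡.cong (ℕ._+ ListAction.sum (P ++ Q)) (ℕ.+-comm p i)) (ℕ.+-assoc i p _)))

  length-insert : ∀ (P : List ℕ) i Q → length (P ++ i ∷ Q) ≡ suc (length (P ++ Q))
  length-insert []      i Q = ≡.refl
  length-insert (p ∷ P) i Q = ≡.cong suc (length-insert P i Q)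

  -- Induction on the strict upper bound. If `N` occurs, at most `N` other entries remain, so
  -- removing `N` pays for one step of `triangle`.
  bounded-sum : ∀ N L → Unique L → (∀ {i} → i ∈ L → i < N) → length L ≤ N × triangle (length L) ≤ ListAction.sum L
  bounded-sum zero    []      u b = z≤n , z≤n
  bounded-sum zero    (i ∷ L) u b with b (here ≡.refl)
  ... | ()
  bounded-sum (suc N) L u b with DecMembership._∈?_ ℕ._≟_ N L
  ... | no N∉ = let p , q = bounded-sum N L u (λ m → ℕ.≤∧≢⇒< (ℕ.≤-pred (b m)) λ { ≡.refl → N∉ m }) in ℕ.m≤n⇒m≤1+n p , q
  ... | yes N∈ with ∈-∃++ N∈
  ...   | P , Q , ≡.refl with unique-split P u
  ...     | N∉P , N∉Q , v with bounded-sum N (P ++ Q) v (λ {i} m → below (∈-++⁻ P m))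
    where
    below : ∀ {i} → i ∈ P ⊎ i ∈ Q → i < N
    below (inj₁ m) = ℕ.≤∧≢⇒< (ℕ.≤-pred (b (∈-++⁺ˡ m))) λ { ≡.refl → N∉P m }
    below (inj₂ m) = ℕ.≤∧≢⇒< (ℕ.≤-pred (b (∈-++⁺ʳ P (there m)))) λ { ≡.refl → N∉Q m }
  ...       | p , q = ≡.subst (_≤ suc N) (≡.sym (length-insert P N Q)) (s≤s p) ,
    ≡.subst₂ (λ l s → triangle l ≤ s) (≡.sym (length-insert P N Q)) (≡.sym (sum-insert P N Q)) (ℕ.+-mono-≤ p q)

unique-sum : ∀ L → Unique L → triangle (length L) ≤ ListAction.sum L
unique-sum L u = proj₂ (bounded-sum (suc (ListAction.sum L)) L u (λ m → s≤s (∈-sum L m)))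
  where
  ∈-sum : ∀ L {i} → i ∈ L → i ≤ ListAction.sum L
  ∈-sum (j ∷ L) (here ≡.refl) = ℕ.m≤m+n j (ListAction.sum L)
  ∈-sum (j ∷ L) (there m)     = ℕ.≤-trans (∈-sum L m) (ℕ.m≤n+m (ListAction.sum L) j)

-- Here α i + 1 = r (q i + 1) with distinct `q i`, whose sum is at least `triangle m`.
large-size : ∀ {m} r .{{_ : NonZero r}} (α : Vec ℕ m) → (∀ i → suc (lookup α i) % r ≡ 0) →
             (∀ {i j} → lookup α i ≡ lookup α j → i ≡ j) → r ℕ.* (triangle m ℕ.+ m) ≤ Vec.sum α ℕ.+ m
large-size {m} r α d inj = ≡.subst (r ℕ.* (triangle m ℕ.+ m) ≤_) (≡.sym (total α q suc-q))
  (ℕ.*-monoʳ-≤ r (ℕ.+-monoˡ-≤ m (≡.subst (λ l → triangle l ≤ ListAction.sum (List.tabulate q)) (length-tabulate q)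
    (unique-sum (List.tabulate q) (Unique.tabulate⁺ (λ {i} {j} e → inj (ℕ.suc-injective (≡.trans (suc-q i) (≡.trans (≡.cong (λ k → r ℕ.* suc k) e) (≡.sym (suc-q j)))))))))))
  where
  q : Fin m → ℕ
  q i = ℕ.pred (suc (lookup α i) / r)
  suc-q : ∀ i → suc (lookup α i) ≡ r ℕ.* suc (q i)
  suc-q i = ≡.trans eq (≡.trans (ℕ.*-comm (suc (lookup α i) / r) r) (≡.cong (r ℕ.*_) (positive (suc (lookup α i) / r) eq)))
    where
    eq : suc (lookup α i) ≡ suc (lookup α i) / r ℕ.* r
    eq = ≡.trans (m≡m%n+[m/n]*n (suc (lookup α i)) r) (≡.cong (ℕ._+ suc (lookup α i) / r ℕ.* r) (d i))
    positive : ∀ k → suc (lookup α i) ≡ k ℕ.* r → k ≡ suc (ℕ.pred k)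
    positive (suc k) e = ≡.refl
  total : ∀ {m} (α : Vec ℕ m) (q : Fin m → ℕ) → (∀ i → suc (lookup α i) ≡ r ℕ.* suc (q i)) →
          Vec.sum α ℕ.+ m ≡ r ℕ.* (ListAction.sum (List.tabulate q) ℕ.+ m)
  total []                q e = ≡.sym (ℕ.*-zeroʳ r)
  total {suc m} (a ∷ α)   q e = begin
    a ℕ.+ Vec.sum α ℕ.+ suc m                      ≡⟨ solve 3 (λ a s m → a :+ s :+ (con 1 :+ m) := (con 1 :+ a) :+ (s :+ m)) ≡.refl a (Vec.sum α) m ⟩
    suc a ℕ.+ (Vec.sum α ℕ.+ m)                    ≡⟨ ≡.cong₂ ℕ._+_ (e zero) (total α (λ i → q (suc i)) (λ i → e (suc i))) ⟩
    r ℕ.* suc (q zero) ℕ.+ r ℕ.* (S ℕ.+ m)         ≡⟨ solve 4 (λ r q s m → r :* (con 1 :+ q) :+ r :* (s :+ m) := r :* (q :+ s :+ (con 1 :+ m))) ≡.refl r (q zero) S m ⟩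
    r ℕ.* (q zero ℕ.+ S ℕ.+ suc m)                 ∎
    where
    open ≡.≡-Reasoning
    open import Data.Nat.Solver using (module +-*-Solver)
    open +-*-Solver
    S = ListAction.sum (List.tabulate (λ i → q (suc i)))

injective-or-repeated : ∀ {m} (α : Vec ℕ m) → (∃[ i ] ∃[ j ] (i ≢ j × lookup α i ≡ lookup α j)) ⊎
                        (∀ {i j} → lookup α i ≡ lookup α j → i ≡ j)
injective-or-repeated α with Fin.any? (λ i → Fin.any? (λ j → ¬? (i Fin.≟ j) ×-dec (lookup α i ℕ.≟ lookup α j)))
... | yes (i , j , p) = inj₁ (i , j , p)
... | no ¬p = inj₂ λ {i} {j} e → go i j e (i Fin.≟ j)
  where
  go : ∀ i j → lookup α i ≡ lookup α j → Dec (i ≡ j) → i ≡ j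
  go i j e (yes p) = p
  go i j e (no q)  = contradiction (i , j , q , e) ¬p

record Swaps {n : ℕ} (i j : Fin n) (w : Fin n → Fin n) : Set where
  field
    swapˡ : w i ≡ j
    swapʳ : w j ≡ i
    fixes : ∀ {k} → k ≢ i → k ≢ j → w k ≡ k

-- `i` and `j` may occur in either order; `s` and `t` name them in the order of occurrence.
swap-list : ∀ {n} {i j : Fin n} {w} → Swaps i j w → i ≢ j → ∀ L → Unique L → i ∈ L → j ∈ L →
            ∃[ A ] ∃[ B ] ∃[ C ] ∃[ s ] ∃[ t ] (L ≡ A ++ s ∷ B ++ t ∷ C × map w L ≡ A ++ t ∷ B ++ s ∷ C)
swap-list {i = i} {j} {w} sw i≢j L u i∈ j∈ with ∈-∃++ i∈
... | P , Q , ≡.refl with unique-split P u | ∈-++⁻ P j∈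
...   | i∉P , i∉Q , v | inj₂ (here j≡i)  = contradiction (≡.sym j≡i) i≢j
...   | i∉P , i∉Q , v | inj₂ (there j∈Q) with ∈-∃++ j∈Q
...     | B , C , ≡.refl = P , B , C , i , j , ≡.refl , image
  where
  open Swaps sw
  v′ = unique-split (P ++ B) (≡.subst Unique (≡.sym (++-assoc P B (j ∷ C))) v)
  fix : ∀ l → (i ∉ l) → (j ∉ l) → map w l ≡ l
  fix l p q = map-id-local (All.tabulate λ {k} m → fixes (λ { ≡.refl → p m }) (λ { ≡.refl → q m }))
  image : map w (P ++ i ∷ B ++ j ∷ C) ≡ P ++ j ∷ B ++ i ∷ C
  image = ≡.trans (map-++ w P _) (≡.cong₂ _++_ (fix P i∉P (λ m → proj₁ v′ (∈-++⁺ˡ m)))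
    (≡.cong₂ _∷_ swapˡ (≡.trans (map-++ w B _) (≡.cong₂ _++_ (fix B (λ m → i∉Q (∈-++⁺ˡ m)) (λ m → proj₁ v′ (∈-++⁺ʳ P m)))
      (≡.cong₂ _∷_ swapʳ (fix C (λ m → i∉Q (∈-++⁺ʳ B (there m))) (proj₁ (proj₂ v′))))))))
swap-list {i = i} {j} {w} sw i≢j L u i∈ j∈ | P , Q , ≡.refl | i∉P , i∉Q , v | inj₁ j∈P with ∈-∃++ j∈P
... | A , B , ≡.refl = A , B , Q , j , i , ++-assoc A (j ∷ B) (i ∷ Q) , image
  where
  open Swaps sw
  v′ = unique-split A (≡.subst Unique (++-assoc A (j ∷ B) Q) v)
  fix : ∀ l → (i ∉ l) → (j ∉ l) → map w l ≡ l
  fix l p q = map-id-local (All.tabulate λ {k} m → fixes (λ { ≡.refl → p m }) (λ { ≡.refl → q m }))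
  image : map w ((A ++ j ∷ B) ++ i ∷ Q) ≡ A ++ i ∷ B ++ j ∷ Q
  image = ≡.trans (≡.cong (map w) (++-assoc A (j ∷ B) (i ∷ Q)))
    (≡.trans (map-++ w A _) (≡.cong₂ _++_ (fix A (λ m → i∉P (∈-++⁺ˡ m)) (proj₁ v′))
    (≡.cong₂ _∷_ swapʳ (≡.trans (map-++ w B _) (≡.cong₂ _++_ (fix B (λ m → i∉P (∈-++⁺ʳ A (there m))) (λ m → proj₁ (proj₂ v′) (∈-++⁺ˡ m)))
      (≡.cong₂ _∷_ swapˡ (fix Q i∉Q (λ m → proj₁ (proj₂ v′) (∈-++⁺ʳ B m)))))))))

module VandermondeSwap {c ℓ : Level} (R : CommutativeRing c ℓ) where

  open CommutativeRing R hiding (zero)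
  open IntegerSolver R
  open SymmetricFunctions R
  open SymmetricLists R

  private
    -- Each entry between `s` and `t` contributes two changes of sign, so under the swap of `s` and
    -- `t` only their own difference changes the sign of the Vandermonde product.
    exchange : ∀ B s t → monic B s * comonic B t ≈ monic B t * comonic B s
    exchange []      s t = refl
    exchange (b ∷ B) s t = trans
      (solve 5 (λ b s t m k → ((s :- b) :* m) :* ((b :- t) :* k) := ((s :- b) :* (b :- t)) :* (m :* k)) refl b s t (monic B s) (comonic B t))
      (trans (*-congˡ (exchange B s t))
        (solve 5 (λ b s t m k → ((s :- b) :* (b :- t)) :* (m :* k) := ((t :- b) :* m) :* ((b :- s) :* k)) refl b s t (monic B t) (comonic B s)))

    expand : ∀ A B C s t → vandermonde (A ++ s ∷ B ++ t ∷ C) ≈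
      (s - t) * (comonic A s * monic C s * comonic A t * monic C t) * (monic B s * comonic B t) * vandermonde (A ++ B ++ C)
    expand A B C s t = trans (vandermonde-remove A (B ++ t ∷ C)) (trans
      (*-cong (*-congˡ (monic-insert B C s)) (trans (reflexive (≡.cong vandermonde (≡.sym (++-assoc A B (t ∷ C)))))
        (trans (vandermonde-remove (A ++ B) C) (*-cong (*-congʳ (comonic-++ A B t)) (reflexive (≡.cong vandermonde (++-assoc A B C)))))))
      (trans (*-congʳ (*-congˡ (*-congˡ (monic-++ B C s))))
        (solve 8 (λ d as bs cs at bt ct v → (as :* (d :* (bs :* cs))) :* (at :* bt :* ct :* v) := d :* (as :* cs :* at :* ct) :* (bs :* bt) :* v) refl
          (s - t) (comonic A s) (monic B s) (monic C s) (comonic A t) (comonic B t) (monic C t) (vandermonde (A ++ B ++ C)))))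

  vandermonde-swap : ∀ A B C s t → vandermonde (A ++ t ∷ B ++ s ∷ C) ≈ - vandermonde (A ++ s ∷ B ++ t ∷ C)
  vandermonde-swap A B C s t = trans (expand A B C t s) (trans (*-congʳ (*-congˡ (exchange B t s)))
    (trans (solve 8 (λ s t as cs at ct e v → (t :- s) :* (at :* ct :* as :* cs) :* e :* v := :- ((s :- t) :* (as :* cs :* at :* ct) :* e :* v)) refl
      s t (comonic A s) (monic C s) (comonic A t) (monic C t) (monic B s * comonic B t) (vandermonde (A ++ B ++ C)))
    (-‿cong (sym (expand A B C s t)))))

-- The functional φ and its annihilation by invariants

module Alternant {c ℓ : Level} (K : CommutativeRing c ℓ) (n r : ℕ) (1≤r : 1 ≤ r) (ζ : CommutativeRing.Carrier K)
         (ζ^r≈1 : IsRootOfUnity K r ζ)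
         where

  private
    module Ω = Superspace K n
    module ΩRing = Ring Ω.ring
  open CommutativeRing K hiding (zero)
  open RingProperties ring using (-‿distribʳ-*)
  open Polynomials K n
  open Functionals K n
  open Exp semiring using (_^_; ^-homo-*; ^-assocʳ; ^-congˡ)
  open Exp P.semiring using () renaming (_^_ to _^ᴾ_)
  open SymmetricFunctions polyRing
  open SymmetricLists polyRing
  open InvariantSums K n r 1≤r ζ ζ^r≈1 using (act; scale; one^; act-power)
  open Ω.WreathProduct

  y : Fin n → Poly
  y i = x i ^ᴾ r

  degree : ℕ
  degree = length (ascending n)

  degree≡n : degree ≡ n
  degree≡n = ≡.trans (length-ʳ++ (descending n)) (≡.trans (ℕ.+-identityʳ _) (go n))
    where
    go : ∀ n → length (descending n) ≡ n
    go zero    = ≡.refl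
    go (suc n) = ≡.trans (length-++ (map suc (descending n))) (≡.trans (ℕ.+-comm _ 1) (≡.cong suc (≡.trans (length-map suc (descending n)) (go n))))

  corner : Vec ℕ n
  corner = replicate n (r ℕ.* degree ∸ 1)

  indicator : ∀ {a} {A : Set a} → Dec A → Carrier
  indicator (yes _) = 1#
  indicator (no _)  = 0#

  χ₀ φ : Functional
  χ₀ α = indicator (Vec.≡-dec ℕ._≟_ α corner)
  φ = apply ⟦ vandermonde (map y (ascending n)) ⟧ χ₀

  χ₀-corner : χ₀ corner ≈ 1#
  χ₀-corner with Vec.≡-dec ℕ._≟_ corner corner
  ... | yes _ = refl
  ... | no ne = contradiction ≡.refl ne

  χ₀-other : ∀ {α} → α ≢ corner → χ₀ α ≈ 0#
  χ₀-other {α} ne with Vec.≡-dec ℕ._≟_ α corner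
  ... | yes e = contradiction e ne
  ... | no _  = refl

  apply-power : ∀ i k χ α → apply ⟦ x i ^ᴾ k ⟧ χ α ≈ χ (updateAt α i (k ℕ.+_))
  apply-power i zero    χ α = trans (*-identityˡ _) (reflexive (≡.cong χ (≡.sym (Vec.updateAt-id-local i α ≡.refl))))
  apply-power i (suc k) χ α = trans (apply-power i k χ (updateAt α i suc))
    (reflexive (≡.cong χ (Vec.updateAt-updateAt-local i {f = k ℕ.+_} {g = suc} {h = suc k ℕ.+_} α (ℕ.+-suc k (lookup α i)))))

  -- Multiplication by the Vandermonde product moves through any filtration of
  -- the functionals that is shifted by r under each y i.
  module Filtration {p : Level} (F : ℕ → Functional → Set p)
                    (F-resp : ∀ {o χ ψ} → χ ≗ ψ → F o χ → F o ψ)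
                    (F-y : ∀ {o χ} i → F o χ → F (r ℕ.+ o) (apply ⟦ y i ⟧ χ))
                    (F-- : ∀ {o χ ψ} → F o χ → F o ψ → F o (λ α → χ α + - ψ α)) where

    monic-filtered : ∀ i l {o χ} → F o χ → F (length l ℕ.* r ℕ.+ o) (apply ⟦ monic (map y l) (y i) ⟧ χ)
    monic-filtered i []      h = F-resp (λ α → sym (*-identityˡ _)) h
    monic-filtered i (j ∷ l) {o} {χ} h = ≡.subst (λ m → F m (apply ⟦ monic (map y (j ∷ l)) (y i) ⟧ χ)) (≡.sym (ℕ.+-assoc r (length l ℕ.* r) o))
      (F-- (F-y i (monic-filtered i l h)) (F-y j (monic-filtered i l h)))

    vandermonde-filtered : ∀ l {o χ} → F o χ → F (r ℕ.* triangle (length l) ℕ.+ o) (apply ⟦ vandermonde (map y l) ⟧ χ)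
    vandermonde-filtered []      {o} {χ} h = ≡.subst (λ m → F (m ℕ.+ o) (apply ⟦ vandermonde [] ⟧ χ)) (≡.sym (ℕ.*-zeroʳ r)) (F-resp (λ α → sym (*-identityˡ _)) h)
    vandermonde-filtered (i ∷ l) {o} {χ} h = ≡.subst (λ m → F m (apply ⟦ vandermonde (map y (i ∷ l)) ⟧ χ))
      (≡.trans (≡.sym (ℕ.+-assoc (length l ℕ.* r) (r ℕ.* triangle (length l)) o))
        (≡.cong (ℕ._+ o) (≡.trans (≡.cong (ℕ._+ r ℕ.* triangle (length l)) (ℕ.*-comm (length l) r)) (≡.sym (ℕ.*-distribˡ-+ r (length l) (triangle (length l)))))))
      (monic-filtered i l (vandermonde-filtered l h))

  private
    sum-update : ∀ {m} (i : Fin m) k α → Vec.sum (updateAt α i (k ℕ.+_)) ≡ k ℕ.+ Vec.sum α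
    sum-update zero    k (a ∷ α) = ℕ.+-assoc k a (Vec.sum α)
    sum-update (suc i) k (a ∷ α) = ≡.trans (≡.cong (a ℕ.+_) (sum-update i k α))
      (≡.trans (≡.sym (ℕ.+-assoc a k _)) (≡.trans (≡.cong (ℕ._+ Vec.sum α) (ℕ.+-comm a k)) (ℕ.+-assoc k a _)))

    Small : ℕ → Functional → Set ℓ
    Small o χ = ∀ α → Vec.sum corner < Vec.sum α ℕ.+ o → χ α ≈ 0#

    difference-0 : ∀ {a b} → a ≈ 0# → b ≈ 0# → a + - b ≈ 0#
    difference-0 e e′ = trans (+-cong e (-‿cong e′)) (-‿inverseʳ 0#)

    module SmallF = Filtration Small
      (λ e h α p → trans (sym (e α)) (h α p))
      (λ {o} {χ} i h α p → trans (apply-power i r χ α) (h _ (≡.subst (Vec.sum corner <_)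
        (≡.trans (≡.sym (ℕ.+-assoc (Vec.sum α) r o)) (≡.cong (ℕ._+ o) (≡.trans (ℕ.+-comm (Vec.sum α) r) (≡.sym (sum-update i r α))))) p)))
      (λ h h′ α p → difference-0 (h α p) (h′ α p))

    χ₀-small : Small 0 χ₀
    χ₀-small α p = χ₀-other {α} λ { ≡.refl → ℕ.<-irrefl ≡.refl (≡.subst (Vec.sum corner <_) (ℕ.+-identityʳ _) p) }

    -- For primitive `ζ` this is support on exponents congruent to -1 modulo `r` at `j`. It is an
    -- equation because a value cannot be tested for 0. Each `y i` shifts exponents by `r`, so the
    -- condition is constant along the filtration.
    Twisted : Fin n → ℕ → Functional → Set ℓ
    Twisted j _ χ = ∀ α → ζ ^ suc (lookup α j) * χ α ≈ χ α

    shifted : ∀ j i (α : Vec ℕ n) → ζ ^ suc (lookup (updateAt α i (r ℕ.+_)) j) ≈ ζ ^ suc (lookup α j)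
    shifted j i α with j Fin.≟ i
    ... | yes ≡.refl = trans (reflexive (≡.cong (ζ ^_) (≡.trans (≡.cong suc (Vec.lookup∘updateAt j α)) (≡.sym (ℕ.+-suc r (lookup α j))))))
      (trans (^-homo-* ζ r (suc (lookup α j))) (trans (*-congʳ ζ^r≈1) (*-identityˡ _)))
    ... | no j≢i     = reflexive (≡.cong (λ m → ζ ^ suc m) (Vec.lookup∘updateAt′ j i j≢i α))

    twisted-y : ∀ j {o χ} i → Twisted j o χ → Twisted j (r ℕ.+ o) (apply ⟦ y i ⟧ χ)
    twisted-y j {o} {χ} i h α = trans (*-congˡ (apply-power i r χ α))
      (trans (trans (*-congʳ (sym (shifted j i α))) (h (updateAt α i (r ℕ.+_)))) (sym (apply-power i r χ α)))

    module TwistedF (j : Fin n) = Filtration (Twisted j)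
      (λ e h α → trans (*-congˡ (sym (e α))) (trans (h α) (e α)))
      (λ {o} {χ} → twisted-y j {o} {χ})
      (λ h h′ α → trans (distribˡ _ _ _) (+-cong (h α) (trans (sym (-‿distribʳ-* _ _)) (-‿cong (h′ α)))))

    root-power : ∀ k → ζ ^ (r ℕ.* k) ≈ 1#
    root-power k = trans (sym (^-assocʳ ζ r k)) (trans (^-congˡ k ζ^r≈1) (one^ k))

    suc-corner : Fin n → suc (r ℕ.* degree ∸ 1) ≡ r ℕ.* degree
    suc-corner i = ℕ.m+[n∸m]≡n (ℕ.*-mono-≤ 1≤r (≡.subst (1 ≤_) (≡.sym degree≡n) (positive i)))
      where
      positive : ∀ {m} → Fin m → 1 ≤ m
      positive {suc m} _ = s≤s z≤n

    χ₀-twisted : ∀ j → Twisted j 0 χ₀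
    χ₀-twisted j α with Vec.≡-dec ℕ._≟_ α corner
    ... | no _       = zeroʳ _
    ... | yes ≡.refl = trans (*-congʳ (trans (reflexive (≡.cong (ζ ^_) (≡.trans (≡.cong suc (Vec.lookup-replicate j _)) (suc-corner j)))) (root-power degree)))
      (*-identityˡ _)

  exchange : Permutation′ n → Ω.WreathProduct r
  exchange w = Ω.monomialMatrix (λ _ → fromℕ< 1≤r) w

  private
    exchange-scale : ∀ w i → scale (exchange w) i ≈ 1#
    exchange-scale w i = trans (reflexive (≡.cong (λ m → ζ ^ (r ∸ m)) (Fin.toℕ-fromℕ< 1≤r))) ζ^r≈1

  apply-exchange : ∀ w f χ α → apply (act (exchange w) f) (λ β → χ (permute w β)) α ≈ apply f χ (permute w α)
  apply-exchange w (Ω.con a) χ α = refl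
  apply-exchange w (Ω.x i)   χ α = trans (*-congʳ (exchange-scale w i)) (trans (*-identityˡ _) (reflexive (≡.cong χ (permute-increment w i α))))
  apply-exchange w (Ω.θ i)   χ α = zeroʳ _
  apply-exchange w (f Ω.+ g) χ α = +-cong (apply-exchange w f χ α) (apply-exchange w g χ α)
  apply-exchange w (f Ω.* g) χ α = trans (apply-cong (act (exchange w) f) (apply-exchange w g χ) α) (apply-exchange w f (apply g χ) α)
  apply-exchange w (Ω.- f)   χ α = -‿cong (apply-exchange w f χ α)

  -- The diagonal matrix with `ζ` at `j` and 1 elsewhere. Its exponent 1 lies in `Fin r` only if r ≥
  -- 2; for r = 1 every exponent satisfies the congruence that rotations are to enforce.
  rotate : 2 ≤ r → Fin n → Ω.WreathProduct r
  rotate 2≤r j = Ω.monomialMatrix (λ i → exponent (i Fin.≟ j)) idᵖ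
    where
    exponent : ∀ {p} {P : Set p} → Dec P → Fin r
    exponent (yes _) = fromℕ< 2≤r
    exponent (no _)  = fromℕ< 1≤r

  private
    rotate-scale : ∀ 2≤r j i (α : Vec ℕ n) → scale (rotate 2≤r j) i * ζ ^ lookup (updateAt α i suc) j ≈ ζ ^ lookup α j
    rotate-scale 2≤r j i α with i Fin.≟ j
    ... | yes ≡.refl = trans (*-congˡ (reflexive (≡.cong (ζ ^_) (Vec.lookup∘updateAt j α))))
      (trans (sym (^-homo-* ζ (r ∸ toℕ (fromℕ< 2≤r)) (suc (lookup α j))))
      (trans (reflexive (≡.cong (ζ ^_) (≡.trans (≡.cong (λ m → r ∸ m ℕ.+ suc (lookup α j)) (Fin.toℕ-fromℕ< 2≤r))
          (≡.trans (ℕ.+-suc (r ∸ 1) (lookup α j)) (≡.cong (ℕ._+ lookup α j) (ℕ.m+[n∸m]≡n 1≤r))))))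
        (trans (^-homo-* ζ r (lookup α j)) (trans (*-congʳ ζ^r≈1) (*-identityˡ _)))))
    ... | no i≢j     = trans (*-cong (trans (reflexive (≡.cong (λ m → ζ ^ (r ∸ m)) (Fin.toℕ-fromℕ< 1≤r))) ζ^r≈1)
        (reflexive (≡.cong (ζ ^_) (Vec.lookup∘updateAt′ j i (λ e → i≢j (≡.sym e)) α)))) (*-identityˡ _)

  apply-rotate : ∀ 2≤r j f χ α → apply (act (rotate 2≤r j) f) (λ β → ζ ^ lookup β j * χ β) α ≈ ζ ^ lookup α j * apply f χ α
  apply-rotate 2≤r j (Ω.con a) χ α = CommutativeSemigroupProperties.x∙yz≈y∙xz *-commutativeSemigroup _ _ _
  apply-rotate 2≤r j (Ω.x i)   χ α = trans (sym (*-assoc _ _ _)) (*-congʳ (rotate-scale 2≤r j i α))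
  apply-rotate 2≤r j (Ω.θ i)   χ α = trans (zeroʳ _) (sym (zeroʳ _))
  apply-rotate 2≤r j (f Ω.+ g) χ α = trans (+-cong (apply-rotate 2≤r j f χ α) (apply-rotate 2≤r j g χ α)) (sym (distribˡ _ _ _))
  apply-rotate 2≤r j (f Ω.* g) χ α = trans (apply-cong (act (rotate 2≤r j) f) (apply-rotate 2≤r j g χ) α) (apply-rotate 2≤r j f (apply g χ) α)
  apply-rotate 2≤r j (Ω.- f)   χ α = trans (-‿cong (apply-rotate 2≤r j f χ α)) (-‿distribʳ-* _ _)

  transpose-swaps : ∀ (i j : Fin n) → Swaps i j (transpose i j ⟨$⟩ʳ_)
  transpose-swaps i j = record { swapˡ = swapˡ ; swapʳ = swapʳ ; fixes = fixes }
    where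
    swapˡ : transpose i j ⟨$⟩ʳ i ≡ j
    swapˡ with i Fin.≟ i
    ... | yes _  = ≡.refl
    ... | no i≢i = contradiction ≡.refl i≢i
    swapʳ : transpose i j ⟨$⟩ʳ j ≡ i
    swapʳ with j Fin.≟ i
    ... | yes e = e
    ... | no _ with j Fin.≟ j
    ...   | yes _  = ≡.refl
    ...   | no j≢j = contradiction ≡.refl j≢j
    fixes : ∀ {k} → k ≢ i → k ≢ j → transpose i j ⟨$⟩ʳ k ≡ k
    fixes {k} k≢i k≢j with k Fin.≟ i
    ... | yes e = contradiction e k≢i
    ... | no _ with k Fin.≟ j
    ...   | yes e = contradiction e k≢j
    ...   | no _  = ≡.refl

  private
    act-y : ∀ w i → act (exchange w) ⟦ y i ⟧ ΩRing.≈ ⟦ y (w ⟨$⟩ʳ i) ⟧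
    act-y w i = ΩRing.trans (ΩRing.reflexive (≡.cong (act (exchange w)) (⟦^⟧ (x i) r)))
      (ΩRing.trans (act-power (exchange w) i r) (ΩRing.trans (ΩRing.*-congʳ (Ω.con-cong (trans (^-congˡ r (exchange-scale w i)) (one^ r))))
        (ΩRing.trans (ΩRing.*-identityˡ _) (ΩRing.reflexive (≡.sym (⟦^⟧ (x (w ⟨$⟩ʳ i)) r))))))

    act-monic : ∀ w i l → act (exchange w) ⟦ monic (map y l) (y i) ⟧ ΩRing.≈ ⟦ monic (map y (map (w ⟨$⟩ʳ_) l)) (y (w ⟨$⟩ʳ i)) ⟧
    act-monic w i []      = ΩRing.refl
    act-monic w i (j ∷ l) = ΩRing.*-cong (ΩRing.+-cong (act-y w i) (ΩRing.-‿cong (act-y w j))) (act-monic w i l)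

    act-vandermonde : ∀ w l → act (exchange w) ⟦ vandermonde (map y l) ⟧ ΩRing.≈ ⟦ vandermonde (map y (map (w ⟨$⟩ʳ_) l)) ⟧
    act-vandermonde w []      = ΩRing.refl
    act-vandermonde w (i ∷ l) = ΩRing.*-cong (act-monic w i l) (act-vandermonde w l)

  act-elem : ∀ w k l → act (exchange w) ⟦ elem k (map y l) ⟧ ΩRing.≈ ⟦ elem k (map y (map (w ⟨$⟩ʳ_) l)) ⟧
  act-elem w zero    l       = ΩRing.refl
  act-elem w (suc k) []      = ΩRing.refl
  act-elem w (suc k) (i ∷ l) = ΩRing.+-cong (act-elem w (suc k) l) (ΩRing.-‿cong (ΩRing.*-cong (act-y w i) (act-elem w k l)))

  act-rotate-elem : ∀ 2≤r j k l → act (rotate 2≤r j) ⟦ elem k (map y l) ⟧ ΩRing.≈ ⟦ elem k (map y l) ⟧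
  act-rotate-elem 2≤r j zero    l       = ΩRing.refl
  act-rotate-elem 2≤r j (suc k) []      = ΩRing.refl
  act-rotate-elem 2≤r j (suc k) (i ∷ l) = ΩRing.+-cong (act-rotate-elem 2≤r j (suc k) l)
    (ΩRing.-‿cong (ΩRing.*-cong act-rotate-y (act-rotate-elem 2≤r j k l)))
    where
    act-rotate-y : act (rotate 2≤r j) ⟦ y i ⟧ ΩRing.≈ ⟦ y i ⟧
    act-rotate-y = ΩRing.trans (ΩRing.reflexive (≡.cong (act (rotate 2≤r j)) (⟦^⟧ (x i) r)))
      (ΩRing.trans (act-power (rotate 2≤r j) i r) (ΩRing.trans (ΩRing.*-congʳ (Ω.con-cong
          (trans (^-assocʳ ζ (r ∸ toℕ (exponents (rotate 2≤r j) i)) r) (trans (reflexive (≡.cong (ζ ^_) (ℕ.*-comm (r ∸ toℕ (exponents (rotate 2≤r j) i)) r))) (root-power _)))))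
        (ΩRing.trans (ΩRing.*-identityˡ _) (ΩRing.reflexive (≡.sym (⟦^⟧ (x i) r))))))

  private
    permute-corner : ∀ w {α} → permute w α ≡ corner → α ≡ corner
    permute-corner w {α} e = ≡.trans (≡.sym (Vec.tabulate∘lookup α)) (≡.trans (Vec.tabulate-cong (λ i →
      ≡.trans (≡.cong (lookup α) (≡.sym (inverseʳ w {i}))) (≡.trans (≡.sym (Vec.lookup∘tabulate (λ k → lookup α (w ⟨$⟩ʳ k)) (w ⟨$⟩ˡ i)))
        (≡.trans (≡.cong (λ β → lookup β (w ⟨$⟩ˡ i)) e) (≡.trans (Vec.lookup-replicate (w ⟨$⟩ˡ i) _) (≡.sym (Vec.lookup-replicate i _))))))) (Vec.tabulate∘lookup corner))

    corner-permute : ∀ w → permute w corner ≡ corner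
    corner-permute w = ≡.trans (Vec.tabulate-cong (λ i → ≡.trans (Vec.lookup-replicate (w ⟨$⟩ʳ i) _) (≡.sym (Vec.lookup-replicate i _)))) (Vec.tabulate∘lookup corner)

    χ₀-permute : ∀ w α → χ₀ (permute w α) ≈ χ₀ α
    χ₀-permute w α with Vec.≡-dec ℕ._≟_ α corner
    ... | yes ≡.refl = trans (reflexive (≡.cong χ₀ (corner-permute w))) χ₀-corner
    ... | no ne      = χ₀-other (λ e → ne (permute-corner w e))

  located : ∀ {i j : Fin n} → i ≢ j → ∃[ A ] ∃[ B ] ∃[ C ] ∃[ s ] ∃[ t ]
            (ascending n ≡ A ++ s ∷ B ++ t ∷ C × map (transpose i j ⟨$⟩ʳ_) (ascending n) ≡ A ++ t ∷ B ++ s ∷ C)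
  located {i} {j} i≢j = swap-list (transpose-swaps i j) i≢j (ascending n) (ascending-unique n) (ascending-complete i) (ascending-complete j)

  φ-antisymmetric : ∀ {i j} → i ≢ j → ∀ α → φ (permute (transpose i j) α) ≈ - φ α
  φ-antisymmetric {i} {j} i≢j α with located i≢j
  ... | A , B , C , s , t , e , e′ = begin
    apply ⟦ V ⟧ χ₀ (permute w α)                                             ≈⟨ apply-exchange w ⟦ V ⟧ χ₀ α ⟨
    apply (act (exchange w) ⟦ V ⟧) (λ β → χ₀ (permute w β)) α                ≈⟨ apply-cong (act (exchange w) ⟦ V ⟧) (χ₀-permute w) α ⟩
    apply (act (exchange w) ⟦ V ⟧) χ₀ α                                      ≈⟨ sound (act-vandermonde w (ascending n)) χ₀ α ⟩
    apply ⟦ vandermonde (map y (map (w ⟨$⟩ʳ_) (ascending n))) ⟧ χ₀ α          ≈⟨ sound swapped χ₀ α ⟩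
    - apply ⟦ V ⟧ χ₀ α                                                       ∎
    where
    open import Relation.Binary.Reasoning.Setoid setoid
    w = transpose i j
    V = vandermonde (map y (ascending n))
    spread : ∀ (s t : Fin n) → map y (A ++ s ∷ B ++ t ∷ C) ≡ map y A ++ y s ∷ map y B ++ y t ∷ map y C
    spread s t = ≡.trans (map-++ y A _) (≡.cong (λ l → map y A ++ y s ∷ l) (map-++ y B _))
    swapped : vandermonde (map y (map (w ⟨$⟩ʳ_) (ascending n))) P.≈ P.- V
    swapped = P.trans (P.reflexive (≡.cong vandermonde (≡.trans (≡.cong (map y) e′) (spread t s))))
      (P.trans (VandermondeSwap.vandermonde-swap polyRing (map y A) (map y B) (map y C) (y s) (y t))
        (P.-‿cong (P.reflexive (≡.cong vandermonde (≡.sym (≡.trans (≡.cong (map y) e) (spread s t)))))))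

  φ-twisted : ∀ j α → ζ ^ suc (lookup α j) * φ α ≈ φ α
  φ-twisted j = TwistedF.vandermonde-filtered j (ascending n) {0} {χ₀} (χ₀-twisted j)

  φ-small : ∀ α → Vec.sum corner < Vec.sum α ℕ.+ r ℕ.* triangle n → φ α ≈ 0#
  φ-small α p = SmallF.vandermonde-filtered (ascending n) {0} {χ₀} χ₀-small α
    (≡.subst (λ m → Vec.sum corner < Vec.sum α ℕ.+ m) (≡.trans (≡.cong (λ m → r ℕ.* triangle m) (≡.sym degree≡n)) (≡.sym (ℕ.+-identityʳ _))) p)

  -- An invariant without constant term multiplies φ to an alternating
  -- functional of smaller degree, and φ has the least possible degree.
  module _ (cancel : PowersCancel K r ζ)
           (halve : NoTwoTorsion K) where

    kill : ∀ f → (∀ 2≤r j → act (rotate 2≤r j) f Ω.≈ f) → (∀ {i j} → i ≢ j → act (exchange (transpose i j)) f Ω.≈ f) →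
           Ω.constantTerm f ≈ 0# → ∀ α → apply f φ α ≈ 0#
    kill f rot exch const α = result
      where
      instance
        r≢0 : NonZero r
        r≢0 = ℕ.>-nonZero 1≤r
      ψ = apply f φ
      open import Relation.Binary.Reasoning.Setoid setoid

      ψ-twisted : 2 ≤ r → ∀ j → ζ ^ suc (lookup α j) * ψ α ≈ ψ α
      ψ-twisted 2≤r j = begin
        ζ * ζ ^ lookup α j * ψ α                                                 ≈⟨ *-assoc _ _ _ ⟩
        ζ * (ζ ^ lookup α j * apply f φ α)                                       ≈⟨ *-congˡ (apply-rotate 2≤r j f φ α) ⟨
        ζ * apply (act (rotate 2≤r j) f) (λ β → ζ ^ lookup β j * φ β) α          ≈⟨ *-congˡ (sound (rot 2≤r j) _ α) ⟩
        ζ * apply f (λ β → ζ ^ lookup β j * φ β) α                               ≈⟨ apply-* f ζ _ α ⟨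
        apply f (λ β → ζ * (ζ ^ lookup β j * φ β)) α                             ≈⟨ apply-cong f (λ β → trans (sym (*-assoc _ _ _)) (φ-twisted j β)) α ⟩
        apply f φ α                                                              ∎

      ψ-alternating : ∀ {i j} → i ≢ j → lookup α i ≡ lookup α j → ψ α ≈ - ψ α
      ψ-alternating {i} {j} i≢j e = begin
        ψ α                                                                      ≡⟨ ≡.cong ψ fixed ⟨
        apply f φ (permute w α)                                                  ≈⟨ apply-exchange w f φ α ⟨
        apply (act (exchange w) f) (λ β → φ (permute w β)) α                     ≈⟨ sound (exch i≢j) _ α ⟩
        apply f (λ β → φ (permute w β)) α                                        ≈⟨ apply-cong f (λ β → trans (φ-antisymmetric i≢j β) (sym (-1*≈ _))) α ⟩
        apply f (λ β → - 1# * φ β) α                                             ≈⟨ apply-* f (- 1#) φ α ⟩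
        - 1# * ψ α                                                               ≈⟨ -1*≈ _ ⟩
        - ψ α                                                                    ∎
        where
        w = transpose i j
        -1*≈ = RingProperties.-1*x≈-x ring
        open Swaps (transpose-swaps i j)
        same : ∀ k → lookup α (w ⟨$⟩ʳ k) ≡ lookup α k
        same k = by (k Fin.≟ i) (k Fin.≟ j)
          where
          by : Dec (k ≡ i) → Dec (k ≡ j) → lookup α (w ⟨$⟩ʳ k) ≡ lookup α k
          by (yes ≡.refl) _            = ≡.trans (≡.cong (lookup α) swapˡ) (≡.sym e)
          by (no _)       (yes ≡.refl) = ≡.trans (≡.cong (lookup α) swapʳ) e
          by (no k≢i)     (no k≢j)     = ≡.cong (lookup α) (fixes k≢i k≢j)
        fixed : permute w α ≡ α
        fixed = ≡.trans (Vec.tabulate-cong same) (Vec.tabulate∘lookup α)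

      -- By n·n = 2·triangle n + n, the degree n(r n - 1) of the corner, lowered by r·triangle n, is
      -- exactly the least size of an exponent with distinct entries congruent to -1 modulo `r`.
      large : (∀ i → suc (lookup α i) % r ≡ 0) → (∀ {i j} → lookup α i ≡ lookup α j → i ≡ j) →
              Vec.sum corner ≤ r ℕ.* triangle n ℕ.+ Vec.sum α
      large d inj = ℕ.+-cancelʳ-≤ n (Vec.sum corner) (r ℕ.* triangle n ℕ.+ Vec.sum α) (≡.subst₂ _≤_ (≡.sym corner-size)
          (≡.sym (ℕ.+-assoc (r ℕ.* triangle n) (Vec.sum α) n))
          (ℕ.≤-trans (ℕ.≤-reflexive rearrange) (ℕ.+-monoʳ-≤ (r ℕ.* triangle n) (large-size r α d inj))))
        where
        rearrange : r ℕ.* (n ℕ.* n) ≡ r ℕ.* triangle n ℕ.+ r ℕ.* (triangle n ℕ.+ n)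
        rearrange = ≡.trans (≡.cong (r ℕ.*_) (≡.trans (≡.sym (triangle-double n)) (ℕ.+-comm (triangle n ℕ.+ n) (triangle n))))
          (ℕ.*-distribˡ-+ r (triangle n) (triangle n ℕ.+ n))
        sum-replicate : ∀ m e → Vec.sum (replicate m e) ≡ m ℕ.* e
        sum-replicate zero    e = ≡.refl
        sum-replicate (suc m) e = ≡.cong (e ℕ.+_) (sum-replicate m e)
        corner-size : Vec.sum corner ℕ.+ n ≡ r ℕ.* (n ℕ.* n)
        corner-size = go n ≡.refl
          where
          go : ∀ m → n ≡ m → Vec.sum corner ℕ.+ n ≡ r ℕ.* (n ℕ.* n)
          go zero    ≡.refl = ≡.sym (ℕ.*-zeroʳ r)
          go (suc m) ≡.refl = ≡.trans (≡.cong (ℕ._+ n) (sum-replicate n _)) (≡.trans (ℕ.+-comm _ n) (≡.trans (≡.sym (ℕ.*-suc n _))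
            (≡.trans (≡.cong (n ℕ.*_) (≡.trans (suc-corner zero) (≡.cong (r ℕ.*_) degree≡n)))
              (≡.trans (≡.sym (ℕ.*-assoc n r n)) (≡.trans (≡.cong (ℕ._* n) (ℕ.*-comm n r)) (ℕ.*-assoc r n n))))))

      bounded : Vec.sum corner ≤ r ℕ.* triangle n ℕ.+ Vec.sum α → ψ α ≈ 0#
      bounded p = trans (apply-constant (Vec.sum corner ∸ r ℕ.* triangle n) f
          (λ β q → φ-small β (ℕ.≤-<-trans (ℕ.m≤n+m∸n (Vec.sum corner) (r ℕ.* triangle n))
            (≡.subst (r ℕ.* triangle n ℕ.+ (Vec.sum corner ∸ r ℕ.* triangle n) <_) (ℕ.+-comm (r ℕ.* triangle n) (Vec.sum β)) (ℕ.+-monoʳ-< (r ℕ.* triangle n) q))))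
          α (ℕ.m≤n+o⇒m∸n≤o (Vec.sum corner) (r ℕ.* triangle n) p))
        (trans (*-congʳ const) (zeroˡ _))

      -- An entry not congruent to -1 modulo `r` is excluded by a rotation, two equal entries by a
      -- transposition. In the remaining case `α` is in or above the top degree of `φ`, where `f`
      -- acts through its constant term.
      result : ψ α ≈ 0#
      result with Fin.any? (λ i → ¬? (suc (lookup α i) % r ℕ.≟ 0))
      ... | yes (i , ne) = cancel (suc (lookup α i) % r) (ℕ.n≢0⇒n>0 ne) (m%n<n (suc (lookup α i)) r) (ψ α)
            (trans (*-congʳ reduced) (ψ-twisted 2≤r i))
        where
        2≤r : 2 ≤ r
        2≤r = ℕ.≤-trans (s≤s (ℕ.n≢0⇒n>0 ne)) (m%n<n (suc (lookup α i)) r)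
        reduced : ζ ^ (suc (lookup α i) % r) ≈ ζ ^ suc (lookup α i)
        reduced = sym (trans (reflexive (≡.cong (ζ ^_) (≡.trans (m≡m%n+[m/n]*n (suc (lookup α i)) r)
            (≡.cong (suc (lookup α i) % r ℕ.+_) (ℕ.*-comm (suc (lookup α i) / r) r)))))
          (trans (^-homo-* ζ (suc (lookup α i) % r) (r ℕ.* (suc (lookup α i) / r))) (trans (*-congˡ (root-power _)) (*-identityʳ _))))
      ... | no none with injective-or-repeated α
      ...   | inj₁ (i , j , i≢j , e) = halve (ψ α) (ψ-alternating i≢j e)
      ...   | inj₂ inj = bounded (large (λ i → decidable-stable (suc (lookup α i) % r ℕ.≟ 0) (λ ne → none (i , ne))) inj)

-- Odd derivations and linear independence

-- The contraction ι E is the odd derivation with x i ↦ 0 and θ i ↦ E i.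
module Contractions {c ℓ : Level} (K : CommutativeRing c ℓ) (n : ℕ) where

  private
    module K = CommutativeRing K
    module Ω = Superspace K n
  open Ring Ω.ring hiding (zero)
  open RingProperties Ω.ring using (-‿distribˡ-*; -‿distribʳ-*)
  open AbelianGroupProperties +-abelianGroup using (⁻¹-∙-comm; ε⁻¹≈ε; ⁻¹-involutive)
  open CommutativeSemigroupProperties +-commutativeSemigroup using (interchange)
  open Polynomials K n

  Field : Set c
  Field = Fin n → Poly

  parity : Carrier → Carrier
  parity (Ω.con a) = Ω.con a
  parity (Ω.x i)   = Ω.x i
  parity (Ω.θ i)   = - Ω.θ i
  parity (f Ω.+ g) = parity f + parity g
  parity (f Ω.* g) = parity f * parity g
  parity (Ω.- f)   = - parity f

  ι : Field → Carrier → Carrier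
  ι E (Ω.con a) = 0#
  ι E (Ω.x i)   = 0#
  ι E (Ω.θ i)   = ⟦ E i ⟧
  ι E (f Ω.+ g) = ι E f + ι E g
  ι E (f Ω.* g) = ι E f * g + parity f * ι E g
  ι E (Ω.- f)   = - ι E f

  private
    [-x][-y]≈xy : ∀ f g → - f * - g ≈ f * g
    [-x][-y]≈xy f g = trans (sym (-‿distribˡ-* _ _)) (trans (-‿cong (sym (-‿distribʳ-* _ _))) (⁻¹-involutive _))

    x*-y : ∀ {f g} → f * g ≈ g * f → f * (- g) ≈ - g * f
    x*-y e = trans (sym (-‿distribʳ-* _ _)) (trans (-‿cong e) (-‿distribˡ-* _ _))

    left0 : ∀ f {g h} → g ≈ h → 0# * f + g ≈ h
    left0 f e = trans (+-cong (zeroˡ f) e) (+-identityˡ _)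

    right0 : ∀ f {g h} → g ≈ h → g + f * 0# ≈ h
    right0 f e = trans (+-cong e (zeroʳ f)) (+-identityʳ _)

  parity-cong : ∀ {f g} → f ≈ g → parity f ≈ parity g
  parity-cong Ω.refl              = refl
  parity-cong (Ω.sym e)           = sym (parity-cong e)
  parity-cong (Ω.trans e e′)      = trans (parity-cong e) (parity-cong e′)
  parity-cong (Ω.con-cong e)      = Ω.con-cong e
  parity-cong (Ω.+-cong e e′)     = +-cong (parity-cong e) (parity-cong e′)
  parity-cong (Ω.*-cong e e′)     = *-cong (parity-cong e) (parity-cong e′)
  parity-cong (Ω.neg-cong e)      = -‿cong (parity-cong e)
  parity-cong (Ω.+-assoc f g h)   = +-assoc _ _ _
  parity-cong (Ω.+-comm f g)      = +-comm _ _
  parity-cong (Ω.+-identityˡ f)   = +-identityˡ _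
  parity-cong (Ω.+-inverseˡ f)    = -‿inverseˡ _
  parity-cong (Ω.*-assoc f g h)   = *-assoc _ _ _
  parity-cong (Ω.*-identityˡ f)   = *-identityˡ _
  parity-cong (Ω.distribˡ f g h)  = distribˡ _ _ _
  parity-cong (Ω.distribʳ f g h)  = distribʳ _ _ _
  parity-cong (Ω.con-+ a b)       = Ω.con-+ a b
  parity-cong (Ω.con-* a b)       = Ω.con-* a b
  parity-cong (Ω.con-central a f) = Ω.con-central a _
  parity-cong (Ω.xx-comm i j)     = Ω.xx-comm i j
  parity-cong (Ω.xθ-comm i j)     = x*-y (Ω.xθ-comm i j)
  parity-cong (Ω.θθ-anticomm i j) = trans ([-x][-y]≈xy _ _)
    (trans (Ω.θθ-anticomm i j) (-‿cong (sym ([-x][-y]≈xy _ _))))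

  parity-⟦⟧ : ∀ p → parity ⟦ p ⟧ ≡ ⟦ p ⟧
  parity-⟦⟧ (con a) = ≡.refl
  parity-⟦⟧ (x i)   = ≡.refl
  parity-⟦⟧ (p ⊕ q) = ≡.cong₂ Ω._+_ (parity-⟦⟧ p) (parity-⟦⟧ q)
  parity-⟦⟧ (p ⊛ q) = ≡.cong₂ Ω._*_ (parity-⟦⟧ p) (parity-⟦⟧ q)
  parity-⟦⟧ (⊝ p)   = ≡.cong Ω.-_ (parity-⟦⟧ p)

  parity-involutive : ∀ f → parity (parity f) ≈ f
  parity-involutive (Ω.con a) = refl
  parity-involutive (Ω.x i)   = refl
  parity-involutive (Ω.θ i)   = ⁻¹-involutive _
  parity-involutive (f Ω.+ g) = +-cong (parity-involutive f) (parity-involutive g)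
  parity-involutive (f Ω.* g) = *-cong (parity-involutive f) (parity-involutive g)
  parity-involutive (Ω.- f)   = -‿cong (parity-involutive f)

  ι-cong : ∀ E {f g} → f ≈ g → ι E f ≈ ι E g
  ι-cong E Ω.refl              = refl
  ι-cong E (Ω.sym e)           = sym (ι-cong E e)
  ι-cong E (Ω.trans e e′)      = trans (ι-cong E e) (ι-cong E e′)
  ι-cong E (Ω.con-cong e)      = refl
  ι-cong E (Ω.+-cong e e′)     = +-cong (ι-cong E e) (ι-cong E e′)
  ι-cong E (Ω.*-cong e e′)     = +-cong (*-cong (ι-cong E e) e′) (*-cong (parity-cong e) (ι-cong E e′))
  ι-cong E (Ω.neg-cong e)      = -‿cong (ι-cong E e)
  ι-cong E (Ω.+-assoc f g h)   = +-assoc _ _ _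
  ι-cong E (Ω.+-comm f g)      = +-comm _ _
  ι-cong E (Ω.+-identityˡ f)   = +-identityˡ _
  ι-cong E (Ω.+-inverseˡ f)    = -‿inverseˡ _
  ι-cong E (Ω.*-assoc f g h)   = trans (+-cong (trans (distribʳ _ _ _) (+-cong (*-assoc _ _ _) (*-assoc _ _ _))) (*-assoc _ _ _))
    (trans (+-assoc _ _ _) (+-congˡ (sym (distribˡ _ _ _))))
  ι-cong E (Ω.*-identityˡ f)   = left0 f (*-identityˡ _)
  ι-cong E (Ω.distribˡ f g h)  = trans (+-cong (distribˡ _ _ _) (distribˡ _ _ _)) (interchange _ _ _ _)
  ι-cong E (Ω.distribʳ f g h)  = trans (+-cong (distribʳ _ _ _) (distribʳ _ _ _)) (interchange _ _ _ _)
  ι-cong E (Ω.con-+ a b)       = sym (+-identityˡ _)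
  ι-cong E (Ω.con-* a b)       = sym (left0 _ (zeroʳ _))
  ι-cong E (Ω.con-central a f) = left0 f (trans (Ω.con-central a _) (sym (right0 _ refl)))
  ι-cong E (Ω.xx-comm i j)     = left0 _ (trans (zeroʳ _) (sym (left0 _ (zeroʳ _))))
  ι-cong E (Ω.xθ-comm i j)     = left0 _ (trans (central (x i) _) (sym (right0 _ refl)))
  ι-cong E (Ω.θθ-anticomm i j) = trans (+-cong (central (E i) _) (sym (-‿distribˡ-* _ _)))
    (trans (+-congˡ (-‿cong (sym (central (E j) _))))
    (trans (trans (+-comm _ _) (+-congˡ (trans (sym (⁻¹-involutive _)) (-‿cong (-‿distribˡ-* _ _))))) (⁻¹-∙-comm _ _)))

  ι-⟦⟧ : ∀ E p → ι E ⟦ p ⟧ ≈ 0#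
  ι-⟦⟧ E (con a) = refl
  ι-⟦⟧ E (x i)   = refl
  ι-⟦⟧ E (p ⊕ q) = trans (+-cong (ι-⟦⟧ E p) (ι-⟦⟧ E q)) (+-identityˡ _)
  ι-⟦⟧ E (p ⊛ q) = trans (+-cong (trans (*-congʳ (ι-⟦⟧ E p)) (zeroˡ _)) (trans (*-congˡ (ι-⟦⟧ E q)) (zeroʳ _))) (+-identityˡ _)
  ι-⟦⟧ E (⊝ p)   = trans (-‿cong (ι-⟦⟧ E p)) ε⁻¹≈ε

  ι-parity : ∀ E f → ι E (parity f) ≈ - parity (ι E f)
  ι-parity E (Ω.con a) = sym ε⁻¹≈ε
  ι-parity E (Ω.x i)   = sym ε⁻¹≈ε
  ι-parity E (Ω.θ i)   = -‿cong (reflexive (≡.sym (parity-⟦⟧ (E i))))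
  ι-parity E (f Ω.+ g) = trans (+-cong (ι-parity E f) (ι-parity E g)) (⁻¹-∙-comm _ _)
  ι-parity E (f Ω.* g) = trans (+-cong (trans (*-congʳ (ι-parity E f)) (sym (-‿distribˡ-* _ _)))
    (trans (*-congˡ (ι-parity E g)) (sym (-‿distribʳ-* _ _)))) (⁻¹-∙-comm _ _)
  ι-parity E (Ω.- f)   = -‿cong (ι-parity E f)

  -- Polynomials are central and even, so contraction is linear over them in the field. The shape p
  -- E′ - E″ is that of one factor s - y i being multiplied out.
  ι-linear : ∀ {E E′ E″} p → (∀ i → E i P.≈ p ⊛ E′ i ⊕ ⊝ E″ i) → ∀ f → ι E f ≈ ⟦ p ⟧ * ι E′ f - ι E″ f
  ι-linear {E} {E′} {E″} p e = go
    where
    zero′ : 0# ≈ ⟦ p ⟧ * 0# - 0#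
    zero′ = sym (trans (+-cong (zeroʳ _) ε⁻¹≈ε) (+-identityˡ _))
    go : ∀ f → ι E f ≈ ⟦ p ⟧ * ι E′ f - ι E″ f
    go (Ω.con a) = zero′
    go (Ω.x i)   = zero′
    go (Ω.θ i)   = e i
    go (f Ω.+ g) = trans (+-cong (go f) (go g)) (trans (interchange _ _ _ _) (+-cong (sym (distribˡ _ _ _)) (⁻¹-∙-comm _ _)))
    go (f Ω.* g) = trans (+-cong
        (trans (*-congʳ (go f)) (trans (distribʳ _ _ _) (+-cong (*-assoc _ _ _) (sym (-‿distribˡ-* _ _)))))
        (trans (*-congˡ (go g)) (trans (distribˡ _ _ _) (+-cong
          (trans (sym (*-assoc _ _ _)) (trans (*-congʳ (sym (central p _))) (*-assoc _ _ _))) (sym (-‿distribʳ-* _ _))))))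
      (trans (interchange _ _ _ _) (+-cong (sym (distribˡ _ _ _)) (⁻¹-∙-comm _ _)))
    go (Ω.- f)   = trans (-‿cong (go f)) (trans (sym (⁻¹-∙-comm _ _)) (+-congʳ (-‿distribʳ-* _ _)))

  constantTerm-ι : ∀ E → (∀ i → Ω.constantTerm ⟦ E i ⟧ K.≈ K.0#) → ∀ f → Ω.constantTerm (ι E f) K.≈ K.0#
  constantTerm-ι E e (Ω.con a) = K.refl
  constantTerm-ι E e (Ω.x i)   = K.refl
  constantTerm-ι E e (Ω.θ i)   = e i
  constantTerm-ι E e (f Ω.+ g) = K.trans (K.+-cong (constantTerm-ι E e f) (constantTerm-ι E e g)) (K.+-identityˡ _)
  constantTerm-ι E e (f Ω.* g) = K.trans (K.+-cong (K.trans (K.*-congʳ (constantTerm-ι E e f)) (K.zeroˡ _))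
    (K.trans (K.*-congˡ (constantTerm-ι E e g)) (K.zeroʳ _))) (K.+-identityˡ _)
  constantTerm-ι E e (Ω.- f)   = K.trans (K.-‿cong (constantTerm-ι E e f)) (AbelianGroupProperties.ε⁻¹≈ε K.+-abelianGroup)

  ι* : List Field → Carrier → Carrier
  ι* []      f = f
  ι* (E ∷ L) f = ι* L (ι E f)

  ι*-cong : ∀ L {f g} → f ≈ g → ι* L f ≈ ι* L g
  ι*-cong []      e = e
  ι*-cong (E ∷ L) e = ι*-cong L (ι-cong E e)

  ι*-+ : ∀ L f g → ι* L (f + g) ≡ ι* L f + ι* L g
  ι*-+ []      f g = ≡.refl
  ι*-+ (E ∷ L) f g = ι*-+ L _ _

  ι*-neg : ∀ L f → ι* L (- f) ≡ - ι* L f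
  ι*-neg []      f = ≡.refl
  ι*-neg (E ∷ L) f = ι*-neg L _

  ι*-⟦⟧* : ∀ L p f → ι* L (⟦ p ⟧ * f) ≈ ⟦ p ⟧ * ι* L f
  ι*-⟦⟧* []      p f = refl
  ι*-⟦⟧* (E ∷ L) p f = trans (ι*-cong L (trans (+-cong (trans (*-congʳ (ι-⟦⟧ E p)) (zeroˡ _)) (*-congʳ (reflexive (parity-⟦⟧ p)))) (+-identityˡ _)))
    (ι*-⟦⟧* L p (ι E f))

  -- With `θ i` on the right there is no sign: a contraction reaches it only in the term parity f ·
  -- E i, which is 0.
  ι*-*θ : ∀ i L → All (λ E → E i P.≈ P.0#) L → ∀ f → ι* L (f * Ω.θ i) ≈ ι* L f * Ω.θ i
  ι*-*θ i []      []       f = refl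
  ι*-*θ i (E ∷ L) (e ∷ es) f = trans (ι*-cong L (trans (+-congˡ (trans (*-congˡ e) (zeroʳ _))) (+-identityʳ _))) (ι*-*θ i L es (ι E f))

module Vanishing {c ℓ : Level} (K : CommutativeRing c ℓ) (n r : ℕ) (1≤r : 1 ≤ r) (ζ : CommutativeRing.Carrier K)
         (ζ^r≈1 : IsRootOfUnity K r ζ)
         (cancel : PowersCancel K r ζ)
         (halve : NoTwoTorsion K)
         where

  open CommutativeRing K hiding (zero)
  private
    module Ω = Superspace K n
    module O = Ring Ω.ring
  open Polynomials K n
  open Functionals K n
  open Contractions K n
  open Alternant K n r 1≤r ζ ζ^r≈1
  open InvariantSums K n r 1≤r ζ ζ^r≈1 using (act; scale; scale^; act-power)
  open SymmetricFunctions polyRing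
  open Exp P.semiring using () renaming (_^_ to _^ᴾ_)
  open Ω.WreathProduct

  Null : O.Carrier → Set ℓ
  Null f = ∀ α → apply f φ α ≈ 0#

  null-resp : ∀ {f g} → f O.≈ g → Null f → Null g
  null-resp e h α = trans (sym (sound e φ α)) (h α)

  null-+ : ∀ {f g} → Null f → Null g → Null (f Ω.+ g)
  null-+ h h′ α = trans (+-cong (h α) (h′ α)) (+-identityˡ _)

  private
    module KR = AbelianGroupProperties +-abelianGroup

  null-neg : ∀ {f} → Null f → Null (Ω.- f)
  null-neg h α = trans (-‿cong (h α)) KR.ε⁻¹≈ε

  null-*ˡ : ∀ g {f} → Null f → Null (g Ω.* f)
  null-*ˡ g h = apply-0 g h

  private
    body : O.Carrier → Poly
    body (Ω.con a) = con a
    body (Ω.x i)   = x i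
    body (Ω.θ i)   = con 0#
    body (f Ω.+ g) = body f ⊕ body g
    body (f Ω.* g) = body f ⊛ body g
    body (Ω.- f)   = ⊝ body f

    apply-body : ∀ f χ → apply f χ ≗ apply ⟦ body f ⟧ χ
    apply-body (Ω.con a) χ α = refl
    apply-body (Ω.x i)   χ α = refl
    apply-body (Ω.θ i)   χ α = sym (zeroˡ _)
    apply-body (f Ω.+ g) χ α = +-cong (apply-body f χ α) (apply-body g χ α)
    apply-body (f Ω.* g) χ α = trans (apply-cong f (apply-body g χ) α) (apply-body f _ α)
    apply-body (Ω.- f)   χ α = -‿cong (apply-body f χ α)

  -- On functionals `f` acts as the polynomial `body f`, and the action of a polynomial commutes
  -- with that of `g`.
  null-*ʳ : ∀ g {f} → Null f → Null (f Ω.* g)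
  null-*ʳ g {f} h α = trans (apply-body f (apply g φ) α) (trans (apply-central (body f) g φ α)
    (trans (apply-cong g (λ β → sym (apply-body f φ β)) α) (apply-0 g h α)))

  apply-parity : ∀ f {χ} → apply (parity f) χ ≗ apply f χ
  apply-parity (Ω.con a) α = refl
  apply-parity (Ω.x i)   α = refl
  apply-parity (Ω.θ i)   α = KR.ε⁻¹≈ε
  apply-parity (f Ω.+ g) α = +-cong (apply-parity f α) (apply-parity g α)
  apply-parity (f Ω.* g) α = trans (apply-cong (parity f) (apply-parity g) α) (apply-parity f α)
  apply-parity (Ω.- f)   α = -‿cong (apply-parity f α)

  null-parity : ∀ L f → Null (ι* L f) → Null (ι* L (parity f))
  null-parity []      f h α = trans (apply-parity f α) (h α)
  null-parity (E ∷ L) f h = null-resp (O.sym (O.trans (ι*-cong L (ι-parity E f)) (O.reflexive (ι*-neg L _))))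
    (null-neg {ι* L (parity (ι E f))} (null-parity L (ι E f) h))

  -- x i ^ (r k + 1) ∏ (t - y i) over t in A: equivariant for A = [], and zero
  -- at all i with y i in A.
  radial : ℕ → List Poly → Field
  radial k A i = x i ⊛ (y i ^ᴾ k ⊛ comonic A (y i))

  -- `Null` sees only the part without θ, since θ acts by 0; contractions expose the other parts.
  -- Quantifying over all lists lets the product rule close up, so that the condition passes to
  -- two-sided multiples.
  Contracted : O.Carrier → Set ℓ
  Contracted f = ∀ ks → Null (ι* (map (λ k → radial k []) ks) f)

  contracted-resp : ∀ {f g} → f O.≈ g → Contracted f → Contracted g
  contracted-resp {f} e h ks = null-resp (ι*-cong (map (λ k → radial k []) ks) e) (h ks)

  contracted-+ : ∀ {f g} → Contracted f → Contracted g → Contracted (f Ω.+ g)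
  contracted-+ {f} {g} h h′ ks = null-resp (O.reflexive (≡.sym (ι*-+ L f g))) (null-+ {ι* L f} {ι* L g} (h ks) (h′ ks))
    where L = map (λ k → radial k []) ks

  contracted-neg : ∀ {f} → Contracted f → Contracted (Ω.- f)
  contracted-neg {f} h ks = null-resp (O.reflexive (≡.sym (ι*-neg L f))) (null-neg {ι* L f} (h ks))
    where L = map (λ k → radial k []) ks

  contracted-*ˡ : ∀ g {f} → Contracted f → Contracted (g Ω.* f)
  contracted-*ˡ g {f} h []       = null-*ˡ g {f} (h [])
  contracted-*ˡ g {f} h (k ∷ ks) = null-resp (O.reflexive (≡.sym (ι*-+ L (ι E g Ω.* f) (parity g Ω.* ι E f))))
      (null-+ {ι* L (ι E g Ω.* f)} {ι* L (parity g Ω.* ι E f)} (contracted-*ˡ (ι E g) h ks) (contracted-*ˡ (parity g) (λ ks → h (k ∷ ks)) ks))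
    where
    E = radial k []
    L = map (λ k → radial k []) ks

  contracted-*ʳ : ∀ g {f} → Contracted f → Contracted (f Ω.* g)
  contracted-*ʳ g {f} h []       = null-*ʳ g {f} (h [])
  contracted-*ʳ g {f} h (k ∷ ks) = null-resp (O.reflexive (≡.sym (ι*-+ L (ι E f Ω.* g) (parity f Ω.* ι E g))))
      (null-+ {ι* L (ι E f Ω.* g)} {ι* L (parity f Ω.* ι E g)} (contracted-*ʳ g (λ ks → h (k ∷ ks)) ks)
        (contracted-*ʳ (ι E g) {parity f} (λ ks → null-parity (map (λ k → radial k []) ks) f (h ks)) ks))
    where
    E = radial k []
    L = map (λ k → radial k []) ks

  private
    act-parity : ∀ g f → act g (parity f) O.≈ parity (act g f)
    act-parity g (Ω.con a) = O.refl
    act-parity g (Ω.x i)   = O.refl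
    act-parity g (Ω.θ i)   = RingProperties.-‿distribʳ-* Ω.ring _ _
    act-parity g (f Ω.+ h) = O.+-cong (act-parity g f) (act-parity g h)
    act-parity g (f Ω.* h) = O.*-cong (act-parity g f) (act-parity g h)
    act-parity g (Ω.- f)   = O.-‿cong (act-parity g f)

    act-ι : ∀ g {E} → (∀ i → act g ⟦ E i ⟧ O.≈ Ω.con (scale g i) Ω.* ⟦ E (permutation g ⟨$⟩ʳ i) ⟧) →
            ∀ f → act g (ι E f) O.≈ ι E (act g f)
    act-ι g e (Ω.con a) = O.refl
    act-ι g e (Ω.x i)   = O.sym (O.trans (O.+-cong (O.zeroˡ _) (O.zeroʳ _)) (O.+-identityˡ _))
    act-ι g e (Ω.θ i)   = O.trans (e i) (O.sym (O.trans (O.+-congʳ (O.zeroˡ _)) (O.+-identityˡ _)))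
    act-ι g e (f Ω.+ h) = O.+-cong (act-ι g e f) (act-ι g e h)
    act-ι g e (f Ω.* h) = O.+-cong (O.*-congʳ (act-ι g e f)) (O.*-cong (act-parity g f) (act-ι g e h))
    act-ι g e (Ω.- f)   = O.-‿cong (act-ι g e f)

    act-field : ∀ g k i → act g ⟦ radial k [] i ⟧ O.≈ Ω.con (scale g i) Ω.* ⟦ radial k [] (permutation g ⟨$⟩ʳ i) ⟧
    act-field g k i = O.trans (O.*-assoc _ _ _) (O.*-congˡ (O.*-congˡ (O.*-congʳ power)))
      where
      module Expᴼ = Exp O.semiring
      j = permutation g ⟨$⟩ʳ i
      as-power : ∀ i → ⟦ y i ^ᴾ k ⟧ O.≈ Expᴼ._^_ (Ω.x i) (r ℕ.* k)
      as-power i = O.trans (O.reflexive (≡.trans (⟦^⟧ (y i) k) (≡.cong (λ z → Expᴼ._^_ z k) (⟦^⟧ (x i) r)))) (Expᴼ.^-assocʳ (Ω.x i) r k)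
      act-^ : ∀ f m → act g (Expᴼ._^_ f m) ≡ Expᴼ._^_ (act g f) m
      act-^ f zero    = ≡.refl
      act-^ f (suc m) = ≡.cong (act g f Ω.*_) (act-^ f m)
      power : act g ⟦ y i ^ᴾ k ⟧ O.≈ ⟦ y j ^ᴾ k ⟧
      power = O.trans (O.reflexive (≡.trans (≡.cong (act g) (≡.trans (⟦^⟧ (y i) k) (≡.cong (λ z → Expᴼ._^_ z k) (⟦^⟧ (x i) r))))
            (≡.trans (act-^ (Expᴼ._^_ (Ω.x i) r) k) (≡.cong (λ z → Expᴼ._^_ z k) (act-^ (Ω.x i) r)))))
        (O.trans (Expᴼ.^-assocʳ (act g (Ω.x i)) r k) (O.trans (O.reflexive (≡.sym (act-^ (Ω.x i) (r ℕ.* k))))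
          (O.trans (act-power g i (r ℕ.* k)) (O.trans (O.*-congʳ (Ω.con-cong (scale^ g i k))) (O.trans (O.*-identityˡ _) (O.sym (as-power j)))))))

  -- `x i ^ (r k + 1)` is scaled by the group exactly as `θ i` is. The contraction therefore
  -- commutes with the action, and its value is again an invariant without constant term.
  contracted-generator : ∀ {f} → Ω.SI-generators r ζ f → Contracted f
  contracted-generator {f} (inv , const) []       = kill cancel halve f (λ 2≤r j → inv (rotate 2≤r j)) (λ {i} {j} _ → inv (exchange (transpose i j))) const
  contracted-generator {f} (inv , const) (k ∷ ks) = contracted-generator
    ((λ g → O.trans (act-ι g (act-field g k) f) (ι-cong (radial k []) (inv g)))
      , constantTerm-ι (radial k []) (λ i → zeroˡ _) f) ks

  contracted : ∀ {f} → Ω.SI r ζ f → Contracted f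
  contracted (Ω.generator p)  = contracted-generator p
  contracted (Ω.resp e p)     = contracted-resp e (contracted p)
  contracted Ω.zeroᴵ ks       = null-resp (O.sym (O.trans (ι*-cong L (O.sym (O.zeroˡ Ω.0Ω)))
    (O.trans (ι*-⟦⟧* L (con 0#) Ω.0Ω) (O.zeroˡ (ι* L Ω.0Ω))))) (λ α → zeroˡ (φ α))
    where L = map (λ k → radial k []) ks
  contracted (Ω.addᴵ {f} {g} p q) = contracted-+ {f} {g} (contracted p) (contracted q)
  contracted (Ω.mulˡ g {f} p) = contracted-*ˡ g {f} (contracted p)
  contracted (Ω.mulʳ g {f} p) = contracted-*ʳ g {f} (contracted p)

  -- Multiplying out the factors s - y i one by one expresses the field through the equivariant
  -- ones, with polynomial coefficients.
  contracted-ι : ∀ A k {f} → Contracted f → Contracted (ι (radial k A) f)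
  contracted-ι []      k h = λ ks → h (k ∷ ks)
  contracted-ι (s ∷ A) k {f} h = contracted-resp
    (O.sym (ι-linear {radial k (s ∷ A)} {radial k A} {radial (suc k) A} s expand f))
    (contracted-+ {⟦ s ⟧ Ω.* ι (radial k A) f} {Ω.- ι (radial (suc k) A) f}
      (contracted-*ˡ ⟦ s ⟧ {ι (radial k A) f} (contracted-ι A k {f} h))
      (contracted-neg {ι (radial (suc k) A) f} (contracted-ι A (suc k) {f} h)))
    where
    open IntegerSolver polyRing using (solve; _:=_; _:*_; _:-_)
    expand : ∀ i → radial k (s ∷ A) i P.≈ s ⊛ radial k A i ⊕ ⊝ radial (suc k) A i
    expand i = solve 5 (λ s x y q m → x :* (q :* ((s :- y) :* m)) := s :* (x :* (q :* m)) :- (x :* ((y :* q) :* m))) P.refl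
      s (x i) (y i) (y i ^ᴾ k) (comonic A (y i))

-- Separating the components of a linear relation

module LinearIndependence {c ℓ : Level} (K : CommutativeRing c ℓ) (n r : ℕ) (1≤r : 1 ≤ r) (ζ : CommutativeRing.Carrier K)
         (ζ^r≈1 : IsRootOfUnity K r ζ)
         (invertᴷ : InvertibleNaturals K)
         (cancel : PowersCancel K r ζ)
         where

  open CommutativeRing K hiding (zero)
  private
    module Ω = Superspace K n
    module O = Ring Ω.ring

  halve : NoTwoTorsion K
  halve a e = begin
    a                                    ≈⟨ *-identityˡ a ⟨
    1# * a                               ≈⟨ *-congʳ (proj₂ (invertᴷ 1)) ⟨
    u * (1# + (1# + 0#)) * a             ≈⟨ *-assoc _ _ _ ⟩
    u * ((1# + (1# + 0#)) * a)           ≈⟨ *-congˡ (trans (distribʳ _ _ _) (+-cong (*-identityˡ a)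
                                              (trans (*-congʳ (+-identityʳ 1#)) (*-identityˡ a)))) ⟩
    u * (a + a)                          ≈⟨ *-congˡ (trans (+-congˡ e) (-‿inverseʳ a)) ⟩
    u * 0#                               ≈⟨ zeroʳ u ⟩
    0#                                   ∎
    where
    open import Relation.Binary.Reasoning.Setoid setoid
    u = proj₁ (invertᴷ 1)

  open Polynomials K n
  open Functionals K n
  open Contractions K n
  open Alternant K n r 1≤r ζ ζ^r≈1
  open Vanishing K n r 1≤r ζ ζ^r≈1 cancel halve
  open SpanningSet K n r 1≤r ζ ζ^r≈1 invertᴷ using (powerSum∈; tree; active-entries)
  open SymmetricFunctions polyRing
  open SymmetricLists polyRing
  open Staircases {n} r 1≤r
  open Configurations polyRing r x (ascending n) (ascending-unique n) using (active; Entries; Exponents; Box)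
  open Complements polyRing r x (ascending n) (ascending-unique n) using (preFactor; factor)
  module In = Independence polyRing r x (ascending n) (ascending-unique n) con (_≈ 0#)
  open Exp P.semiring using () renaming (_^_ to _^ᴾ_)

  private
    1≤degree : Fin n → 1 ≤ degree
    1≤degree i = ≡.subst (1 ≤_) (≡.sym degree≡n) (positive i)
      where
      positive : ∀ {m} → Fin m → 1 ≤ m
      positive {suc m} _ = s≤s z≤n

    power∈𝔧 : ∀ i → Annihilator χ₀ (x i ^ᴾ (r ℕ.* degree))
    power∈𝔧 i α = trans (apply-power i (r ℕ.* degree) χ₀ α) (χ₀-other {updateAt α i (r ℕ.* degree ℕ.+_)} λ e →
      ℕ.<-irrefl (≡.trans (≡.sym (Vec.lookup-replicate i (r ℕ.* degree ∸ 1))) (≡.trans (≡.cong (λ β → lookup β i) (≡.sym e)) (Vec.lookup∘updateAt i {r ℕ.* degree ℕ.+_} α)))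
        (ℕ.<-≤-trans (ℕ.∸-monoʳ-< {r ℕ.* degree} {1} {0} (s≤s z≤n) (ℕ.*-mono-≤ 1≤r (1≤degree i))) (ℕ.m≤m+n _ _)))

    raise : List (Fin n) → Vec ℕ n → Vec ℕ n
    raise []      α = α
    raise (i ∷ l) α = raise l (updateAt α i (r ℕ.* degree ∸ 1 ℕ.+_))

    apply-top : ∀ l χ α → apply ⟦ In.top l ⟧ χ α ≈ χ (raise l α)
    apply-top []      χ α = *-identityˡ _
    apply-top (i ∷ l) χ α = trans (apply-power i (r ℕ.* degree ∸ 1) (apply ⟦ In.top l ⟧ χ) α) (apply-top l χ _)

    raise-∉ : ∀ {i} l α → i ∉ l → lookup (raise l α) i ≡ lookup α i
    raise-∉ []          α i∉ = ≡.refl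
    raise-∉ {i} (j ∷ l) α i∉ = ≡.trans (raise-∉ l _ (λ m → i∉ (there m))) (Vec.lookup∘updateAt′ i j (λ { ≡.refl → i∉ (here ≡.refl) }) α)

    raise-∈ : ∀ {i} l α → Unique l → i ∈ l → lookup (raise l α) i ≡ r ℕ.* degree ∸ 1 ℕ.+ lookup α i
    raise-∈ {i} (i ∷ l) α (i∉ ∷ u) (here ≡.refl) = ≡.trans (raise-∉ l _ (All.All¬⇒¬Any i∉)) (Vec.lookup∘updateAt i α)
    raise-∈ {i} (j ∷ l) α (j∉ ∷ u) (there m)     = ≡.trans (raise-∈ l _ u m)
      (≡.cong (r ℕ.* degree ∸ 1 ℕ.+_) (Vec.lookup∘updateAt′ i j (λ { ≡.refl → All.lookup j∉ m ≡.refl }) α))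

    raise-corner : raise (ascending n) (replicate n 0) ≡ corner
    raise-corner = ≡.trans (≡.sym (Vec.tabulate∘lookup _)) (≡.trans (Vec.tabulate-cong λ i →
      ≡.trans (raise-∈ (ascending n) _ (ascending-unique n) (ascending-complete i))
      (≡.trans (≡.trans (≡.cong (r ℕ.* degree ∸ 1 ℕ.+_) (Vec.lookup-replicate i 0)) (ℕ.+-identityʳ _)) (≡.sym (Vec.lookup-replicate i _))))
      (Vec.tabulate∘lookup corner))

    -- Evaluated at the exponent 0, `In.top` reads `χ₀` at the corner, where it is 1.
    top∉𝔧 : ∀ a → Annihilator χ₀ (con a ⊛ In.top (ascending n)) → a ≈ 0#
    top∉𝔧 a h = trans (sym (trans (*-congˡ (trans (apply-top (ascending n) χ₀ (replicate n 0))
      (trans (reflexive (≡.cong χ₀ raise-corner)) χ₀-corner))) (*-identityʳ a))) (h (replicate n 0))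

    ascending-transposed : ∀ {i j : Fin n} → i ≢ j → map (transpose i j ⟨$⟩ʳ_) (ascending n) ↭ ascending n
    ascending-transposed i≢j with located i≢j
    ... | A , B , C , s , t , e , e′ = ≡.subst₂ _↭_ (≡.sym e′) (≡.sym e) (Perm.++⁺ˡ A
      (Perm.↭-trans (Perm.prep t (Perm.shift s B C)) (Perm.↭-trans (Perm.swap t s Perm.refl) (Perm.prep s (Perm.↭-sym (Perm.shift t B C))))))

    constantTerm-elem : ∀ k l → Ω.constantTerm ⟦ elem (suc k) (map y l) ⟧ ≈ 0#
    constantTerm-elem k []      = refl
    constantTerm-elem k (i ∷ l) = trans (+-cong (constantTerm-elem k l)
        (trans (-‿cong (trans (*-congʳ (vanish r 1≤r)) (zeroˡ _))) (AbelianGroupProperties.ε⁻¹≈ε +-abelianGroup))) (+-identityˡ _)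
      where
      vanish : ∀ m → 1 ≤ m → Ω.constantTerm ⟦ x i ^ᴾ m ⟧ ≈ 0#
      vanish (suc m) _ = zeroˡ _

    elem∈ : ∀ k → Annihilator φ (elem (suc k) (map y (ascending n)))
    elem∈ k = kill cancel halve ⟦ elem (suc k) (map y (ascending n)) ⟧ (λ 2≤r j → act-rotate-elem 2≤r j (suc k) (ascending n))
      (λ {i} {j} i≢j → O.trans (act-elem (transpose i j) (suc k) (ascending n)) (elem-↭ (Perm.map⁺ y (ascending-transposed i≢j)) (suc k)))
      (constantTerm-elem k (ascending n))

    map-ʳ++ : ∀ l {m} → map y l ʳ++ map y m ≡ map y (l ʳ++ m)
    map-ʳ++ []      = ≡.refl
    map-ʳ++ (i ∷ l) {m} = map-ʳ++ l {i ∷ m}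

    sum∈ : ∀ k → Annihilator φ (∑ (map y (ascending n)) (λ t → t ^ᴾ suc k))
    sum∈ k = null-resp (∑-↭ {map y (descending n)} {map y (ascending n)} (Perm.↭-sym (≡.subst₂ _↭_ (map-ʳ++ (descending n)) (++-identityʳ _) (ʳ++-↭ (map y (descending n)) []))) (λ t → t ^ᴾ suc k))
        (contracted (powerSum∈ k) [])

    powers-0 : ∀ L → In.powers 0 L P.≈ P.1#
    powers-0 []      = P.refl
    powers-0 (t ∷ L) = P.trans (P.*-identityˡ _) (powers-0 L)

    invertᴾ = invert invertᴷ

    -- `φ` is the Vandermonde product applied to `χ₀`, so `faithful` only unfolds its definition; no
    -- variable is dead yet, hence padding 0.
    coinvariant : In.Coinvariant 1≤r invertᴾ Ω.con-cong (annihilator-isIdeal χ₀) power∈𝔧 top∉𝔧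
                    (Annihilator φ) (map y (ascending n)) (In.top [])
    coinvariant = record
      { elems = elem∈
      ; sums = sum∈
      ; padding = 0
      ; padded = ≡.trans (ℕ.+-identityʳ _) (length-map y (ascending n))
      ; faithful = λ {h} p α → trans (sym (sound (O.sym (O.*-congˡ {⟦ h ⟧} (O.trans (O.*-congˡ {⟦ V ⟧} (O.trans (O.*-identityʳ _) (powers-0 (map y (ascending n))))) (O.*-identityʳ ⟦ V ⟧)))) χ₀ α)) (p α) }
      where V = vandermonde (map y (ascending n))

    deads-entries : ∀ J ρ → In.deads (entries J ρ) ≡ []
    deads-entries J []      = ≡.refl
    deads-entries J (i ∷ ρ) with lookup J i
    ... | inside  = deads-entries J ρ
    ... | outside = deads-entries J ρ

    independentᴾ : ∀ J → In.Independent (λ a → 𝒜 n r (J , a)) (Annihilator φ) (preFactor (entries J (descending n)) [])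
    independentᴾ J k as u b h = In.independent 1≤r invertᴾ Ω.con-cong (annihilator-isIdeal χ₀) power∈𝔧 top∉𝔧 ascending-complete
      (tree J) (annihilator-isIdeal φ)
      (≡.subst₂ (In.Coinvariant 1≤r invertᴾ Ω.con-cong (annihilator-isIdeal χ₀) power∈𝔧 top∉𝔧 (Annihilator φ))
        (≡.sym (≡.trans (≡.cong (_ʳ++ []) (active-entries J (descending n))) (map-ʳ++ (descending n))))
        (≡.cong (λ l → In.top (l ʳ++ [])) (≡.sym (deads-entries J (descending n)))) coinvariant)
      k as u (λ m → staircase⇒box {J} (b m)) (null-resp (P.*-congˡ {In.combination k as} (P.sym (P.*-identityʳ (preFactor (entries J (descending n)) [])))) h)

  Index : Set
  Index = Subset n × Vec ℕ n

  private
    -- For a descending list the factors stand in increasing order, and splitting off the head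
    -- leaves `θ p` on the right, where `ι*-*θ` applies.
    θ-products : (Fin n → O.Carrier) → List (Fin n) → O.Carrier
    θ-products f []      = O.1#
    θ-products f (i ∷ ρ) = θ-products f ρ Ω.* f i

    θ-products-descending : ∀ {m} (ι : Fin m → Fin n) f → θ-products f (map ι (descending m)) O.≈ Vector.foldr Ω._*_ Ω.1Ω (λ i → f (ι i))
    θ-products-descending {zero}  ι f = O.refl
    θ-products-descending {suc m} ι f = O.trans (O.reflexive (≡.cong (θ-products f) (≡.trans (map-++ ι (map suc (descending m)) (zero ∷ []))
        (≡.cong (_++ ι zero ∷ []) (≡.sym (map-∘ (descending m)))))))
      (O.trans (last (map (λ i → ι (suc i)) (descending m)) (ι zero)) (O.*-congˡ (θ-products-descending (λ i → ι (suc i)) f)))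
      where
      last : ∀ ρ z → θ-products f (ρ ++ z ∷ []) O.≈ f z Ω.* θ-products f ρ
      last []      z = O.trans (O.*-identityˡ _) (O.sym (O.*-identityʳ _))
      last (i ∷ ρ) z = O.trans (O.*-congʳ (last ρ z)) (O.*-assoc _ _ _)

  Θ : List (Fin n) → Subset n → O.Carrier
  Θ ρ J = θ-products (λ i → Ω.θ-factor (lookup J i) i) ρ

  partialSum : (Index → Carrier) → Poly → List (Fin n) → List Index → O.Carrier
  partialSum a U ρ []             = O.0#
  partialSum a U ρ ((J , α) ∷ is) = ⟦ con (a (J , α)) ⊛ monomial x α ⊛ U ⟧ Ω.* Θ ρ J Ω.+ partialSum a U ρ is

  Covers : List (Fin n) → List Poly → Set c
  Covers S A = ∀ p → p ∈ S → y p ∈ A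

  -- Only fields that vanish at the positions already treated remain available.
  Live : List (Fin n) → O.Carrier → Set (c ⊔ ℓ)
  Live S f = ∀ L → All (Covers S) L → Null (ι* (map (radial 0) L) f)

  contracted⇒live : ∀ {f} → Contracted f → Live [] f
  contracted⇒live h []      _        = h []
  contracted⇒live {f} h (A ∷ L) (_ ∷ q) = contracted⇒live {ι (radial 0 A) f} (contracted-ι A 0 {f} h) L q

  live-resp : ∀ {S f g} → f O.≈ g → Live S f → Live S g
  live-resp e h L q = null-resp (ι*-cong (map (radial 0) L) e) (h L q)

  private
    vanishing : ∀ {p S L} → All (Covers (p ∷ S)) L → All (λ E → E p P.≈ P.0#) (map (radial 0) L)
    vanishing []      = []
    vanishing {p} (h ∷ hs) = O.trans (O.*-congˡ (O.trans (O.*-congˡ (comonic-root (h _ (here ≡.refl)))) (O.zeroʳ _))) (O.zeroʳ _) ∷ vanishing hs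

    null-*θ : ∀ {p S} L → All (Covers (p ∷ S)) L → ∀ f → Null (ι* (map (radial 0) L) (f Ω.* Ω.θ p))
    null-*θ {p} L h f = null-resp (O.sym (ι*-*θ p (map (radial 0) L) (vanishing h) f))
      (apply-0 (ι* (map (radial 0) L) f) λ _ → refl)

    cancelʳ : ∀ {f g} → Null (f Ω.+ g) → Null g → Null f
    cancelʳ {f} {g} h h′ = null-resp (O.trans (O.+-assoc f g (Ω.- g)) (O.trans (O.+-congˡ (O.-‿inverseʳ g)) (O.+-identityʳ f)))
      (null-+ {f Ω.+ g} {Ω.- g} h (null-neg {g} h′))

  -- The fields still available vanish at `p`, so they leave `θ p` standing on the right, and θ acts
  -- by 0 on functionals.
  live-outside : ∀ {p S f g} → Live S (f Ω.+ g Ω.* Ω.θ p) → Live (p ∷ S) f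
  live-outside {p} {S} {f} {g} h L q = cancelʳ {ι* L′ f} {ι* L′ (g Ω.* Ω.θ p)}
      (null-resp (O.reflexive (ι*-+ L′ f (g Ω.* Ω.θ p))) (h L (All.map (λ k _ m → k _ (there m)) q))) (null-*θ {p} {S} L q g)
    where L′ = map (radial 0) L

  -- One contraction turns `θ p` into the value of the field at `p`. The term in which it hits `g`
  -- instead keeps `θ p` and dies as before; the parity put on `g` is undone by `null-parity`.
  live-inside : ∀ {p S g} → Live S (g Ω.* Ω.θ p) → Live (p ∷ S) (g Ω.* ⟦ radial 0 (map y S) p ⟧)
  live-inside {p} {S} {g} h L q = null-resp (ι*-cong L′ (parity-involutive (g Ω.* ⟦ D p ⟧)))
      (null-parity L′ (parity (g Ω.* ⟦ D p ⟧)) (cancelʳ {ι* L′ (parity g Ω.* parity ⟦ D p ⟧)} {ι* L′ (ι D g Ω.* Ω.θ p)}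
        (null-resp (O.trans (ι*-cong L′ (O.trans (O.+-comm _ _) (O.+-congʳ (O.*-congˡ (O.reflexive (≡.sym (parity-⟦⟧ (D p))))))))
            (O.reflexive (ι*-+ L′ (parity g Ω.* parity ⟦ D p ⟧) (ι D g Ω.* Ω.θ p))))
          (h (map y S ∷ L) ((λ _ → ∈-map⁺ y) ∷ All.map (λ k _ m → k _ (there m)) q)))
        (null-*θ {p} {S} L q (ι D g))))
    where
    D = radial 0 (map y S)
    L′ = map (radial 0) L

  private
    module _ (a : Index → Carrier) where

      outs ins : Fin n → List Index → List Index
      outs p = filter (λ (J , _) → lookup J p Bool.≟ outside)
      ins  p = filter (λ (J , _) → lookup J p Bool.≟ inside)

      split : ∀ U p ρ is → partialSum a U (p ∷ ρ) is O.≈ partialSum a U ρ (outs p is) Ω.+ partialSum a U ρ (ins p is) Ω.* Ω.θ p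
      split U p ρ []             = O.sym (O.trans (O.+-congˡ (O.zeroˡ _)) (O.+-identityʳ _))
      split U p ρ ((J , α) ∷ is) with lookup J p
      ... | outside = O.trans (O.+-cong (O.*-congˡ (O.*-identityʳ _)) (split U p ρ is)) (O.sym (O.+-assoc _ _ _))
      ... | inside  = O.trans (O.+-cong (O.sym (O.*-assoc _ _ _)) (split U p ρ is))
        (O.trans (O.sym (O.+-assoc _ _ _)) (O.trans (O.+-congʳ (O.+-comm _ _)) (O.trans (O.+-assoc _ _ _) (O.+-congˡ (O.sym (O.distribʳ _ _ _))))))

      partialSum-0 : ∀ U ρ is → (∀ {i} → i ∈ is → a i ≈ 0#) → partialSum a U ρ is O.≈ O.0#
      partialSum-0 U ρ []             h = O.refl
      partialSum-0 U ρ ((J , α) ∷ is) h = O.trans (O.+-cong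
          (O.trans (O.*-congʳ (O.trans (O.*-congʳ (O.trans (O.*-congʳ (Ω.con-cong (h (here ≡.refl)))) (O.zeroˡ _))) (O.zeroˡ _))) (O.zeroˡ _))
          (partialSum-0 U ρ is (λ m → h (there m)))) (O.+-identityˡ _)

      partialSum-* : ∀ U V ρ is → partialSum a U ρ is Ω.* ⟦ V ⟧ O.≈ partialSum a (U ⊛ V) ρ is
      partialSum-* U V ρ []             = O.zeroˡ _
      partialSum-* U V ρ ((J , α) ∷ is) = O.trans (O.distribʳ _ _ _) (O.+-cong
        (O.trans (O.*-assoc _ _ _) (O.trans (O.*-congˡ (O.sym (central V _))) (O.trans (O.sym (O.*-assoc _ _ _)) (O.*-congʳ (O.*-assoc _ _ _)))))
        (partialSum-* U V ρ is))

      partialSum-combination : ∀ U J αs → partialSum a U [] (map (J ,_) αs) O.≈ ⟦ In.combination (λ α → a (J , α)) αs ⊛ U ⟧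
      partialSum-combination U J []       = O.sym (O.zeroˡ _)
      partialSum-combination U J (α ∷ αs) = O.trans (O.+-cong (O.*-identityʳ _) (partialSum-combination U J αs)) (O.sym (O.distribʳ _ _ _))

      Agree : List (Fin n) → List Index → Set
      Agree ρ is = ∀ {J J′} → J ∈ is → J′ ∈ is → ∀ i → i ∈ ρ ⊎ lookup (proj₁ J) i ≡ lookup (proj₁ J′) i

      subset-agree : ∀ {p ρ b is} → Agree (p ∷ ρ) is → Agree ρ (filter (λ (J , _) → lookup J p Bool.≟ b) is)
      subset-agree {p} {is = is} g m m′ i with ∈-filter⁻ _ {xs = is} m | ∈-filter⁻ _ {xs = is} m′
      ... | k , e | k′ , e′ with g k k′ i
      ...   | inj₁ (here ≡.refl) = inj₂ (≡.trans e (≡.sym e′))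
      ...   | inj₁ (there i∈)    = inj₁ i∈
      ...   | inj₂ e″            = inj₂ e″

      -- `S` holds the positions already treated and `U` the field values collected there. At each
      -- position the part without `θ p` is settled first; everything left then ends in `θ p`, and
      -- one more field can be spent on it.
      vanish : ∀ ρ S U is → Unique is → (∀ {i} → i ∈ is → 𝒜 n r i) → Agree ρ is →
        (∀ {J α} → (J , α) ∈ is → U ⊛ preFactor (entries J ρ) (map y S) P.≈ preFactor (entries J (descending n)) []) →
        Live S (partialSum a U ρ is) → ∀ {i} → i ∈ is → a i ≈ 0#
      vanish [] S U is u b g e h {J , α} m = independentᴾ J (λ α → a (J , α)) αs (Unique.map⁻ (≡.subst Unique same u)) box
            (null-resp (O.trans (O.reflexive (≡.cong (partialSum a U []) same)) (O.trans (partialSum-combination U J αs)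
              (O.*-congˡ (O.trans (O.sym (O.*-identityʳ _)) (e m))))) (h [] []))
            (∈-map⁺ proj₂ m)
        where
        αs = map proj₂ is
        J≡ : ∀ {K} → K ∈ is → proj₁ K ≡ J
        J≡ {K} k = ≡.trans (≡.sym (Vec.tabulate∘lookup _)) (≡.trans (Vec.tabulate-cong (λ i → agree {i} (g k m i))) (Vec.tabulate∘lookup J))
          where
          agree : ∀ {i} → i ∈ [] ⊎ lookup (proj₁ K) i ≡ lookup J i → lookup (proj₁ K) i ≡ lookup J i
          agree (inj₂ e) = e
        same : is ≡ map (J ,_) αs
        same = ≡.trans (≡.sym (map-id is)) (≡.trans (map-cong-local {xs = is} (All.tabulate λ {K} k → ≡.cong (_, proj₂ K) (J≡ k))) (map-∘ is))
        box : ∀ {β} → β ∈ αs → 𝒜 n r (J , β)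
        box m′ with ∈-map⁻ proj₂ m′
        ... | (K , β) , k , ≡.refl = ≡.subst (λ K → 𝒜 n r (K , β)) (J≡ k) (b k)
      vanish (p ∷ ρ) S U is u b g e h = all
        where
        D = radial 0 (map y S) p
        out∈ : ∀ {i} → i ∈ outs p is → a i ≈ 0#
        out∈ = vanish ρ (p ∷ S) U (outs p is) (Unique.filter⁺ _ u) (λ m → b (proj₁ (∈-filter⁻ _ {xs = is} m))) (subset-agree g)
          (λ {J} m → let k , o = ∈-filter⁻ _ {xs = is} m in
            ≡.subst (λ μ → U ⊛ preFactor ((p , sideMark μ) ∷ entries J ρ) (map y S) P.≈ preFactor (entries J (descending n)) []) o (e k))
          (live-outside {g = partialSum a U ρ (ins p is)} (live-resp (split U p ρ is) h))
        in∈ : ∀ {i} → i ∈ ins p is → a i ≈ 0#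
        in∈ = vanish ρ (p ∷ S) (U ⊛ D) (ins p is) (Unique.filter⁺ _ u) (λ m → b (proj₁ (∈-filter⁻ _ {xs = is} m))) (subset-agree g)
          (λ {J} m → let k , o = ∈-filter⁻ _ {xs = is} m in O.trans (O.trans (O.*-assoc _ _ _) (O.*-congˡ (O.*-congʳ D≈)))
            (≡.subst (λ μ → U ⊛ preFactor ((p , sideMark μ) ∷ entries J ρ) (map y S) P.≈ preFactor (entries J (descending n)) []) o (e k)))
          (live-resp (partialSum-* U D ρ (ins p is)) (live-inside {g = partialSum a U ρ (ins p is)}
            (live-resp (O.trans (split U p ρ is) (O.trans (O.+-congʳ (partialSum-0 U ρ (outs p is) out∈)) (O.+-identityˡ _))) h)))
          where
          -- The weight r - 1 of an element of `J` leaves a single `x p` in `preFactor`, the same as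
          -- in the field.
          D≈ : D P.≈ x p ^ᴾ (r ∸ (r ∸ 1)) ⊛ comonic (map y S) (y p)
          D≈ = O.*-cong (O.trans (O.sym (O.*-identityʳ _)) (O.reflexive (≡.cong (λ k → ⟦ x p ^ᴾ k ⟧) (≡.sym (ℕ.m∸[m∸n]≡n 1≤r))))) (O.*-identityˡ _)
        all : ∀ {i} → i ∈ is → a i ≈ 0#
        all {J , α} m = by (lookup J p) ≡.refl
          where
          by : ∀ b → lookup J p ≡ b → a (J , α) ≈ 0#
          by outside o = out∈ (∈-filter⁺ _ m o)
          by inside  o = in∈ (∈-filter⁺ _ m o)

      partialSum-all : ∀ is → linearCombination (Ω.SR r ζ) Ω.monomial a is O.≈ partialSum a P.1# (descending n) is
      partialSum-all []             = O.refl
      partialSum-all ((J , α) ∷ is) = O.+-cong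
        (O.trans (O.sym (O.*-assoc _ _ _)) (O.*-cong (O.trans (O.*-congˡ (O.reflexive (≡.sym (⟦monomial⟧ α)))) (O.sym (O.*-identityʳ _)))
          (O.sym (O.trans (O.reflexive (≡.cong (θ-products _) (≡.sym (map-id (descending n))))) (θ-products-descending (λ i → i) _)))))
        (partialSum-all is)

  independent : ∀ a is → Unique is → All (𝒜 n r) is → Ω.SI r ζ (linearCombination (Ω.SR r ζ) Ω.monomial a is Ω.- O.0#) →
                All (λ i → a i ≈ 0#) is
  independent a is u b h = All.tabulate (vanish a (descending n) [] P.1# is u (All.lookup b) (λ _ _ i → inj₁ (descending-complete i))
    (λ _ → O.*-identityˡ _)
    (contracted⇒live (contracted-resp (O.trans (O.trans (O.+-congˡ (AbelianGroupProperties.ε⁻¹≈ε O.+-abelianGroup)) (O.+-identityʳ _)) (partialSum-all a is)) (contracted h))))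

-- Scalars

module RealNumbers where

  open Real using (seq; cauchy; Null)
  open CommutativeRing Real.commutativeRing using (_≈_; _*_; _+_; 0#)

  pointwise : ∀ {a b} → (∀ k → seq a k ≡ seq b k) → a ≈ b
  pointwise {a} {b} e ε ε>0 = 0 , λ k _ → ≡.subst (λ q → ∣ q ∣ ℚ.< ε)
    (≡.sym (≡.trans (≡.cong (ℚ._- seq b k) (e k)) (ℚ.+-inverseʳ (seq b k)))) ε>0

  private
    minus-0 : ∀ q → q ℚ.- 0ℚ ≡ q
    minus-0 q = ℚ.+-identityʳ q

    null⇒≈0 : ∀ {a} → Null (seq a) → a ≈ 0#
    null⇒≈0 {a} h ε ε>0 = let N , p = h ε ε>0 in N , λ k l → ≡.subst (λ q → ∣ q ∣ ℚ.< ε) (≡.sym (minus-0 (seq a k))) (p k l)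

    ≈0⇒null : ∀ {a} → a ≈ 0# → Null (seq a)
    ≈0⇒null {a} h ε ε>0 = let N , p = h ε ε>0 in N , λ k l → ≡.subst (λ q → ∣ q ∣ ℚ.< ε) (minus-0 (seq a k)) (p k l)

    half-pos : ∀ {ε} → 0ℚ ℚ.< ε → 0ℚ ℚ.< ε ℚ.* ½
    half-pos {ε} ε>0 = ≡.subst (ℚ._< ε ℚ.* ½) (ℚ.*-zeroˡ ½) (ℚ.*-monoˡ-<-pos ½ ε>0)

    halves : ∀ ε → ε ℚ.* ½ ℚ.+ ε ℚ.* ½ ≡ ε
    halves ε = ≡.trans (≡.sym (ℚ.*-distribˡ-+ ε ½ ½)) (ℚ.*-identityʳ ε)

    half-< : ∀ {ε} → 0ℚ ℚ.< ε → ε ℚ.* ½ ℚ.< ε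
    half-< {ε} ε>0 = ≡.subst₂ ℚ._<_ (ℚ.+-identityʳ (ε ℚ.* ½)) (halves ε) (ℚ.+-monoʳ-< (ε ℚ.* ½) (half-pos ε>0))

    triangle-inequality : ∀ a b → ∣ a ∣ ℚ.≤ ∣ b ∣ ℚ.+ ∣ a ℚ.- b ∣
    triangle-inequality a b = ≡.subst (λ q → ∣ q ∣ ℚ.≤ ∣ b ∣ ℚ.+ ∣ a ℚ.- b ∣)
      (≡.trans (ℚ.+-comm b (a ℚ.- b)) (≡.trans (ℚ.+-assoc a (ℚ.- b) b) (≡.trans (≡.cong (a ℚ.+_) (ℚ.+-inverseˡ b)) (ℚ.+-identityʳ a))))
      (ℚ.∣p+q∣≤∣p∣+∣q∣ b (a ℚ.- b))

    product-≥ : ∀ a b {δ η} → 0ℚ ℚ.< δ → δ ℚ.≤ ∣ a ∣ → η ℚ.≤ ∣ b ∣ → δ ℚ.* η ℚ.≤ ∣ a ℚ.* b ∣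
    product-≥ a b {δ} {η} δ>0 p q = begin
      δ ℚ.* η          ≤⟨ ℚ.*-monoˡ-≤-nonNeg δ q ⟩
      δ ℚ.* ∣ b ∣      ≤⟨ ℚ.*-monoʳ-≤-nonNeg ∣ b ∣ p ⟩
      ∣ a ∣ ℚ.* ∣ b ∣  ≡⟨ ℚ.∣p*q∣≡∣p∣*∣q∣ a b ⟨
      ∣ a ℚ.* b ∣      ∎
      where
      open ℚ.≤-Reasoning
      instance
        _ = ℚ.pos⇒nonNeg δ {{ℚ.positive δ>0}}
        _ = ℚ.∣-∣-nonNeg b

    product-pos : ∀ {δ η} → 0ℚ ℚ.< δ → 0ℚ ℚ.< η → 0ℚ ℚ.< δ ℚ.* η
    product-pos {δ} {η} p q = ℚ.positive⁻¹ (δ ℚ.* η) {{ℚ.pos*pos⇒pos δ {{ℚ.positive p}} η {{ℚ.positive q}}}}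

    -- A Cauchy sequence with an entry of absolute value ≥ ε / 2 far out
    -- stays away from 0.
    null-or-apart : ∀ {a b} → Null (seq (a * b)) → ¬ Null (seq a) → Null (seq b)
    null-or-apart {a} {b} h ¬a ε ε>0 with cauchy b (ε ℚ.* ½ ℚ.* ½) (half-pos (half-pos ε>0))
    ... | N , c with ∣ seq b N ∣ ℚ.<? ε ℚ.* ½
    ...   | yes small = N , λ k l → ℚ.≤-<-trans (triangle-inequality (seq b k) (seq b N))
              (≡.subst (∣ seq b N ∣ ℚ.+ ∣ seq b k ℚ.- seq b N ∣ ℚ.<_) (halves ε)
                (ℚ.+-mono-< small (ℚ.<-trans (c k N l ℕ.≤-refl) (half-< (half-pos ε>0)))))
    ...   | no large  = contradiction a-null ¬a
      where
      η = ε ℚ.* ½ ℚ.* ½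
      apart : ∀ k → N ℕ.≤ k → η ℚ.≤ ∣ seq b k ∣
      apart k l = ℚ.≮⇒≥ λ lt → large (ℚ.≤-<-trans (triangle-inequality (seq b N) (seq b k))
        (≡.subst (∣ seq b k ∣ ℚ.+ ∣ seq b N ℚ.- seq b k ∣ ℚ.<_) (halves (ε ℚ.* ½)) (ℚ.+-mono-< lt (c N k ℕ.≤-refl l))))
      a-null : Null (seq a)
      a-null δ δ>0 with h (δ ℚ.* η) (product-pos δ>0 (half-pos (half-pos ε>0)))
      ... | M , p = N ℕ.⊔ M , λ k l → ℚ.≰⇒> λ le → ℚ.<-irrefl ≡.refl (ℚ.<-≤-trans (p k (ℕ.m⊔n≤o⇒n≤o N M l))
              (product-≥ (seq a k) (seq b k) δ>0 le (apart k (ℕ.m⊔n≤o⇒m≤o N M l))))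

    square-nonNeg : ∀ q → 0ℚ ℚ.≤ q ℚ.* q
    square-nonNeg q = ≡.subst (0ℚ ℚ.≤_) (square (ℚ.∣p∣≡p∨∣p∣≡-p q)) (ℚ.nonNegative⁻¹ (∣ q ∣ ℚ.* ∣ q ∣)
        {{ℚ.nonNeg*nonNeg⇒nonNeg (∣ q ∣) {{ℚ.∣-∣-nonNeg q}} (∣ q ∣) {{ℚ.∣-∣-nonNeg q}}}})
      where
      open import Algebra.Properties.Ring (CommutativeRing.ring ℚ.+-*-commutativeRing) using (-‿distribˡ-*; -‿distribʳ-*)
      open AbelianGroupProperties ℚ.+-0-abelianGroup using (⁻¹-involutive)
      open import Data.Sum.Base using (_⊎_)
      square : ∣ q ∣ ≡ q ⊎ ∣ q ∣ ≡ ℚ.- q → ∣ q ∣ ℚ.* ∣ q ∣ ≡ q ℚ.* q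
      square (inj₁ e) = ≡.cong₂ ℚ._*_ e e
      square (inj₂ e) = ≡.trans (≡.cong₂ ℚ._*_ e e) (≡.trans (≡.sym (-‿distribˡ-* q (ℚ.- q)))
        (≡.trans (≡.cong ℚ.-_ (≡.sym (-‿distribʳ-* q q))) (⁻¹-involutive (q ℚ.* q))))

    squares-null : ∀ {a b} → Null (seq (a * a + b * b)) → Null (seq a)
    squares-null {a} {b} h δ δ>0 with h (δ ℚ.* δ) (product-pos δ>0 δ>0)
    ... | N , p = N , λ k l → ℚ.≰⇒> λ le → ℚ.<-irrefl ≡.refl (ℚ.<-≤-trans (p k l) (bound k le))
      where
      bound : ∀ k → δ ℚ.≤ ∣ seq a k ∣ → δ ℚ.* δ ℚ.≤ ∣ seq (a * a + b * b) k ∣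
      bound k le = begin
        δ ℚ.* δ                                         ≤⟨ product-≥ (seq a k) (seq a k) δ>0 le le ⟩
        ∣ seq a k ℚ.* seq a k ∣                         ≡⟨ ℚ.0≤p⇒∣p∣≡p a² ⟩
        seq a k ℚ.* seq a k                             ≡⟨ ℚ.+-identityʳ _ ⟨
        seq a k ℚ.* seq a k ℚ.+ 0ℚ                      ≤⟨ ℚ.+-monoʳ-≤ (seq a k ℚ.* seq a k) (square-nonNeg (seq b k)) ⟩
        seq a k ℚ.* seq a k ℚ.+ seq b k ℚ.* seq b k     ≡⟨ ℚ.0≤p⇒∣p∣≡p (ℚ.+-mono-≤ a² (square-nonNeg (seq b k))) ⟨
        ∣ seq (a * a + b * b) k ∣                       ∎
        where
        open ℚ.≤-Reasoning
        a² = square-nonNeg (seq a k)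

  integral : NoZeroDivisors Real.commutativeRing
  integral {a} {b} h ¬a = null⇒≈0 {b} (null-or-apart {a} {b} (≈0⇒null {a * b} h) (λ z → ¬a (null⇒≈0 {a} z)))

  squares-0 : SquaresVanish Real.commutativeRing
  squares-0 {a} {b} h = null⇒≈0 {a} (squares-null {a} {b} (≈0⇒null {a * a + b * b} h))

module GaussianIntegrality {c ℓ : Level} (R : CommutativeRing c ℓ)
         (integral : NoZeroDivisors R)
         (squares-0 : SquaresVanish R) where

  open CommutativeRing R
  private
    module G = CommutativeRing (GaussianExtension.commutativeRing R)
  open IntegerSolver R using (solve; _:=_; _:+_; _:*_; _:-_)
  open RingProperties G.ring using (-1*x≈-x)
  open AbelianGroupProperties G.+-abelianGroup using (x∙y⁻¹≈ε⇒x≈y)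

  -- Multiply by the conjugate of w.
  gaussian-integral : ∀ {w z} → w G.* z G.≈ G.0# → ¬ (w G.≈ G.0#) → z G.≈ G.0#
  gaussian-integral {a , b} {c , d} (re , im) ¬w = integral real ¬norm , integral imaginary ¬norm
    where
    ¬norm : ¬ (a * a + b * b ≈ 0#)
    ¬norm e = ¬w (squares-0 e , squares-0 (trans (+-comm _ _) e))
    real : (a * a + b * b) * c ≈ 0#
    real = trans (solve 4 (λ a b c d → (a :* a :+ b :* b) :* c := a :* (a :* c :- b :* d) :+ b :* (a :* d :+ b :* c)) refl a b c d)
      (trans (+-cong (trans (*-congˡ re) (zeroʳ a)) (trans (*-congˡ im) (zeroʳ b))) (+-identityˡ 0#))
    imaginary : (a * a + b * b) * d ≈ 0#
    imaginary = trans (solve 4 (λ a b c d → (a :* a :+ b :* b) :* d := a :* (a :* d :+ b :* c) :- b :* (a :* c :- b :* d)) refl a b c d)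
      (trans (+-cong (trans (*-congˡ im) (zeroʳ a)) (-‿cong (trans (*-congˡ re) (zeroʳ b)))) (-‿inverseʳ 0#))

  gaussian-cancel : ∀ {w z} → w G.* z G.≈ z → ¬ (w G.≈ G.1#) → z G.≈ G.0#
  gaussian-cancel {w} {z} e ¬1 = gaussian-integral
    (G.trans (G.distribʳ z w (G.- G.1#)) (G.trans (G.+-cong e (-1*x≈-x z)) (G.-‿inverseʳ z)))
    (λ h → ¬1 (x∙y⁻¹≈ε⇒x≈y w G.1# h))

module ComplexNumbers where

  private
    module R = CommutativeRing Real.commutativeRing
  open CommutativeRing ℂ hiding (zero)
  open RealNumbers
  open Mult +-monoid using () renaming (_×_ to _·_)
  open Real using (seq; fromℚ)

  complex-cancel : ∀ w z → w * z ≈ z → ¬ (w ≈ 1#) → z ≈ 0#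
  complex-cancel w z = GaussianIntegrality.gaussian-cancel Real.commutativeRing
    (λ {a} {b} → integral {a} {b}) (λ {a} {b} → squares-0 {a} {b}) {w} {z}

  -- The recursion is that of `_·_`, so real parts agree with it entry by entry.
  natural : ℕ → ℚ
  natural zero    = 0ℚ
  natural (suc m) = 1ℚ ℚ.+ natural m

  private
    natural-nonNeg : ∀ m → 0ℚ ℚ.≤ natural m
    natural-nonNeg zero    = ℚ.≤-refl
    natural-nonNeg (suc m) = ℚ.+-mono-≤ {0ℚ} {1ℚ} (ℚ.nonNegative⁻¹ 1ℚ) (natural-nonNeg m)

    real-part : ∀ m k → seq (proj₁ (m · 1#)) k ≡ natural m
    real-part zero    k = ≡.refl
    real-part (suc m) k = ≡.cong (1ℚ ℚ.+_) (real-part m k)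

    imaginary-part : ∀ m k → seq (proj₂ (m · 1#)) k ≡ 0ℚ
    imaginary-part zero    k = ≡.refl
    imaginary-part (suc m) k = ≡.trans (ℚ.+-identityˡ _) (imaginary-part m k)

  complex-invert : InvertibleNaturals ℂ
  complex-invert m = (fromℚ q , R.0#)
      , pointwise {proj₁ ((fromℚ q , R.0#) * (suc m · 1#))} {R.1#} re
      , pointwise {proj₂ ((fromℚ q , R.0#) * (suc m · 1#))} {R.0#} im
    where
    instance
      nonZero : ℚ.NonZero (natural (suc m))
      nonZero = ℚ.pos⇒nonZero (natural (suc m)) {{ℚ.positive (ℚ.+-mono-<-≤ {0ℚ} {1ℚ} (ℚ.positive⁻¹ 1ℚ) (natural-nonNeg m))}}
    q = ℚ.1/ natural (suc m)
    re : ∀ k → q ℚ.* seq (proj₁ (suc m · 1#)) k ℚ.+ ℚ.- (0ℚ ℚ.* seq (proj₂ (suc m · 1#)) k) ≡ 1ℚ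
    re k = ≡.trans (≡.cong₂ (λ s t → q ℚ.* s ℚ.+ ℚ.- t) (real-part (suc m) k) (ℚ.*-zeroˡ (seq (proj₂ (suc m · 1#)) k)))
      (≡.trans (ℚ.+-identityʳ (q ℚ.* natural (suc m))) (ℚ.*-inverseˡ (natural (suc m))))
    im : ∀ k → q ℚ.* seq (proj₂ (suc m · 1#)) k ℚ.+ 0ℚ ℚ.* seq (proj₁ (suc m · 1#)) k ≡ 0ℚ
    im k = ≡.trans (≡.cong₂ (λ s t → q ℚ.* s ℚ.+ t) (imaginary-part (suc m) k) (ℚ.*-zeroˡ (seq (proj₁ (suc m · 1#)) k))) (≡.trans (ℚ.+-identityʳ (q ℚ.* 0ℚ)) (ℚ.*-zeroʳ q))

theorem3p21 : (n r : ℕ) → n ≥ 1 → r ≥ 1 →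
    (ζ : CommutativeRing.Carrier ℂ) → IsPrimitiveRoot ℂ r ζ →
    IsBasis (Superspace.SR ℂ n r ζ) (Superspace.monomial ℂ n) (𝒜 n r)
theorem3p21 n r _ 1≤r ζ ζ-primitive = record
  { independent = LinearIndependence.independent ℂ n r 1≤r ζ isRoot complex-invert
      (λ k 0<k k<r z e → complex-cancel (ζ ^ k) z e (minimal k 0<k k<r))
  ; spanning = λ v → let a , is , _ , all , e = SpanningSet.spanned ℂ n r 1≤r ζ isRoot complex-invert v in a , is , all , e }
  where
  open ComplexNumbers
  open Exp (CommutativeRing.semiring ℂ) using (_^_)
  open IsPrimitiveRoot ζ-primitive
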